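{- For an integer $n\ge 3$, let $H(n)$ be the number of equivalence classes of sign sequences of length $n$ that contain a sequence obtainable from $(1,1,1)$ by finitely many extensions. Then $$H(n) = \begin{cases} \displaystyle\sum_{i=0}^{\lfloor (n-2)/6 \rfloor} B\!\left(n, \lceil n/2 \rceil + 1 + 3i\right) & \text{for } n \text{ odd},\\[3mm] \displaystyle -\tfrac{1}{2}B(n,n/2) + \tfrac12 F(n) - 1 + \sum_{i=0}^{\lfloor n/6 \rfloor} B\!\left(n, \lceil n/2 \rceil + 3i\right) & \text{for } n \text{ even},\end{cases}$$ where, for even $n$, $$F(n) = \sum_{k=1}^{n/2} \ \sum_{l \mid \gcd(n/2,k)} L\!\left(\frac{n}{2l},\frac{k}{l}\right) \left\lceil \frac{k}{2l} \right\rceil .$$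
   Context: Hexaflexagons with $n$ faces are encoded by sign sequences $(a_1,\dots,a_n)\in\{1,-1\}^n$. The trihexaflexagon has sign sequence $(1,1,1)$. An extension of a sign sequence replaces some single entry $a_i$ (any position) by the consecutive pair $(-a_i,-a_i)$, producing a sequence of length one greater. Two sign sequences are equivalent if one can be transformed into the other by a combination of cyclic shifts $(a_1,\dots,a_n)\mapsto(a_i,\dots,a_n,a_1,\dots,a_{i-1})$, reversal $(a_1,\dots,a_n)\mapsto(a_n,\dots,a_1)$, and inversion $(a_1,\dots,a_n)\mapsto(-a_1,\dots,-a_n)$. Notation: $B(n,k)$ is the number of binary bracelets of length $n$ with $k$ ones, i.e. the number of equivalence classes of sequences in $\{1,-1\}^n$ with exactly $k$ entries equal to $1$ under cyclic shifts and reversal only (not inversion); $B(n,k)=0$ if $k>n$. $L(n,k)$ is the number of aperiodic binary necklaces (Lyndon words) of length $n$ with $k$ ones, $L(n,k)=\frac1n\sum_{j\mid\gcd(n,k)}\mu(j)\binom{n/j}{k/j}$, with $\mu$ the Möbius function. -}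

module Defs where

open import Data.Bool using (Bool; true; false; _∧_; _∨_; if_then_else_)
open import Data.Nat using (ℕ; zero; suc; _+_; _*_; _∸_; _/_; _≡ᵇ_; _≤_; NonZero; ⌈_/2⌉)
open import Data.Nat.GCD using (gcd)
open import Data.Nat.Divisibility using (_∣?_)
open import Data.List using (List; lookup; []; _∷_; _++_; length; reverse; map; filterᵇ; drop; take; upTo; foldr; filter)
open import Data.Nat.ListAction using (sum)
open import Data.List.Relation.Unary.All using (All)
open import Data.List.Relation.Unary.Any using (Any)
open import Data.Fin using (Fin)
open import Data.Product using (Σ; ∃; _×_; _,_)
open import Relation.Binary.PropositionalEquality using (_≡_)
open import Relation.Binary.Construct.Closure.Equivalence using (EqClosure)
open import Relation.Nullary.Decidable using (does)

data Sign : Set where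
  plus minus : Sign

neg : Sign → Sign
neg plus  = minus
neg minus = plus

SignSeq : Set
SignSeq = List Sign

data Ext : SignSeq → SignSeq → Set where
  ext : (as bs : SignSeq) (a : Sign) →
        Ext (as ++ a ∷ bs) (as ++ neg a ∷ neg a ∷ bs)

data Reachable : SignSeq → Set where
  base : Reachable (plus ∷ plus ∷ plus ∷ [])
  step : ∀ {s t} → Reachable s → Ext s t → Reachable t

data Move : SignSeq → SignSeq → Set where
  shift  : (xs ys : SignSeq) → Move (xs ++ ys) (ys ++ xs)
  revers : (xs : SignSeq) → Move xs (reverse xs)
  invert : (xs : SignSeq) → Move xs (map neg xs)

_≈_ : SignSeq → SignSeq → Set
_≈_ = EqClosure Move

HasClassCount : ℕ → ℕ → Set
HasClassCount n h =
  Σ (List SignSeq) λ reps →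
      length reps ≡ h
    × All (λ r → length r ≡ n × Reachable r) reps
    × (∀ (i j : Fin (length reps)) → lookup reps i ≈ lookup reps j → i ≡ j)
    × (∀ s → length s ≡ n → Reachable s → Any (λ r → s ≈ r) reps)

allSeqs : ℕ → List SignSeq
allSeqs zero    = [] ∷ []
allSeqs (suc n) = map (minus ∷_) (allSeqs n) ++ map (plus ∷_) (allSeqs n)

countPlus : SignSeq → ℕ
countPlus []           = 0
countPlus (plus ∷ xs)  = suc (countPlus xs)
countPlus (minus ∷ xs) = countPlus xs

lexLt : SignSeq → SignSeq → Bool
lexLt []           _            = false
lexLt (_ ∷ _)      []           = false
lexLt (minus ∷ xs) (plus ∷ ys)  = true
lexLt (plus ∷ xs)  (minus ∷ ys) = false
lexLt (minus ∷ xs) (minus ∷ ys) = lexLt xs ys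
lexLt (plus ∷ xs)  (plus ∷ ys)  = lexLt xs ys

lexLe : SignSeq → SignSeq → Bool
lexLe xs ys = lexLt xs ys ∨ eqSeq xs ys
  where
  eqSeq : SignSeq → SignSeq → Bool
  eqSeq []           []           = true
  eqSeq (plus ∷ xs)  (plus ∷ ys)  = eqSeq xs ys
  eqSeq (minus ∷ xs) (minus ∷ ys) = eqSeq xs ys
  eqSeq _            _            = false

rot : ℕ → SignSeq → SignSeq
rot i s = drop i s ++ take i s

allB : {A : Set} → (A → Bool) → List A → Bool
allB p = foldr (λ x b → p x ∧ b) true

-- B(n,k): number of binary bracelets of length n with k ones
-- (orbits under the dihedral group generated by cyclic shifts and reversal),
-- counted via their lexicographically least representatives.

isBraceletRep : SignSeq → Bool
isBraceletRep s =
  allB (λ i → lexLe s (rot i s) ∧ lexLe s (rot i (reverse s))) (upTo (length s))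

B : ℕ → ℕ → ℕ
B n k = length (filterᵇ (λ s → (countPlus s ≡ᵇ k) ∧ isBraceletRep s) (allSeqs n))

-- L(n,k): number of aperiodic binary necklaces (Lyndon words) of length n
-- with k ones: words strictly smaller than all their proper rotations.

isLyndon : SignSeq → Bool
isLyndon s = allB (λ i → lexLt s (rot (suc i) s)) (upTo (length s ∸ 1))

L : ℕ → ℕ → ℕ
L n k = length (filterᵇ (λ s → (countPlus s ≡ᵇ k) ∧ isLyndon s) (allSeqs n))

sumTo : ℕ → (ℕ → ℕ) → ℕ
sumTo N f = sum (map f (upTo (suc N)))

sumFrom1 : ℕ → (ℕ → ℕ) → ℕ
sumFrom1 N f = sum (map (λ i → f (suc i)) (upTo N))

sumDiv : ℕ → (ℕ → ℕ) → ℕ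
sumDiv g f = sum (map (λ i → f (suc i)) (filter (λ i → suc i ∣? g) (upTo g)))

ceilDiv : (a b : ℕ) → .{{NonZero b}} → ℕ
ceilDiv a b = (a + (b ∸ 1)) / b

F : ℕ → ℕ
F n = sumFrom1 (n / 2) λ k →
        sumDiv (gcd (n / 2) k) λ where
          zero → 0   -- never used: divisors l are ≥ 1
          l@(suc _) → L (n / (2 * l)) (k / l) * ceilDiv k (2 * l)

{-# OPTIONS --safe #-}
module Submission where

-- An extension preserves the length plus the number of plus signs modulo 3 and creates two equal
-- neighbours.  Conversely a cyclic word of length at least 4 with two equal neighbours can be contracted
-- so that equal neighbours remain, so the reachable classes are those of the words with
-- n + #plus ≡ 0 (mod 3) that do not alternate cyclically.  For odd n complementation pairs these
-- bracelets off; for even n the balanced ones must be halved, which brings in the number of bracelets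
-- equal to their own complement.  A coset version of Burnside's lemma reduces that number to counting
-- words negated by a reflection (m 2^m of them with n = 2m) and words negated by a rotation.  Passing to
-- cyclic difference words turns the latter into words whose primitive root contains an odd number of plus
-- signs, and 2^(m-1) counts the Lyndon roots of words of length m weighted by their number of plus signs,
-- so the two parts add up to 2 ⌈ j /2⌉ = j + [ j odd ] over Lyndon words with j plus signs: this is F.

open import Defs
open import Data.Bool using (Bool; true; false; T; _∧_; _∨_; if_then_else_)
open import Data.Bool.Properties using (T-∧)
open import Data.Fin using (Fin)
open import Data.List hiding (sum; product; iterate; and; or; all; any; fromMaybe)
open import Data.List.Properties hiding (sum-++)
open import Data.List.Extrema.Nat using (argmin; argmin-all; f[argmin]≤f[xs])
open import Data.List.Membership.Propositional using (_∈_)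
open import Data.List.Membership.Propositional.Properties
open import Data.List.Membership.Propositional.Properties.WithK using (unique∧set⇒bag)
open import Data.List.Relation.Binary.BagAndSetEquality using (∼bag⇒↭)
import Data.List.Relation.Binary.Permutation.Propositional.Properties as Perm
open import Data.List.Relation.Unary.All using (All; []; _∷_)
import Data.List.Relation.Unary.All as All
import Data.List.Relation.Unary.All.Properties as All
open import Data.List.Relation.Unary.AllPairs using (AllPairs; []; _∷_)
open import Data.List.Relation.Unary.Any using (Any; here; there)
import Data.List.Relation.Unary.Any as Any
open import Data.List.Relation.Unary.Unique.Propositional using (Unique)
import Data.List.Relation.Unary.Unique.Propositional.Properties as Unique
open import Data.Nat
open import Data.Nat.DivMod
open import Data.Nat.Divisibility
open import Data.Nat.GCD using (gcd; gcd[m,n]∣m; gcd[m,n]∣n; gcd-greatest)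
open import Data.Nat.Induction using (<-rec)
open import Data.Nat.ListAction using (sum)
open import Data.Nat.ListAction.Properties using (sum-↭; sum-++)
open import Data.Nat.Properties
open import Data.Nat.Tactic.RingSolver using (solve-∀)
open import Data.Product using (Σ; ∃; _×_; _,_; proj₁; proj₂)
open import Data.Sum using (_⊎_; inj₁; inj₂)
open import Function using (_∘_; id; Equivalence; mk⇔)
open import Relation.Binary.Construct.Closure.Equivalence using (EqClosure)
import Relation.Binary.Construct.Closure.Equivalence as EqC
open import Relation.Binary.Definitions using (tri<; tri≈; tri>)
open import Relation.Binary.PropositionalEquality
open import Relation.Nullary using (¬_; Dec; yes; no; does; contradiction)
open import Relation.Nullary.Decidable using (_×-dec_; _→-dec_; _⊎-dec_; ¬?; T?; map′; from-no; dec-true; dec-false)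
open import Relation.Unary using (Decidable)

-- Finite sums and indicators

-- A class is a single bracelet or a bracelet together with its complement. For n = 2m each majority
-- bracelet stands for its class. Balanced words have weight 3m and pass the test modulo 3
-- automatically; their complement orbits number (B(n,m) + F(n)) / 2, and the lone alternating
-- bracelet accounts for the -1. Identities are proved multiplied out in ℕ, so that ℚ enters only at
-- the very end.
--
-- The delicate count is of pairs (word, rotation negating it). If the cyclic difference word is
-- `power l w` with `w` primitive, a negating rotation runs through t copies of `w`. With c the
-- number of `plus` in `w`, the product t c must be odd, while l c is even because the signs close
-- up cyclically. Hence c is odd, l is even, and t takes l / 2 values. A Lyndon root of length p has
-- p rotations and p (l / 2) = m, so every odd Lyndon word whose length divides m contributes m
-- pairs of difference words, hence 2m pairs of words. This is why divisors of n / 2, not of n,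
-- appear in F.

private variable
  A A′ : Set
  P Q : Set

*-left-comm : ∀ a b c → a * (b * c) ≡ b * (a * c)
*-left-comm = solve-∀

n+n≡n*2 : ∀ n → n + n ≡ n * 2
n+n≡n*2 = solve-∀

n+n-injective : ∀ {m n} → m + m ≡ n + n → m ≡ n
n+n-injective {m} {n} eq = *-cancelʳ-≡ m n 2 (trans (sym (n+n≡n*2 m)) (trans eq (n+n≡n*2 n)))

-- Iverson bracket. It inspects only `does`, so decisions with the same underlying Boolean have
-- definitionally equal brackets; `B≡` and `∑-L` use this to trade the Boolean tests of `B` and `L`
-- for `least?` and `lyndon?`.
⟦_⟧ : Dec P → ℕ
⟦ d ⟧ = if does d then 1 else 0

⟦⟧-yes : (d : Dec P) → P → ⟦ d ⟧ ≡ 1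
⟦⟧-yes d p rewrite dec-true d p = refl

⟦⟧-no : (d : Dec P) → ¬ P → ⟦ d ⟧ ≡ 0
⟦⟧-no d ¬p rewrite dec-false d ¬p = refl

⟦⟧-cong : (d : Dec P) (e : Dec Q) → (P → Q) → (Q → P) → ⟦ d ⟧ ≡ ⟦ e ⟧
⟦⟧-cong (yes p) e to from = sym (⟦⟧-yes e (to p))
⟦⟧-cong (no ¬p) e to from = sym (⟦⟧-no e (¬p ∘ from))

⟦⟧-× : (d : Dec P) (e : Dec Q) → ⟦ d ×-dec e ⟧ ≡ ⟦ d ⟧ * ⟦ e ⟧
⟦⟧-× (yes _) (yes _) = refl
⟦⟧-× (yes _) (no _)  = refl
⟦⟧-× (no _)  _       = refl

⟦⟧-*-cong : (d : Dec P) {m n : ℕ} → (P → m ≡ n) → ⟦ d ⟧ * m ≡ ⟦ d ⟧ * n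
⟦⟧-*-cong (yes p) eq = cong (1 *_) (eq p)
⟦⟧-*-cong (no _)  eq = refl

⟦⟧-*-yes : (d : Dec P) {m : ℕ} → P → ⟦ d ⟧ * m ≡ m
⟦⟧-*-yes d {m} p = trans (cong (_* m) (⟦⟧-yes d p)) (*-identityˡ m)

⟦⟧-*-no : (d : Dec P) {m : ℕ} → ¬ P → ⟦ d ⟧ * m ≡ 0
⟦⟧-*-no d {m} ¬p = cong (_* m) (⟦⟧-no d ¬p)

∑ : List A → (A → ℕ) → ℕ
∑ xs f = sum (map f xs)

infixr 6.5 ∑
syntax ∑ xs (λ x → e) = ∑[ x ∈ xs ] e

∑-cong : (xs : List A) {f g : A → ℕ} → (∀ {x} → x ∈ xs → f x ≡ g x) → ∑ xs f ≡ ∑ xs g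
∑-cong []       eq = refl
∑-cong (x ∷ xs) eq = cong₂ _+_ (eq (here refl)) (∑-cong xs (eq ∘ there))

∑-ext : (xs : List A) {f g : A → ℕ} → (∀ x → f x ≡ g x) → ∑ xs f ≡ ∑ xs g
∑-ext xs eq = ∑-cong xs (λ {x} _ → eq x)

∑-zero : (xs : List A) {f : A → ℕ} → (∀ {x} → x ∈ xs → f x ≡ 0) → ∑ xs f ≡ 0
∑-zero []       eq = refl
∑-zero (x ∷ xs) eq = cong₂ _+_ (eq (here refl)) (∑-zero xs (eq ∘ there))

∑-const : (xs : List A) (c : ℕ) → (∑[ x ∈ xs ] c) ≡ length xs * c
∑-const []       c = refl
∑-const (x ∷ xs) c = cong (c +_) (∑-const xs c)

∑-+ : (xs : List A) (f g : A → ℕ) → (∑[ x ∈ xs ] (f x + g x)) ≡ ∑ xs f + ∑ xs g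
∑-+ []       f g = refl
∑-+ (x ∷ xs) f g = trans (cong (f x + g x +_) (∑-+ xs f g)) (shuffle (f x) (g x) _ _)
  where
  shuffle : ∀ a b c d → a + b + (c + d) ≡ a + c + (b + d)
  shuffle = solve-∀

∑-*ˡ : (xs : List A) (c : ℕ) (f : A → ℕ) → (∑[ x ∈ xs ] c * f x) ≡ c * ∑ xs f
∑-*ˡ []       c f = sym (*-zeroʳ c)
∑-*ˡ (x ∷ xs) c f = trans (cong (c * f x +_) (∑-*ˡ xs c f)) (sym (*-distribˡ-+ c (f x) _))

∑-*ʳ : (xs : List A) (c : ℕ) (f : A → ℕ) → (∑[ x ∈ xs ] f x * c) ≡ ∑ xs f * c
∑-*ʳ xs c f = trans (∑-ext xs (λ x → *-comm (f x) c)) (trans (∑-*ˡ xs c f) (*-comm c _))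

∑-comm : (xs : List A) (ys : List A′) (f : A → A′ → ℕ) →
         (∑[ x ∈ xs ] ∑[ y ∈ ys ] f x y) ≡ (∑[ y ∈ ys ] ∑[ x ∈ xs ] f x y)
∑-comm []       ys f = sym (∑-zero ys (λ _ → refl))
∑-comm (x ∷ xs) ys f = trans (cong (∑ ys (f x) +_) (∑-comm xs ys f)) (sym (∑-+ ys (f x) _))

∑-map : (xs : List A) (h : A → A′) (f : A′ → ℕ) → ∑ (map h xs) f ≡ ∑ xs (f ∘ h)
∑-map xs h f = cong sum (sym (map-∘ xs))

∑-++ : (xs ys : List A) (f : A → ℕ) → ∑ (xs ++ ys) f ≡ ∑ xs f + ∑ ys f
∑-++ xs ys f = trans (cong sum (map-++ f xs ys)) (sum-++ (map f xs) (map f ys))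

∑-filter : {R : A → Set} (R? : Decidable R) (xs : List A) (f : A → ℕ) →
           ∑ (filter R? xs) f ≡ (∑[ x ∈ xs ] ⟦ R? x ⟧ * f x)
∑-filter R? []       f = refl
∑-filter R? (x ∷ xs) f with does (R? x)
... | true  = cong₂ _+_ (sym (+-identityʳ (f x))) (∑-filter R? xs f)
... | false = ∑-filter R? xs f

length-filter-∑ : {R : A → Set} (R? : Decidable R) (xs : List A) →
                  length (filter R? xs) ≡ (∑[ x ∈ xs ] ⟦ R? x ⟧)
length-filter-∑ R? xs = begin
  length (filter R? xs)      ≡⟨ *-identityʳ _ ⟨
  length (filter R? xs) * 1  ≡⟨ ∑-const (filter R? xs) 1 ⟨
  (∑[ x ∈ filter R? xs ] 1)  ≡⟨ ∑-filter R? xs (λ _ → 1) ⟩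
  (∑[ x ∈ xs ] ⟦ R? x ⟧ * 1) ≡⟨ ∑-ext xs (λ x → *-identityʳ ⟦ R? x ⟧) ⟩
  (∑[ x ∈ xs ] ⟦ R? x ⟧)     ∎
  where open ≡-Reasoning

∑-single : {xs : List A} {z : A} (f : A → ℕ) → Unique xs → z ∈ xs →
           (∀ {x} → x ∈ xs → x ≢ z → f x ≡ 0) → ∑ xs f ≡ f z
∑-single {xs = x ∷ xs} f (x∉ ∷ _) (here refl) off =
  trans (cong (f x +_) (∑-zero xs (λ y∈ → off (there y∈) (λ { refl → All.lookup x∉ y∈ refl }))))
        (+-identityʳ (f x))
∑-single {xs = x ∷ xs} f (x∉ ∷ u) (there z∈) off =
  cong₂ _+_ (off (here refl) (λ { refl → All.lookup x∉ z∈ refl })) (∑-single f u z∈ (off ∘ there))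

-- The image of `xs` and the list `ys` are duplicate-free with the same members, hence permutations
-- of each other.
∑-reindex : {xs : List A} {ys : List A′} (φ : A → A′) (ψ : A′ → A) → Unique xs → Unique ys →
            (∀ {x} → x ∈ xs → φ x ∈ ys × ψ (φ x) ≡ x) → (∀ {y} → y ∈ ys → ψ y ∈ xs × φ (ψ y) ≡ y) →
            (f : A′ → ℕ) → ∑ xs (f ∘ φ) ≡ ∑ ys f
∑-reindex {xs = xs} {ys} φ ψ uxs uys fwd bwd f =
  trans (sym (∑-map xs φ f)) (sum-↭ (Perm.map⁺ f (∼bag⇒↭ (unique∧set⇒bag uφ uys (mk⇔ to from)))))
  where
  unique-map : (zs : List _) → (∀ {x} → x ∈ zs → ψ (φ x) ≡ x) → Unique zs → Unique (map φ zs)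
  unique-map []       inv []       = []
  unique-map (z ∷ zs) inv (z∉ ∷ u) =
    All.map⁺ (All.tabulate λ {y} y∈ eq → All.lookup z∉ y∈
      (trans (sym (inv (here refl))) (trans (cong ψ eq) (inv (there y∈)))))
    ∷ unique-map zs (inv ∘ there) u
  uφ : Unique (map φ xs)
  uφ = unique-map xs (proj₂ ∘ fwd) uxs
  to : ∀ {y} → y ∈ map φ xs → y ∈ ys
  to y∈ with ∈-map⁻ φ y∈
  ... | x , x∈ , refl = proj₁ (fwd x∈)
  from : ∀ {y} → y ∈ ys → y ∈ map φ xs
  from y∈ = subst (_∈ map φ xs) (proj₂ (bwd y∈)) (∈-map⁺ φ (proj₁ (bwd y∈)))

∑-upTo-suc : ∀ n (f : ℕ → ℕ) → ∑ (upTo (suc n)) f ≡ f 0 + ∑ (upTo n) (f ∘ suc)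
∑-upTo-suc n f = cong (f 0 +_) (cong sum (trans (map-applyUpTo suc f n) (sym (map-upTo (f ∘ suc) n))))

∑-upTo-last : ∀ n (f : ℕ → ℕ) → ∑ (upTo (suc n)) f ≡ ∑ (upTo n) f + f n
∑-upTo-last zero    f = +-identityʳ (f 0)
∑-upTo-last (suc n) f = begin
  ∑ (upTo (2 + n)) f                       ≡⟨ ∑-upTo-suc (suc n) f ⟩
  f 0 + ∑ (upTo (suc n)) (f ∘ suc)         ≡⟨ cong (f 0 +_) (∑-upTo-last n (f ∘ suc)) ⟩
  f 0 + (∑ (upTo n) (f ∘ suc) + f (suc n)) ≡⟨ +-assoc (f 0) _ _ ⟨
  f 0 + ∑ (upTo n) (f ∘ suc) + f (suc n)   ≡⟨ cong (_+ f (suc n)) (∑-upTo-suc n f) ⟨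
  ∑ (upTo (suc n)) f + f (suc n)           ∎
  where open ≡-Reasoning

∑-upTo-+ : ∀ m n (f : ℕ → ℕ) → ∑ (upTo (m + n)) f ≡ ∑ (upTo m) f + ∑ (upTo n) (λ i → f (m + i))
∑-upTo-+ zero    n f = refl
∑-upTo-+ (suc m) n f = begin
  ∑ (upTo (suc (m + n))) f                                             ≡⟨ ∑-upTo-suc (m + n) f ⟩
  f 0 + ∑ (upTo (m + n)) (f ∘ suc)                                     ≡⟨ cong (f 0 +_) (∑-upTo-+ m n (f ∘ suc)) ⟩
  f 0 + (∑ (upTo m) (f ∘ suc) + ∑ (upTo n) (λ i → f (suc (m + i))))    ≡⟨ +-assoc (f 0) _ _ ⟨
  f 0 + ∑ (upTo m) (f ∘ suc) + ∑ (upTo n) (λ i → f (suc (m + i)))      ≡⟨ cong (_+ ∑ (upTo n) (λ i → f (suc (m + i)))) (∑-upTo-suc m f) ⟨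
  ∑ (upTo (suc m)) f + ∑ (upTo n) (λ i → f (suc (m + i)))              ∎
  where open ≡-Reasoning

∑-upTo-* : ∀ l p (f : ℕ → ℕ) → ∑ (upTo (l * p)) f ≡ (∑[ t ∈ upTo l ] ∑[ j ∈ upTo p ] f (t * p + j))
∑-upTo-* zero    p f = refl
∑-upTo-* (suc l) p f = begin
  ∑ (upTo (p + l * p)) f                                                     ≡⟨ ∑-upTo-+ p (l * p) f ⟩
  ∑ (upTo p) f + ∑ (upTo (l * p)) (λ i → f (p + i))                          ≡⟨ cong (_ +_) (∑-upTo-* l p (λ i → f (p + i))) ⟩
  ∑ (upTo p) f + (∑[ t ∈ upTo l ] ∑[ j ∈ upTo p ] f (p + (t * p + j)))       ≡⟨ cong (_ +_) (∑-ext (upTo l) (λ t → ∑-ext (upTo p) (λ j → cong f (sym (+-assoc p (t * p) j))))) ⟩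
  ∑ (upTo p) f + (∑[ t ∈ upTo l ] ∑[ j ∈ upTo p ] f (suc t * p + j))         ≡⟨ ∑-upTo-suc l (λ t → ∑[ j ∈ upTo p ] f (t * p + j)) ⟨
  (∑[ t ∈ upTo (suc l) ] ∑[ j ∈ upTo p ] f (t * p + j))                      ∎
  where open ≡-Reasoning

∑-multiples : ∀ l p .{{_ : NonZero p}} (f : ℕ → ℕ) → (∀ i → ¬ p ∣ i → f i ≡ 0) →
              ∑ (upTo (l * p)) f ≡ (∑[ t ∈ upTo l ] f (t * p))
∑-multiples l (suc p-1) f off = trans (∑-upTo-* l p f) (∑-ext (upTo l) inner)
  where
  p = suc p-1
  inner : ∀ t → (∑[ j ∈ upTo p ] f (t * p + j)) ≡ f (t * p)
  inner t = trans (∑-single _ (Unique.upTo⁺ p) (∈-upTo⁺ (s≤s z≤n)) zero-off) (cong f (+-identityʳ (t * p)))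
    where
    zero-off : ∀ {j} → j ∈ upTo p → j ≢ 0 → f (t * p + j) ≡ 0
    zero-off {zero}  _  j≢0 = contradiction refl j≢0
    zero-off {suc j} j∈ _   = off _ λ p∣ →
      >⇒∤ (∈-upTo⁻ j∈) (∣m+n∣m⇒∣n p∣ (n∣m*n t))

∑-upTo-shift : ∀ n (f : ℕ → ℕ) → f n ≡ f 0 → ∑ (upTo n) (f ∘ suc) ≡ ∑ (upTo n) f
∑-upTo-shift n f eq = +-cancelˡ-≡ (f 0) _ _ (begin
  f 0 + ∑ (upTo n) (f ∘ suc) ≡⟨ ∑-upTo-suc n f ⟨
  ∑ (upTo (suc n)) f         ≡⟨ ∑-upTo-last n f ⟩
  ∑ (upTo n) f + f n         ≡⟨ cong (∑ (upTo n) f +_) eq ⟩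
  ∑ (upTo n) f + f 0         ≡⟨ +-comm _ (f 0) ⟩
  f 0 + ∑ (upTo n) f         ∎)
  where open ≡-Reasoning

∑-upTo-∸ : ∀ n (f : ℕ → ℕ) → (∑[ i ∈ upTo n ] f (n ∸ i)) ≡ ∑ (upTo n) (f ∘ suc)
∑-upTo-∸ zero    f = refl
∑-upTo-∸ (suc n) f = begin
  (∑[ i ∈ upTo (suc n) ] f (suc n ∸ i))     ≡⟨ ∑-upTo-suc n _ ⟩
  f (suc n) + (∑[ i ∈ upTo n ] f (n ∸ i))   ≡⟨ cong (f (suc n) +_) (∑-upTo-∸ n f) ⟩
  f (suc n) + ∑ (upTo n) (f ∘ suc)          ≡⟨ +-comm (f (suc n)) _ ⟩
  ∑ (upTo n) (f ∘ suc) + f (suc n)          ≡⟨ ∑-upTo-last n (f ∘ suc) ⟨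
  ∑ (upTo (suc n)) (f ∘ suc)                ∎
  where open ≡-Reasoning

∑-upTo-extend : ∀ {m n} (f : ℕ → ℕ) → m ≤ n → (∀ i → m ≤ i → f i ≡ 0) → ∑ (upTo n) f ≡ ∑ (upTo m) f
∑-upTo-extend {m} {n} f m≤n off = begin
  ∑ (upTo n) f                                      ≡⟨ cong (λ k → ∑ (upTo k) f) (m+[n∸m]≡n m≤n) ⟨
  ∑ (upTo (m + (n ∸ m))) f                          ≡⟨ ∑-upTo-+ m (n ∸ m) f ⟩
  ∑ (upTo m) f + ∑ (upTo (n ∸ m)) (λ i → f (m + i)) ≡⟨ cong (_ +_) (∑-zero (upTo (n ∸ m)) (λ {i} _ → off (m + i) (m≤m+n m i))) ⟩
  ∑ (upTo m) f + 0                                  ≡⟨ +-identityʳ _ ⟩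
  ∑ (upTo m) f                                      ∎
  where open ≡-Reasoning

-- Words and rotations

infix 4 _≟ₛ_ _≟ʷ_

_≟ₛ_ : (a b : Sign) → Dec (a ≡ b)
plus  ≟ₛ plus  = yes refl
plus  ≟ₛ minus = no λ ()
minus ≟ₛ plus  = no λ ()
minus ≟ₛ minus = yes refl

_≟ʷ_ : (s t : SignSeq) → Dec (s ≡ t)
_≟ʷ_ = ≡-dec _≟ₛ_

neg-involutive : ∀ a → neg (neg a) ≡ a
neg-involutive plus  = refl
neg-involutive minus = refl

neg-≢ : ∀ a → neg a ≢ a
neg-≢ plus  ()
neg-≢ minus ()

≢⇒≡neg : ∀ {a b} → a ≢ b → b ≡ neg a
≢⇒≡neg {plus}  {plus}  a≢b = contradiction refl a≢b
≢⇒≡neg {plus}  {minus} a≢b = refl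
≢⇒≡neg {minus} {plus}  a≢b = refl
≢⇒≡neg {minus} {minus} a≢b = contradiction refl a≢b

map-neg-involutive : ∀ s → map neg (map neg s) ≡ s
map-neg-involutive []      = refl
map-neg-involutive (a ∷ s) = cong₂ _∷_ (neg-involutive a) (map-neg-involutive s)

∈-allSeqs⁺ : ∀ {n} s → length s ≡ n → s ∈ allSeqs n
∈-allSeqs⁺ []          refl = here refl
∈-allSeqs⁺ (minus ∷ s) refl = ∈-++⁺ˡ (∈-map⁺ (minus ∷_) (∈-allSeqs⁺ s refl))
∈-allSeqs⁺ (plus ∷ s)  refl = ∈-++⁺ʳ _ (∈-map⁺ (plus ∷_) (∈-allSeqs⁺ s refl))

∈-allSeqs⁻ : ∀ n {s} → s ∈ allSeqs n → length s ≡ n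
∈-allSeqs⁻ zero    (here refl) = refl
∈-allSeqs⁻ (suc n) s∈ with ∈-++⁻ (map (minus ∷_) (allSeqs n)) s∈
... | inj₁ m∈ with ∈-map⁻ (minus ∷_) m∈
...   | _ , t∈ , refl = cong suc (∈-allSeqs⁻ n t∈)
∈-allSeqs⁻ (suc n) s∈ | inj₂ p∈ with ∈-map⁻ (plus ∷_) p∈
...   | _ , t∈ , refl = cong suc (∈-allSeqs⁻ n t∈)

allSeqs-unique : ∀ n → Unique (allSeqs n)
allSeqs-unique zero    = [] ∷ []
allSeqs-unique (suc n) =
  Unique.++⁺ (Unique.map⁺ ∷-injectiveʳ (allSeqs-unique n)) (Unique.map⁺ ∷-injectiveʳ (allSeqs-unique n)) disjoint
  where
  disjoint : ∀ {s} → ¬ (s ∈ map (minus ∷_) (allSeqs n) × s ∈ map (plus ∷_) (allSeqs n))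
  disjoint (m∈ , p∈) with ∈-map⁻ (minus ∷_) m∈ | ∈-map⁻ (plus ∷_) p∈
  ... | _ , _ , refl | _ , _ , ()

∑-allSeqs-suc : ∀ n (f : SignSeq → ℕ) →
                ∑ (allSeqs (suc n)) f ≡ ∑ (allSeqs n) (f ∘ (minus ∷_)) + ∑ (allSeqs n) (f ∘ (plus ∷_))
∑-allSeqs-suc n f = trans (∑-++ (map (minus ∷_) (allSeqs n)) _ f)
  (cong₂ _+_ (∑-map (allSeqs n) (minus ∷_) f) (∑-map (allSeqs n) (plus ∷_) f))

length-allSeqs : ∀ n → length (allSeqs n) ≡ 2 ^ n
length-allSeqs zero    = refl
length-allSeqs (suc n) = trans (length-++ (map (minus ∷_) (allSeqs n)))
  (cong₂ _+_ (trans (length-map (minus ∷_) (allSeqs n)) (length-allSeqs n))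
             (trans (trans (length-map (plus ∷_) (allSeqs n)) (length-allSeqs n)) (sym (+-identityʳ (2 ^ n)))))

∑-allSeqs-+ : ∀ m n (f : SignSeq → ℕ) →
              ∑ (allSeqs (m + n)) f ≡ (∑[ s ∈ allSeqs m ] ∑[ t ∈ allSeqs n ] f (s ++ t))
∑-allSeqs-+ zero    n f = sym (+-identityʳ _)
∑-allSeqs-+ (suc m) n f = trans (∑-allSeqs-suc (m + n) f) (trans
  (cong₂ _+_ (∑-allSeqs-+ m n (f ∘ (minus ∷_))) (∑-allSeqs-+ m n (f ∘ (plus ∷_))))
  (sym (∑-allSeqs-suc m (λ s → ∑[ t ∈ allSeqs n ] f (s ++ t)))))

∑-allSeqs-reindex : ∀ n (φ ψ : SignSeq → SignSeq) →
  (∀ s → length s ≡ n → length (φ s) ≡ n × ψ (φ s) ≡ s) →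
  (∀ s → length s ≡ n → length (ψ s) ≡ n × φ (ψ s) ≡ s) →
  (f : SignSeq → ℕ) → ∑ (allSeqs n) (f ∘ φ) ≡ ∑ (allSeqs n) f
∑-allSeqs-reindex n φ ψ fwd bwd =
  ∑-reindex φ ψ (allSeqs-unique n) (allSeqs-unique n) (lift φ ψ fwd) (lift ψ φ bwd)
  where
  lift : ∀ (α β : SignSeq → SignSeq) → (∀ s → length s ≡ n → length (α s) ≡ n × β (α s) ≡ s) →
         ∀ {s} → s ∈ allSeqs n → α s ∈ allSeqs n × β (α s) ≡ s
  lift α β hyp {s} s∈ with hyp s (∈-allSeqs⁻ n s∈)
  ... | len , eq = ∈-allSeqs⁺ (α s) len , eq

∑-allSeqs-single : ∀ {n} z (f : SignSeq → ℕ) → length z ≡ n →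
                   (∀ {x} → length x ≡ n → x ≢ z → f x ≡ 0) → ∑ (allSeqs n) f ≡ f z
∑-allSeqs-single {n} z f len off =
  ∑-single f (allSeqs-unique n) (∈-allSeqs⁺ z len) (λ x∈ → off (∈-allSeqs⁻ n x∈))

rotate : SignSeq → SignSeq
rotate []      = []
rotate (a ∷ s) = s ∷ʳ a

-- As an iterate this obeys `rotate^-+` without bounds, whereas `rot` stops turning once its index
-- exceeds the length.
rotate^ : ℕ → SignSeq → SignSeq
rotate^ zero    s = s
rotate^ (suc i) s = rotate^ i (rotate s)

rotate^-+ : ∀ i j s → rotate^ (i + j) s ≡ rotate^ j (rotate^ i s)
rotate^-+ zero    j s = refl
rotate^-+ (suc i) j s = rotate^-+ i j (rotate s)

rotate^-comm : ∀ i j s → rotate^ i (rotate^ j s) ≡ rotate^ j (rotate^ i s)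
rotate^-comm i j s = trans (sym (rotate^-+ j i s)) (trans (cong (λ k → rotate^ k s) (+-comm j i)) (rotate^-+ i j s))

length-rotate : ∀ s → length (rotate s) ≡ length s
length-rotate []      = refl
length-rotate (a ∷ s) = trans (length-++ s) (+-comm (length s) 1)

length-rotate^ : ∀ i s → length (rotate^ i s) ≡ length s
length-rotate^ zero    s = refl
length-rotate^ (suc i) s = trans (length-rotate^ i (rotate s)) (length-rotate s)

rotate-map-neg : ∀ s → rotate (map neg s) ≡ map neg (rotate s)
rotate-map-neg []      = refl
rotate-map-neg (a ∷ s) = sym (map-++ neg s (a ∷ []))

rotate^-map-neg : ∀ i s → rotate^ i (map neg s) ≡ map neg (rotate^ i s)
rotate^-map-neg zero    s = refl
rotate^-map-neg (suc i) s = trans (cong (rotate^ i) (rotate-map-neg s)) (rotate^-map-neg i (rotate s))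

rotate-injective : ∀ {s t} → rotate s ≡ rotate t → s ≡ t
rotate-injective {[]}    {[]}    eq = refl
rotate-injective {[]}    {b ∷ t} eq = contradiction (trans (cong length eq) (length-rotate (b ∷ t))) λ ()
rotate-injective {a ∷ s} {[]}    eq = contradiction (trans (sym (length-rotate (a ∷ s))) (cong length eq)) λ ()
rotate-injective {a ∷ s} {b ∷ t} eq with ∷ʳ-injective s t eq
... | refl , refl = refl

rotate^-injective : ∀ i {s t} → rotate^ i s ≡ rotate^ i t → s ≡ t
rotate^-injective zero    eq = eq
rotate^-injective (suc i) eq = rotate-injective (rotate^-injective i eq)

rotate^-++ : ∀ s t → rotate^ (length s) (s ++ t) ≡ t ++ s
rotate^-++ []      t = sym (++-identityʳ t)
rotate^-++ (a ∷ s) t = trans (cong (rotate^ (length s)) (++-assoc s t (a ∷ [])))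
  (trans (rotate^-++ s (t ∷ʳ a)) (++-assoc t (a ∷ []) s))

rotate^-length : ∀ s → rotate^ (length s) s ≡ s
rotate^-length s = trans (cong (rotate^ (length s)) (sym (++-identityʳ s))) (rotate^-++ s [])

rotate^-∸ : ∀ {n i} s → length s ≡ n → i ≤ n → rotate^ (n ∸ i) (rotate^ i s) ≡ s
rotate^-∸ {_} {i} s refl i≤n = trans (sym (rotate^-+ i (length s ∸ i) s))
  (trans (cong (λ k → rotate^ k s) (m+[n∸m]≡n i≤n)) (rotate^-length s))

rot≡rotate^ : ∀ i s → i ≤ length s → rot i s ≡ rotate^ i s
rot≡rotate^ i s i≤ = begin
  drop i s ++ take i s                               ≡⟨ rotate^-++ (take i s) (drop i s) ⟨
  rotate^ (length (take i s)) (take i s ++ drop i s) ≡⟨ cong₂ rotate^ (trans (length-take i s) (m≤n⇒m⊓n≡m i≤)) (take++drop≡id i s) ⟩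
  rotate^ i s                                        ∎
  where open ≡-Reasoning

-- The defining relation of the dihedral group. It is what keeps the orbit of `s` within the
-- rotations of `s` and of `reverse s`.
rotate-reverse-rotate : ∀ s → rotate (reverse (rotate s)) ≡ reverse s
rotate-reverse-rotate []      = refl
rotate-reverse-rotate (a ∷ s) =
  trans (cong rotate (reverse-++ s (a ∷ []))) (sym (unfold-reverse a s))

countPlus-++ : ∀ s t → countPlus (s ++ t) ≡ countPlus s + countPlus t
countPlus-++ []          t = refl
countPlus-++ (plus ∷ s)  t = cong suc (countPlus-++ s t)
countPlus-++ (minus ∷ s) t = countPlus-++ s t

countPlus-swap : ∀ s t → countPlus (s ++ t) ≡ countPlus (t ++ s)
countPlus-swap s t = trans (countPlus-++ s t) (trans (+-comm (countPlus s) _) (sym (countPlus-++ t s)))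

countPlus-rotate : ∀ s → countPlus (rotate s) ≡ countPlus s
countPlus-rotate []      = refl
countPlus-rotate (a ∷ s) = countPlus-swap s (a ∷ [])

countPlus-reverse : ∀ s → countPlus (reverse s) ≡ countPlus s
countPlus-reverse []      = refl
countPlus-reverse (a ∷ s) = begin
  countPlus (reverse (a ∷ s))              ≡⟨ cong countPlus (unfold-reverse a s) ⟩
  countPlus (reverse s ∷ʳ a)               ≡⟨ countPlus-swap (reverse s) (a ∷ []) ⟩
  countPlus (a ∷ [] ++ reverse s)          ≡⟨ countPlus-++ (a ∷ []) (reverse s) ⟩
  countPlus (a ∷ []) + countPlus (reverse s) ≡⟨ cong (countPlus (a ∷ []) +_) (countPlus-reverse s) ⟩
  countPlus (a ∷ []) + countPlus s         ≡⟨ countPlus-++ (a ∷ []) s ⟨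
  countPlus (a ∷ s)                        ∎
  where open ≡-Reasoning

countPlus-neg : ∀ s → countPlus (map neg s) + countPlus s ≡ length s
countPlus-neg []          = refl
countPlus-neg (plus ∷ s)  = trans (+-suc _ _) (cong suc (countPlus-neg s))
countPlus-neg (minus ∷ s) = cong suc (countPlus-neg s)

countPlus≤length : ∀ s → countPlus s ≤ length s
countPlus≤length s = subst (countPlus s ≤_) (countPlus-neg s) (m≤n+m _ _)

map-neg-reverse : ∀ s → map neg (reverse s) ≡ reverse (map neg s)
map-neg-reverse = reverse-map neg

++-injective : ∀ (s s′ : SignSeq) {t t′} → length s ≡ length s′ → s ++ t ≡ s′ ++ t′ → s ≡ s′ × t ≡ t′
++-injective []      []        len eq = refl , eq
++-injective (a ∷ s) (b ∷ s′) len eq with ++-injective s s′ (suc-injective len) (∷-injectiveʳ eq)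
... | refl , t≡ = cong (_∷ s) (∷-injectiveˡ eq) , t≡

-- Dihedral orbits and bracelet representatives

data Turn : SignSeq → SignSeq → Set where
  rotation   : ∀ s → Turn s (rotate s)
  reflection : ∀ s → Turn s (reverse s)

infix 4 _∼_
_∼_ : SignSeq → SignSeq → Set
_∼_ = EqClosure Turn

∼-refl : ∀ {s} → s ∼ s
∼-refl = EqC.reflexive Turn

∼-sym : ∀ {s t} → s ∼ t → t ∼ s
∼-sym = EqC.symmetric Turn

∼-trans : ∀ {s t u} → s ∼ t → t ∼ u → s ∼ u
∼-trans = EqC.transitive Turn

∼-invariant : {A : Set} (f : SignSeq → A) → (∀ {s t} → Turn s t → f s ≡ f t) → ∀ {s t} → s ∼ t → f s ≡ f t
∼-invariant f = EqC.gfold isEquivalence f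

∼-length : ∀ {s t} → s ∼ t → length s ≡ length t
∼-length = ∼-invariant length λ { (rotation s) → sym (length-rotate s) ; (reflection s) → sym (length-reverse s) }

∼-countPlus : ∀ {s t} → s ∼ t → countPlus s ≡ countPlus t
∼-countPlus = ∼-invariant countPlus λ { (rotation s) → sym (countPlus-rotate s) ; (reflection s) → sym (countPlus-reverse s) }

∼-map-neg : ∀ {s t} → s ∼ t → map neg s ∼ map neg t
∼-map-neg = EqC.gmap (map neg) λ
  { (rotation s)   → subst (Turn (map neg s)) (rotate-map-neg s) (rotation (map neg s))
  ; (reflection s) → subst (Turn (map neg s)) (sym (map-neg-reverse s)) (reflection (map neg s)) }

rotate-∼ : ∀ s → s ∼ rotate s
rotate-∼ s = EqC.return (rotation s)

rotate^-∼ : ∀ i s → s ∼ rotate^ i s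
rotate^-∼ zero    s = ∼-refl
rotate^-∼ (suc i) s = ∼-trans (rotate-∼ s) (rotate^-∼ i (rotate s))

reverse-∼ : ∀ s → s ∼ reverse s
reverse-∼ s = EqC.return (reflection s)

hits : ℕ → SignSeq → SignSeq → ℕ
hits n s t = ∑[ i ∈ upTo n ] ⟦ rotate^ i s ≟ʷ t ⟧

-- The number of the 2n formal elements of the dihedral group that carry `s` to `t`. Elements acting
-- alike are counted separately, so every word has total multiplicity 2n.
meets : SignSeq → SignSeq → ℕ
meets s t = hits (length s) s t + hits (length s) (reverse s) t

hits-rotate : ∀ {n} s t → length s ≡ n → hits n (rotate s) t ≡ hits n s t
hits-rotate s t refl = ∑-upTo-shift (length s) (λ i → ⟦ rotate^ i s ≟ʷ t ⟧) (cong (λ u → ⟦ u ≟ʷ t ⟧) (rotate^-length s))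

-- A turn of the source permutes the 2n group elements: a rotation shifts the index within each
-- family (through the dihedral relation for the reversed one), and a reflection swaps the two
-- families.
meets-∼ : ∀ {s s′} t → s ∼ s′ → meets s t ≡ meets s′ t
meets-∼ t = ∼-invariant (λ s → meets s t) λ
  { (rotation s)   → trans (sym (cong₂ _+_ (hits-rotate s t refl)
                       (trans (sym (hits-rotate (reverse (rotate s)) t (trans (length-reverse (rotate s)) (length-rotate s))))
                              (cong (λ u → hits (length s) u t) (rotate-reverse-rotate s)))))
                       (cong (λ n → hits n (rotate s) t + hits n (reverse (rotate s)) t) (sym (length-rotate s)))
  ; (reflection s) → trans (+-comm (hits (length s) s t) _)
                       (trans (cong (λ u → hits (length s) (reverse s) t + hits (length s) u t) (sym (reverse-involutive s)))
                              (cong (λ n → hits n (reverse s) t + hits n (reverse (reverse s)) t) (sym (length-reverse s)))) }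

∑≢0 : {A : Set} (xs : List A) (f : A → ℕ) → ∑ xs f ≢ 0 → ∃ λ x → x ∈ xs × f x ≢ 0
∑≢0 []       f ≢0 = contradiction refl ≢0
∑≢0 (x ∷ xs) f ≢0 with f x ≟ 0
... | no fx≢0  = x , here refl , fx≢0
... | yes fx≡0 with ∑≢0 xs f (λ eq → ≢0 (cong₂ _+_ fx≡0 eq))
...   | y , y∈ , fy≢0 = y , there y∈ , fy≢0

⟦⟧≢0 : {P : Set} (d : Dec P) → ⟦ d ⟧ ≢ 0 → P
⟦⟧≢0 (yes p) _  = p
⟦⟧≢0 (no _)  ≢0 = contradiction refl ≢0

Reaches : SignSeq → SignSeq → Set
Reaches s t = ∃ λ i → i < length s × (rotate^ i s ≡ t ⊎ rotate^ i (reverse s) ≡ t)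

meets⇒reaches : ∀ {s t} → meets s t ≢ 0 → Reaches s t
meets⇒reaches {s} {t} ≢0 with hits (length s) s t ≟ 0
... | no h≢0 with ∑≢0 (upTo (length s)) _ h≢0
...   | i , i∈ , eq = i , ∈-upTo⁻ i∈ , inj₁ (⟦⟧≢0 (_ ≟ʷ _) eq)
meets⇒reaches {s} {t} ≢0 | yes h≡0 with ∑≢0 (upTo (length s)) _ (λ eq → ≢0 (cong₂ _+_ h≡0 eq))
...   | i , i∈ , eq = i , ∈-upTo⁻ i∈ , inj₂ (⟦⟧≢0 (_ ≟ʷ _) eq)

meets-self : ∀ a s → meets (a ∷ s) (a ∷ s) ≢ 0
meets-self a s eq = contradiction
  (trans (sym (⟦⟧-yes self refl)) (m+n≡0⇒m≡0 ⟦ self ⟧ (m+n≡0⇒m≡0 (hits (length (a ∷ s)) (a ∷ s) (a ∷ s)) eq))) λ ()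
  where
  self = a ∷ s ≟ʷ a ∷ s

reaches⇒∼ : ∀ {s t} → Reaches s t → s ∼ t
reaches⇒∼ {s} (i , _ , inj₁ refl) = rotate^-∼ i s
reaches⇒∼ {s} (i , _ , inj₂ refl) = ∼-trans (reverse-∼ s) (rotate^-∼ i (reverse s))

∼⇒meets : ∀ {s t} → 0 < length s → s ∼ t → meets s t ≢ 0
∼⇒meets {s} {[]}    pos s∼t eq = contradiction (subst (0 <_) (∼-length s∼t) pos) λ ()
∼⇒meets {s} {b ∷ t} pos s∼t eq = meets-self b t (trans (sym (meets-∼ (b ∷ t) s∼t)) eq)

∼⇒reaches : ∀ {s t} → 0 < length s → s ∼ t → Reaches s t
∼⇒reaches pos s∼t = meets⇒reaches (∼⇒meets pos s∼t)

infix 4 _∼?_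
_∼?_ : ∀ s t → Dec (s ∼ t)
[]      ∼? []      = yes ∼-refl
[]      ∼? (b ∷ t) = no λ s∼t → contradiction (∼-length s∼t) λ ()
(a ∷ s) ∼? t       = map′ (reaches⇒∼ ∘ meets⇒reaches) (∼⇒meets (s≤s z≤n)) (¬? (meets (a ∷ s) t ≟ 0))

-- Orbit and stabiliser: within an orbit the multiplicity is that of the stabiliser of the target,
-- whatever the source.
meets≡ : ∀ {n} s t → 0 < n → length s ≡ n → meets s t ≡ ⟦ s ∼? t ⟧ * meets t t
meets≡ s t pos refl with s ∼? t
... | yes s∼t = trans (meets-∼ t s∼t) (sym (*-identityˡ _))
... | no  s≁t with meets s t ≟ 0
...   | yes eq = eq
...   | no ≢0  = contradiction (reaches⇒∼ (meets⇒reaches ≢0)) s≁t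

∑-hits : ∀ {n} m s → length s ≡ n → ∑ (allSeqs n) (hits m s) ≡ m
∑-hits {n} m s len = begin
  (∑[ t ∈ allSeqs n ] ∑[ i ∈ upTo m ] ⟦ rotate^ i s ≟ʷ t ⟧) ≡⟨ ∑-comm (allSeqs n) (upTo m) _ ⟩
  (∑[ i ∈ upTo m ] ∑[ t ∈ allSeqs n ] ⟦ rotate^ i s ≟ʷ t ⟧) ≡⟨ ∑-ext (upTo m) one ⟩
  (∑[ i ∈ upTo m ] 1)                                       ≡⟨ ∑-const (upTo m) 1 ⟩
  length (upTo m) * 1                                       ≡⟨ *-identityʳ _ ⟩
  length (upTo m)                                           ≡⟨ length-upTo m ⟩
  m                                                         ∎
  where
  open ≡-Reasoning
  one : ∀ i → (∑[ t ∈ allSeqs n ] ⟦ rotate^ i s ≟ʷ t ⟧) ≡ 1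
  one i = trans (∑-allSeqs-single (rotate^ i s) _ (trans (length-rotate^ i s) len)
                  (λ _ t≢ → ⟦⟧-no (_ ≟ʷ _) (t≢ ∘ sym)))
                (⟦⟧-yes (rotate^ i s ≟ʷ rotate^ i s) refl)

∑-meets : ∀ {n} s → length s ≡ n → ∑ (allSeqs n) (meets s) ≡ n + n
∑-meets {n} s refl = trans (∑-+ (allSeqs n) (hits (length s) s) _)
  (cong₂ _+_ (∑-hits (length s) s refl) (∑-hits (length s) (reverse s) (length-reverse s)))

-- The where-bound equality test inside lexLe cannot be named from outside. Abstracting its two outer
-- arguments makes the unification problem for the metavariable a pattern, so Agda finds the test itself.
mutual
  eqSeq : SignSeq → SignSeq → SignSeq → SignSeq → Bool
  eqSeq = _

  eqSeq-spec : ∀ s t → lexLe (minus ∷ s) (minus ∷ t) ≡ (lexLt s t ∨ eqSeq (minus ∷ s) (minus ∷ t) s t)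
  eqSeq-spec s t with minus ∷ s | minus ∷ t
  ... | _ | _ = refl

eqSeq⇒≡ : ∀ u v s t → T (eqSeq u v s t) → s ≡ t
eqSeq⇒≡ u v []          []          _ = refl
eqSeq⇒≡ u v (plus ∷ s)  (plus ∷ t)  e = cong (plus ∷_) (eqSeq⇒≡ u v s t e)
eqSeq⇒≡ u v (minus ∷ s) (minus ∷ t) e = cong (minus ∷_) (eqSeq⇒≡ u v s t e)

eqSeq-refl : ∀ u v s → T (eqSeq u v s s)
eqSeq-refl u v []          = _
eqSeq-refl u v (plus ∷ s)  = eqSeq-refl u v s
eqSeq-refl u v (minus ∷ s) = eqSeq-refl u v s

-- The word as a binary numeral with `plus` as digit 1. Among words of one length the lexicographic
-- order becomes `<` on ℕ, so least words can be obtained by `argmin`.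
binary : SignSeq → ℕ
binary []          = 0
binary (minus ∷ s) = binary s
binary (plus ∷ s)  = 2 ^ length s + binary s

binary<2^length : ∀ s → binary s < 2 ^ length s
binary<2^length []          = s≤s z≤n
binary<2^length (minus ∷ s) = ≤-trans (binary<2^length s) (m≤m+n _ _)
binary<2^length (plus ∷ s)  = +-monoʳ-< (2 ^ length s) (≤-trans (binary<2^length s) (≤-reflexive (sym (+-identityʳ _))))

lexLt⇒< : ∀ s t → length s ≡ length t → T (lexLt s t) → binary s < binary t
lexLt⇒< (minus ∷ s) (plus ∷ t)  len _  = ≤-trans (binary<2^length s)
  (≤-trans (≤-reflexive (cong (2 ^_) (suc-injective len))) (m≤m+n _ _))
lexLt⇒< (minus ∷ s) (minus ∷ t) len lt = lexLt⇒< s t (suc-injective len) lt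
lexLt⇒< (plus ∷ s)  (plus ∷ t)  len lt rewrite suc-injective len =
  +-monoʳ-< (2 ^ length t) (lexLt⇒< s t (suc-injective len) lt)

<⇒lexLt : ∀ s t → length s ≡ length t → binary s < binary t → T (lexLt s t)
<⇒lexLt []          []          len ()
<⇒lexLt (minus ∷ s) (plus ∷ t)  len lt = _
<⇒lexLt (minus ∷ s) (minus ∷ t) len lt = <⇒lexLt s t (suc-injective len) lt
<⇒lexLt (plus ∷ s)  (plus ∷ t)  len lt rewrite suc-injective len =
  <⇒lexLt s t (suc-injective len) (+-cancelˡ-< (2 ^ length t) _ _ lt)
<⇒lexLt (plus ∷ s)  (minus ∷ t) len lt rewrite suc-injective len =
  contradiction (≤-trans lt (<⇒≤ (binary<2^length t))) (m+n≮m (2 ^ length t) (binary s))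

binary-injective : ∀ s t → length s ≡ length t → binary s ≡ binary t → s ≡ t
binary-injective []          []          len eq = refl
binary-injective (minus ∷ s) (minus ∷ t) len eq = cong (minus ∷_) (binary-injective s t (suc-injective len) eq)
binary-injective (plus ∷ s)  (plus ∷ t)  len eq rewrite suc-injective len =
  cong (plus ∷_) (binary-injective s t (suc-injective len) (+-cancelˡ-≡ (2 ^ length t) _ _ eq))
binary-injective (minus ∷ s) (plus ∷ t)  len eq =
  contradiction eq (<⇒≢ (lexLt⇒< (minus ∷ s) (plus ∷ t) len _))
binary-injective (plus ∷ s)  (minus ∷ t) len eq =
  contradiction (sym eq) (<⇒≢ (lexLt⇒< (minus ∷ t) (plus ∷ s) (sym len) _))

T-∨⁻ : ∀ a b → T (a ∨ b) → T a ⊎ T b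
T-∨⁻ true  b _ = inj₁ _
T-∨⁻ false b e = inj₂ e

T-∨⁺ : ∀ a b → T a ⊎ T b → T (a ∨ b)
T-∨⁺ true  b _        = _
T-∨⁺ false b (inj₂ e) = e

lexLe⇒≤ : ∀ s t → length s ≡ length t → T (lexLe s t) → binary s ≤ binary t
lexLe⇒≤ s t len le with T-∨⁻ (lexLt s t) (eqSeq s t s t) le
... | inj₁ lt = <⇒≤ (lexLt⇒< s t len lt)
... | inj₂ eq = ≤-reflexive (cong binary (eqSeq⇒≡ s t s t eq))

≤⇒lexLe : ∀ s t → length s ≡ length t → binary s ≤ binary t → T (lexLe s t)
≤⇒lexLe s t len le with m≤n⇒m<n∨m≡n le
... | inj₁ lt = T-∨⁺ (lexLt s t) (eqSeq s t s t) (inj₁ (<⇒lexLt s t len lt))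
... | inj₂ eq with binary-injective s t len eq
...   | refl = T-∨⁺ (lexLt s s) (eqSeq s s s s) (inj₂ (eqSeq-refl s s s))

allB⁻ : {A : Set} (p : A → Bool) (xs : List A) → T (allB p xs) → ∀ {x} → x ∈ xs → T (p x)
allB⁻ p (x ∷ xs) t (here refl) = proj₁ (Equivalence.to T-∧ t)
allB⁻ p (x ∷ xs) t (there x∈)  = allB⁻ p xs (proj₂ (Equivalence.to T-∧ t)) x∈

allB⁺ : {A : Set} (p : A → Bool) (xs : List A) → (∀ {x} → x ∈ xs → T (p x)) → T (allB p xs)
allB⁺ p []       h = _
allB⁺ p (x ∷ xs) h = Equivalence.from T-∧ (h (here refl) , allB⁺ p xs (h ∘ there))

Least : SignSeq → Set
Least s = ∀ {t} → s ∼ t → binary s ≤ binary t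

isBraceletRep⇒Least : ∀ s → T (isBraceletRep s) → Least s
isBraceletRep⇒Least []      _   s∼t = z≤n
isBraceletRep⇒Least (a ∷ s) rep s∼t with ∼⇒reaches (s≤s z≤n) s∼t
... | i , i< , inj₁ refl = lexLe⇒≤ (a ∷ s) _ (sym (length-rotate^ i (a ∷ s)))
  (subst (T ∘ lexLe (a ∷ s)) (rot≡rotate^ i (a ∷ s) (<⇒≤ i<))
    (proj₁ (Equivalence.to T-∧ (allB⁻ _ (upTo (length (a ∷ s))) rep (∈-upTo⁺ i<)))))
... | i , i< , inj₂ refl = lexLe⇒≤ (a ∷ s) _ (sym (trans (length-rotate^ i _) (length-reverse (a ∷ s))))
  (subst (T ∘ lexLe (a ∷ s)) (rot≡rotate^ i (reverse (a ∷ s)) (≤-trans (<⇒≤ i<) (≤-reflexive (sym (length-reverse (a ∷ s))))))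
    (proj₂ (Equivalence.to T-∧ (allB⁻ _ (upTo (length (a ∷ s))) rep (∈-upTo⁺ i<)))))

Least⇒isBraceletRep : ∀ s → Least s → T (isBraceletRep s)
Least⇒isBraceletRep s least = allB⁺ _ (upTo (length s)) λ {i} i∈ → Equivalence.from T-∧
  ( below s i (<⇒≤ (∈-upTo⁻ i∈)) ∼-refl
  , below (reverse s) i (≤-trans (<⇒≤ (∈-upTo⁻ i∈)) (≤-reflexive (sym (length-reverse s)))) (reverse-∼ s))
  where
  below : ∀ t i → i ≤ length t → s ∼ t → T (lexLe s (rot i t))
  below t i i≤ s∼t rewrite rot≡rotate^ i t i≤ = ≤⇒lexLe s _ (∼-length s∼) (least s∼)
    where s∼ = ∼-trans s∼t (rotate^-∼ i t)

least? : ∀ s → Dec (Least s)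
least? s = map′ (isBraceletRep⇒Least s) (Least⇒isBraceletRep s) (T? (isBraceletRep s))

orbit : SignSeq → List SignSeq
orbit s = map (λ i → rotate^ i s) (upTo (length s)) ++ map (λ i → rotate^ i (reverse s)) (upTo (length s))

canon : SignSeq → SignSeq
canon s = argmin binary s (orbit s)

canon-∼ : ∀ s → s ∼ canon s
canon-∼ s = argmin-all binary {xs = orbit s} {P = s ∼_} ∼-refl (All.++⁺
  (All.map⁺ {xs = upTo (length s)} (All.tabulate λ {i} _ → rotate^-∼ i s))
  (All.map⁺ {xs = upTo (length s)} (All.tabulate λ {i} _ → ∼-trans (reverse-∼ s) (rotate^-∼ i (reverse s)))))

canon-least : ∀ s → Least (canon s)
canon-least []      _   = z≤n
canon-least (a ∷ s) c∼t = All.lookup (f[argmin]≤f[xs] {f = binary} (a ∷ s) (orbit (a ∷ s))) (member (∼⇒reaches (s≤s z≤n) (∼-trans (canon-∼ (a ∷ s)) c∼t)))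
  where
  member : ∀ {t} → Reaches (a ∷ s) t → t ∈ orbit (a ∷ s)
  member (i , i< , inj₁ refl) = ∈-++⁺ˡ (∈-map⁺ (λ i → rotate^ i (a ∷ s)) (∈-upTo⁺ i<))
  member (i , i< , inj₂ refl) = ∈-++⁺ʳ (map (λ i → rotate^ i (a ∷ s)) (upTo (length (a ∷ s)))) (∈-map⁺ (λ i → rotate^ i (reverse (a ∷ s))) (∈-upTo⁺ i<))

least-unique : ∀ {s t} → Least s → Least t → s ∼ t → s ≡ t
least-unique {s} {t} ls lt s∼t = binary-injective s t (∼-length s∼t) (≤-antisym (ls s∼t) (lt (∼-sym s∼t)))

-- Each orbit has exactly one least word, namely `canon s`. Inserting this factor 1 turns a sum over
-- words into a sum over bracelets.
∑-least : ∀ {n} s → length s ≡ n → (∑[ r ∈ allSeqs n ] ⟦ least? r ⟧ * ⟦ r ∼? s ⟧) ≡ 1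
∑-least s len = trans
  (∑-allSeqs-single (canon s) _ (trans (sym (∼-length (canon-∼ s))) len) off)
  (cong₂ _*_ (⟦⟧-yes (least? _) (canon-least s)) (⟦⟧-yes (_ ∼? _) (∼-sym (canon-∼ s))))
  where
  off : ∀ {r} → length r ≡ _ → r ≢ canon s → ⟦ least? r ⟧ * ⟦ r ∼? s ⟧ ≡ 0
  off {r} _ r≢ = trans (sym (⟦⟧-× (least? r) (r ∼? s)))
    (⟦⟧-no (least? r ×-dec r ∼? s) λ (l , r∼s) → r≢ (least-unique l (canon-least s) (∼-trans r∼s (canon-∼ s))))

-- Burnside's count for the coset of the complement: since meets s t vanishes off the orbits and
-- otherwise depends on t only, summing meets (map neg s) s over an orbit gives ∑ t meets r t = 2n
-- when the orbit of r is closed under complement, and 0 otherwise.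
burnside-neg : ∀ n → 0 < n → (∑[ s ∈ allSeqs n ] meets (map neg s) s) ≡
               (∑[ r ∈ allSeqs n ] ⟦ least? r ⟧ * ⟦ map neg r ∼? r ⟧) * (n + n)
burnside-neg n pos = begin
  (∑[ s ∈ allSeqs n ] meets (map neg s) s)
    ≡⟨ ∑-cong (allSeqs n) (λ {s} s∈ → sym (trans (cong (_* meets (map neg s) s) (∑-least s (∈-allSeqs⁻ n s∈))) (*-identityˡ _))) ⟩
  (∑[ s ∈ allSeqs n ] (∑[ r ∈ allSeqs n ] ⟦ least? r ⟧ * ⟦ r ∼? s ⟧) * meets (map neg s) s)
    ≡⟨ ∑-ext (allSeqs n) (λ s → sym (∑-*ʳ (allSeqs n) (meets (map neg s) s) (λ r → ⟦ least? r ⟧ * ⟦ r ∼? s ⟧))) ⟩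
  (∑[ s ∈ allSeqs n ] ∑[ r ∈ allSeqs n ] ⟦ least? r ⟧ * ⟦ r ∼? s ⟧ * meets (map neg s) s)
    ≡⟨ ∑-comm (allSeqs n) (allSeqs n) _ ⟩
  (∑[ r ∈ allSeqs n ] ∑[ s ∈ allSeqs n ] ⟦ least? r ⟧ * ⟦ r ∼? s ⟧ * meets (map neg s) s)
    ≡⟨ ∑-cong (allSeqs n) (λ {r} r∈ → ∑-cong (allSeqs n) (λ {s} s∈ → term r s (∈-allSeqs⁻ n r∈) (∈-allSeqs⁻ n s∈))) ⟩
  (∑[ r ∈ allSeqs n ] ∑[ s ∈ allSeqs n ] ⟦ least? r ⟧ * ⟦ map neg r ∼? r ⟧ * meets r s)
    ≡⟨ ∑-cong (allSeqs n) (λ {r} r∈ → trans (∑-*ˡ (allSeqs n) (⟦ least? r ⟧ * ⟦ map neg r ∼? r ⟧) (meets r))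
                                         (cong (⟦ least? r ⟧ * ⟦ map neg r ∼? r ⟧ *_) (∑-meets r (∈-allSeqs⁻ n r∈)))) ⟩
  (∑[ r ∈ allSeqs n ] ⟦ least? r ⟧ * ⟦ map neg r ∼? r ⟧ * (n + n))
    ≡⟨ ∑-*ʳ (allSeqs n) (n + n) _ ⟩
  (∑[ r ∈ allSeqs n ] ⟦ least? r ⟧ * ⟦ map neg r ∼? r ⟧) * (n + n) ∎
  where
  open ≡-Reasoning
  term : ∀ r s → length r ≡ n → length s ≡ n →
         ⟦ least? r ⟧ * ⟦ r ∼? s ⟧ * meets (map neg s) s ≡ ⟦ least? r ⟧ * ⟦ map neg r ∼? r ⟧ * meets r s
  term r s lr ls = begin
    ⟦ least? r ⟧ * ⟦ r ∼? s ⟧ * meets (map neg s) s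
      ≡⟨ *-assoc ⟦ least? r ⟧ _ _ ⟩
    ⟦ least? r ⟧ * (⟦ r ∼? s ⟧ * meets (map neg s) s)
      ≡⟨ cong (λ k → ⟦ least? r ⟧ * (⟦ r ∼? s ⟧ * k)) (meets≡ (map neg s) s pos (trans (length-map neg s) ls)) ⟩
    ⟦ least? r ⟧ * (⟦ r ∼? s ⟧ * (⟦ map neg s ∼? s ⟧ * meets s s))
      ≡⟨ cong (⟦ least? r ⟧ *_) (⟦⟧-*-cong (r ∼? s) (λ r∼s → cong (_* meets s s)
           (⟦⟧-cong (map neg s ∼? s) (map neg r ∼? r)
             (λ ns∼s → ∼-trans (∼-map-neg r∼s) (∼-trans ns∼s (∼-sym r∼s)))
             (λ nr∼r → ∼-trans (∼-map-neg (∼-sym r∼s)) (∼-trans nr∼r r∼s))))) ⟩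
    ⟦ least? r ⟧ * (⟦ r ∼? s ⟧ * (⟦ map neg r ∼? r ⟧ * meets s s))
      ≡⟨ cong (⟦ least? r ⟧ *_) (*-left-comm ⟦ r ∼? s ⟧ ⟦ map neg r ∼? r ⟧ (meets s s)) ⟩
    ⟦ least? r ⟧ * (⟦ map neg r ∼? r ⟧ * (⟦ r ∼? s ⟧ * meets s s))
      ≡⟨ *-assoc ⟦ least? r ⟧ _ _ ⟨
    ⟦ least? r ⟧ * ⟦ map neg r ∼? r ⟧ * (⟦ r ∼? s ⟧ * meets s s)
      ≡⟨ cong (⟦ least? r ⟧ * ⟦ map neg r ∼? r ⟧ *_) (sym (meets≡ r s pos lr)) ⟩
    ⟦ least? r ⟧ * ⟦ map neg r ∼? r ⟧ * meets r s ∎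

-- Words negated by a reflection

∑-rotate : ∀ n (f : SignSeq → ℕ) → ∑ (allSeqs n) (f ∘ rotate) ≡ ∑ (allSeqs n) f
∑-rotate n = ∑-allSeqs-reindex n rotate (rotate^ (n ∸ 1))
  (λ s len → trans (length-rotate s) len , inverse n s len)
  (λ s len → trans (length-rotate^ (n ∸ 1) s) len , trans (rotate^-comm 1 (n ∸ 1) s) (inverse n s len))
  where
  inverse : ∀ n s → length s ≡ n → rotate^ (n ∸ 1) (rotate s) ≡ s
  inverse zero    []      _   = refl
  inverse (suc n) s       len = rotate^-∸ s len (s≤s z≤n)

∑-rotate^ : ∀ i n (f : SignSeq → ℕ) → ∑ (allSeqs n) (f ∘ rotate^ i) ≡ ∑ (allSeqs n) f
∑-rotate^ zero    n f = refl
∑-rotate^ (suc i) n f = trans (∑-rotate n (f ∘ rotate^ i)) (∑-rotate^ i n f)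

-- Fixed points of the reflection with index `i` followed by complementation; the index encodes the
-- axis of the reflection.
flips : ℕ → ℕ → ℕ
flips n i = ∑[ s ∈ allSeqs n ] ⟦ rotate^ i (reverse (map neg s)) ≟ʷ s ⟧

rotate-reverse-neg-rotate : ∀ s → rotate (reverse (map neg (rotate s))) ≡ reverse (map neg s)
rotate-reverse-neg-rotate s =
  trans (cong (rotate ∘ reverse) (sym (rotate-map-neg s))) (rotate-reverse-rotate (map neg s))

-- Conjugating a reflection by one rotation step moves its index by two, and conjugate maps have
-- equally many fixed points. Only the parity of the index matters.
flips-2+ : ∀ n i → flips n (2 + i) ≡ flips n i
flips-2+ n i = trans (sym (∑-rotate n _)) (∑-ext (allSeqs n) λ s →
  ⟦⟧-cong (rotate^ (2 + i) (reverse (map neg (rotate s))) ≟ʷ rotate s) (rotate^ i (reverse (map neg s)) ≟ʷ s)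
    (λ eq → rotate-injective (trans (sym (move s)) eq))
    (λ eq → trans (move s) (cong rotate eq)))
  where
  move : ∀ s → rotate^ (2 + i) (reverse (map neg (rotate s))) ≡ rotate (rotate^ i (reverse (map neg s)))
  move s = trans (cong (rotate^ (1 + i)) (rotate-reverse-neg-rotate s)) (rotate^-comm i 1 (reverse (map neg s)))

-- The axis passes through a position, whose sign would have to equal its own negative.
flips-1 : ∀ n → 0 < n → flips n 1 ≡ 0
flips-1 n pos = trans (sym (∑-rotate n _)) (∑-zero (allSeqs n) λ {s} s∈ →
  ⟦⟧-no (_ ≟ʷ _) λ eq → absurd s (subst (0 <_) (sym (∈-allSeqs⁻ n s∈)) pos)
                           (trans (sym (rotate-reverse-neg-rotate s)) eq))
  where
  absurd : ∀ s → 0 < length s → reverse (map neg s) ≢ rotate s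
  absurd (a ∷ s) _ eq = neg-≢ a (∷ʳ-injectiveʳ (reverse (map neg s)) s
    (trans (sym (unfold-reverse (neg a) (map neg s))) eq))

-- The axis passes between positions, so the first half of the word is free and determines the
-- second.
flips-0 : ∀ m → flips (m + m) 0 ≡ 2 ^ m
flips-0 m = begin
  flips (m + m) 0
    ≡⟨ ∑-allSeqs-+ m m _ ⟩
  (∑[ s ∈ allSeqs m ] ∑[ t ∈ allSeqs m ] ⟦ reverse (map neg (s ++ t)) ≟ʷ s ++ t ⟧)
    ≡⟨ ∑-cong (allSeqs m) (λ {s} s∈ → one s (∈-allSeqs⁻ m s∈)) ⟩
  (∑[ s ∈ allSeqs m ] 1)
    ≡⟨ trans (∑-const (allSeqs m) 1) (*-identityʳ _) ⟩
  length (allSeqs m)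
    ≡⟨ length-allSeqs m ⟩
  2 ^ m ∎
  where
  open ≡-Reasoning
  reverse-neg-++ : ∀ s t → reverse (map neg (s ++ t)) ≡ reverse (map neg t) ++ reverse (map neg s)
  reverse-neg-++ s t = trans (cong reverse (map-++ neg s t)) (reverse-++ (map neg s) (map neg t))
  length-rn : ∀ s → length (reverse (map neg s)) ≡ length s
  length-rn s = trans (length-reverse (map neg s)) (length-map neg s)
  rn-involutive : ∀ s → reverse (map neg (reverse (map neg s))) ≡ s
  rn-involutive s = trans (cong reverse (map-neg-reverse (map neg s)))
    (trans (reverse-involutive _) (map-neg-involutive s))
  one : ∀ s → length s ≡ m → (∑[ t ∈ allSeqs m ] ⟦ reverse (map neg (s ++ t)) ≟ʷ s ++ t ⟧) ≡ 1
  one s len = trans (∑-allSeqs-single (reverse (map neg s)) _ (trans (length-rn s) len) off)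
    (⟦⟧-yes (_ ≟ʷ _) (trans (reverse-neg-++ s (reverse (map neg s))) (cong (_++ reverse (map neg s)) (rn-involutive s))))
    where
    off : ∀ {t} → length t ≡ m → t ≢ reverse (map neg s) → ⟦ reverse (map neg (s ++ t)) ≟ʷ s ++ t ⟧ ≡ 0
    off {t} lt t≢ = ⟦⟧-no (_ ≟ʷ _) λ eq → t≢ (trans (sym (rn-involutive t)) (cong (reverse ∘ map neg)
      (proj₁ (++-injective (reverse (map neg t)) s (trans (length-rn t) (trans lt (sym len)))
        (trans (sym (reverse-neg-++ s t)) eq)))))

-- Of the 2m indices, the m even ones contribute 2^m each and the m odd ones nothing.
∑-reflections : ∀ m → 0 < m → (∑[ s ∈ allSeqs (m + m) ] hits (m + m) (reverse (map neg s)) s) ≡ m * 2 ^ m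
∑-reflections m pos = begin
  (∑[ s ∈ allSeqs n ] hits n (reverse (map neg s)) s) ≡⟨ ∑-comm (allSeqs n) (upTo n) _ ⟩
  ∑ (upTo n) (flips n)                                ≡⟨ cong (λ k → ∑ (upTo k) (flips n)) (n+n≡n*2 m) ⟩
  ∑ (upTo (m * 2)) (flips n)                          ≡⟨ ∑-upTo-* m 2 (flips n) ⟩
  (∑[ t ∈ upTo m ] ∑[ j ∈ upTo 2 ] flips n (t * 2 + j)) ≡⟨ ∑-ext (upTo m) (λ t → cong₂ (λ a b → a + (b + 0))
                                                           (trans (even t 0) (flips-0 m))
                                                           (trans (even t 1) (flips-1 n (≤-trans pos (m≤m+n m m))))) ⟩
  (∑[ t ∈ upTo m ] (2 ^ m + 0))                       ≡⟨ ∑-const (upTo m) _ ⟩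
  length (upTo m) * (2 ^ m + 0)                       ≡⟨ cong₂ _*_ (length-upTo m) (+-identityʳ (2 ^ m)) ⟩
  m * 2 ^ m                                           ∎
  where
  open ≡-Reasoning
  n = m + m
  even : ∀ t j → flips n (t * 2 + j) ≡ flips n j
  even zero    j = refl
  even (suc t) j = trans (flips-2+ n (t * 2 + j)) (even t j)

-- Primitive roots and Lyndon words

power : ℕ → SignSeq → SignSeq
power zero    w = []
power (suc l) w = w ++ power l w

length-power : ∀ l w → length (power l w) ≡ l * length w
length-power zero    w = refl
length-power (suc l) w = trans (length-++ w) (cong (length w +_) (length-power l w))

rotate-power : ∀ l w → rotate (power l w) ≡ power l (rotate w)
rotate-power zero    w       = refl
rotate-power (suc l) []      = rotate-power l []
rotate-power (suc l) (a ∷ s) = begin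
  (s ++ power l (a ∷ s)) ∷ʳ a    ≡⟨ ++-assoc s _ _ ⟩
  s ++ power l (a ∷ s) ∷ʳ a      ≡⟨ cong (s ++_) (slide l) ⟩
  s ++ a ∷ power l (s ∷ʳ a)      ≡⟨ ++-assoc s (a ∷ []) _ ⟨
  (s ∷ʳ a) ++ power l (s ∷ʳ a)   ∎
  where
  open ≡-Reasoning
  slide : ∀ l → power l (a ∷ s) ∷ʳ a ≡ a ∷ power l (s ∷ʳ a)
  slide zero    = refl
  slide (suc l) = cong (a ∷_) (trans (++-assoc s (power l (a ∷ s)) (a ∷ []))
    (trans (cong (s ++_) (slide l)) (sym (++-assoc s (a ∷ []) (power l (s ∷ʳ a))))))

rotate^-power : ∀ i l w → rotate^ i (power l w) ≡ power l (rotate^ i w)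
rotate^-power zero    l w = refl
rotate^-power (suc i) l w = trans (cong (rotate^ i) (rotate-power l w)) (rotate^-power i l (rotate w))

power-injective : ∀ l {v w} → 0 < l → length v ≡ length w → power l v ≡ power l w → v ≡ w
power-injective (suc l) {v} {w} _ len eq = proj₁ (++-injective v w len eq)

rotate^-multiple : ∀ q p s → rotate^ p s ≡ s → rotate^ (q * p) s ≡ s
rotate^-multiple zero    p s eq = refl
rotate^-multiple (suc q) p s eq =
  trans (rotate^-+ p (q * p) s) (trans (cong (rotate^ (q * p)) eq) (rotate^-multiple q p s eq))

rotate^-% : ∀ i p .{{_ : NonZero p}} s → rotate^ p s ≡ s → rotate^ i s ≡ rotate^ (i % p) s
rotate^-% i p s eq = begin
  rotate^ i s                               ≡⟨ cong (λ k → rotate^ k s) (m≡m%n+[m/n]*n i p) ⟩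
  rotate^ (i % p + i / p * p) s             ≡⟨ rotate^-+ (i % p) (i / p * p) s ⟩
  rotate^ (i / p * p) (rotate^ (i % p) s)   ≡⟨ rotate^-comm (i / p * p) (i % p) s ⟩
  rotate^ (i % p) (rotate^ (i / p * p) s)   ≡⟨ cong (rotate^ (i % p)) (rotate^-multiple (i / p) p s eq) ⟩
  rotate^ (i % p) s                         ∎
  where open ≡-Reasoning

Primitive : SignSeq → Set
Primitive w = ∀ {i} → i < length w → 0 < i → rotate^ i w ≢ w

primitive? : ∀ w → Dec (Primitive w)
primitive? w = allUpTo? (λ i → (0 <? i) →-dec ¬? (rotate^ i w ≟ʷ w)) (length w)

-- The remainder of a period modulo the least positive one is again a period, so it must be 0.
least-period∣ : ∀ k s → rotate^ (suc k) s ≡ s → (∀ {i} → i < suc k → 0 < i → rotate^ i s ≢ s) →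
                ∀ i → rotate^ i s ≡ s → suc k ∣ i
least-period∣ k s eq least i eqi with i % suc k in rem
... | zero  = m%n≡0⇒n∣m i (suc k) rem
... | suc r = contradiction (trans (cong (λ j → rotate^ j s) (sym rem)) (trans (sym (rotate^-% i (suc k) s eq)) eqi))
                (least (subst (_< suc k) rem (m%n<n i (suc k))) (s≤s z≤n))

primitive∣ : ∀ w → 0 < length w → Primitive w → ∀ i → rotate^ i w ≡ w → length w ∣ i
primitive∣ (a ∷ w) pos prim = least-period∣ (length w) (a ∷ w) (rotate^-length (a ∷ w)) prim

-- Commutation makes `w` a prefix of `z`; after stripping it the remainder still commutes with `w`.
commute⇒power : ∀ l w z → length z ≡ l * length w → z ++ w ≡ w ++ z → z ≡ power l w
commute⇒power zero    w []  len eq = refl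
commute⇒power (suc l) w z   len eq = trans z≡ (cong (w ++_) (commute⇒power l w z′ len′ eq′))
  where
  p  = length w
  z′ = drop p z
  split : take p z ≡ w × z′ ++ w ≡ z
  split = ++-injective (take p z) w
    (trans (length-take p z) (m≤n⇒m⊓n≡m (≤-trans (m≤m+n p (l * p)) (≤-reflexive (sym len)))))
    (trans (sym (++-assoc (take p z) z′ w)) (trans (cong (_++ w) (take++drop≡id p z)) eq))
  z≡ : z ≡ w ++ z′
  z≡ = trans (sym (take++drop≡id p z)) (cong (_++ z′) (proj₁ split))
  len′ : length z′ ≡ l * p
  len′ = +-cancelˡ-≡ p _ _ (trans (sym (trans (cong length z≡) (length-++ w))) len)
  eq′ : z′ ++ w ≡ w ++ z′
  eq′ = trans (proj₂ split) z≡

least-witness : {P : ℕ → Set} → Decidable P → ∀ n → P n → ∃ λ k → P k × (∀ {j} → j < k → ¬ P j)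
least-witness {P} P? = <-rec _ search
  where
  search : ∀ n → (∀ {m} → m < n → P m → ∃ λ k → P k × (∀ {j} → j < k → ¬ P j)) →
           P n → ∃ λ k → P k × (∀ {j} → j < k → ¬ P j)
  search n rec pn with anyUpTo? P? n
  ... | yes (m , m<n , pm) = rec m<n pm
  ... | no none            = n , pn , λ {j} j<n pj → none (j , j<n , pj)

record Root (u : SignSeq) : Set where
  field
    word      : SignSeq
    exponent  : ℕ
    prim      : Primitive word
    expand    : power exponent word ≡ u

-- The length is a period, so a least positive period exists and divides it. The prefix of that
-- length commutes with the rest of the word, which makes the word a power of it; a shorter period
-- of the prefix would be one of the whole word.
root : ∀ u → 0 < length u → Root u
root u@(_ ∷ s) _ with least-witness (λ i → rotate^ (suc i) u ≟ʷ u) (length s) (rotate^-length u)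
... | k , period , least = record { word = w ; exponent = quotient p∣ ; prim = prim ; expand = sym u≡ }
  where
  p = suc k
  least′ : ∀ {i} → i < p → 0 < i → rotate^ i u ≢ u
  least′ {suc i} (s≤s i<) _ = least i<
  p∣ : p ∣ length u
  p∣ = least-period∣ k u period least′ (length u) (rotate^-length u)
  w = take p u
  z = drop p u
  len-w : length w ≡ p
  len-w = trans (length-take p u) (m≤n⇒m⊓n≡m (∣⇒≤ p∣))
  commutes : z ++ w ≡ w ++ z
  commutes = begin
    z ++ w                         ≡⟨ rotate^-++ w z ⟨
    rotate^ (length w) (w ++ z)    ≡⟨ cong₂ rotate^ len-w (take++drop≡id p u) ⟩
    rotate^ p u                    ≡⟨ period ⟩
    u                              ≡⟨ take++drop≡id p u ⟨
    w ++ z                         ∎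
    where open ≡-Reasoning
  u≡ : u ≡ power (quotient p∣) w
  u≡ = commute⇒power (quotient p∣) w u
    (trans (_∣_.equality p∣) (cong (quotient p∣ *_) (sym len-w)))
    (begin
      u ++ w            ≡⟨ cong (_++ w) (take++drop≡id p u) ⟨
      (w ++ z) ++ w     ≡⟨ ++-assoc w z w ⟩
      w ++ (z ++ w)     ≡⟨ cong (w ++_) (trans commutes (take++drop≡id p u)) ⟩
      w ++ u            ∎)
    where open ≡-Reasoning
  prim : Primitive w
  prim {i} i< 0<i eq = least′ (subst (i <_) len-w i<) 0<i
    (trans (cong (rotate^ i) u≡) (trans (rotate^-power i (quotient p∣) w) (trans (cong (power (quotient p∣)) eq) (sym u≡))))

-- Rotation by the length of `v` fixes the common power, hence fixes `w`, and the periods of a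
-- primitive word are the multiples of its length.
power-period∣ : ∀ {l l′ v w} → 0 < l′ → 0 < length w → Primitive w → power l v ≡ power l′ w → length w ∣ length v
power-period∣ {l} {l′} {v} {w} 0<l′ pos prim eq = primitive∣ w pos prim (length v)
  (power-injective l′ 0<l′ (length-rotate^ (length v) w) (begin
    power l′ (rotate^ (length v) w)  ≡⟨ rotate^-power (length v) l′ w ⟨
    rotate^ (length v) (power l′ w)  ≡⟨ cong (rotate^ (length v)) eq ⟨
    rotate^ (length v) (power l v)   ≡⟨ rotate^-power (length v) l v ⟩
    power l (rotate^ (length v) v)   ≡⟨ cong (power l) (rotate^-length v) ⟩
    power l v                        ≡⟨ eq ⟩
    power l′ w                       ∎))
  where open ≡-Reasoning

*-pos : ∀ {m n} → 0 < m * n → 0 < m × 0 < n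
*-pos {zero}  {n}     ()
*-pos {suc m} {zero}  pos = contradiction (subst (0 <_) (*-zeroʳ m) pos) λ ()
*-pos {suc m} {suc n} pos = s≤s z≤n , s≤s z≤n

power-pos : ∀ l w → 0 < length (power l w) → 0 < l × 0 < length w
power-pos l w pos = *-pos (subst (0 <_) (length-power l w) pos)

-- Each of the two roots has a length dividing that of the other, so the lengths agree; then so do
-- the exponents and the prefixes.
root-unique : ∀ {l l′ v w} → 0 < length (power l v) → Primitive v → Primitive w → power l v ≡ power l′ w →
              v ≡ w × l ≡ l′
root-unique {l} {l′} {v} {w} pos pv pw eq
  with power-pos l v pos | power-pos l′ w (subst (λ u → 0 < length u) eq pos)
... | 0<l , 0<v | 0<l′ , 0<w = v≡w , l≡l′
  where
  |v|≡|w| : length v ≡ length w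
  |v|≡|w| = ∣-antisym (power-period∣ {l′} {l} 0<l 0<v pv (sym eq)) (power-period∣ {l} {l′} 0<l′ 0<w pw eq)
  instance _ = >-nonZero 0<w
  l≡l′ : l ≡ l′
  l≡l′ = *-cancelʳ-≡ l l′ (length w) (begin
    l * length w         ≡⟨ cong (l *_) |v|≡|w| ⟨
    l * length v         ≡⟨ length-power l v ⟨
    length (power l v)   ≡⟨ cong length eq ⟩
    length (power l′ w)  ≡⟨ length-power l′ w ⟩
    l′ * length w        ∎)
    where open ≡-Reasoning
  v≡w : v ≡ w
  v≡w = power-injective l′ 0<l′ |v|≡|w| (trans (cong (λ k → power k v) (sym l≡l′)) eq)

-- A sum over all pairs with l p = n, where p will be the length of a root and l its exponent.
-- Running over a full square with an indicator leaves the two sums free to be swapped.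
∑-factorisations : ℕ → (ℕ → ℕ → ℕ) → ℕ
∑-factorisations n h = ∑[ p ∈ upTo (suc n) ] ∑[ l ∈ upTo (suc n) ] ⟦ l * p ≟ n ⟧ * h p l

∑-roots : ∀ {n} u → 0 < n → length u ≡ n →
          ∑-factorisations n (λ p l → ∑[ w ∈ allSeqs p ] ⟦ primitive? w ⟧ * ⟦ power l w ≟ʷ u ⟧) ≡ 1
∑-roots {n} u pos refl = begin
  ∑-factorisations n (λ p l → ∑[ w ∈ allSeqs p ] ⟦ primitive? w ⟧ * ⟦ power l w ≟ʷ u ⟧)
    ≡⟨ ∑-single _ (Unique.upTo⁺ (suc n)) (∈-upTo⁺ (s≤s (≤-trans (m≤n*m p* l*) (≤-reflexive l*p≡)))) (λ {p} _ p≢ →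
         ∑-zero (upTo (suc n)) λ {l} _ → trans (⟦⟧-*-cong (l * p ≟ n) {n = 0} (λ _ → ∑-zero (allSeqs p) (λ {w} w∈ →
           none w l λ (w≡ , _) → p≢ (trans (sym (∈-allSeqs⁻ p w∈)) (cong length w≡))))) (*-zeroʳ ⟦ l * p ≟ n ⟧)) ⟩
  (∑[ l ∈ upTo (suc n) ] ⟦ l * p* ≟ n ⟧ * (∑[ w ∈ allSeqs p* ] ⟦ primitive? w ⟧ * ⟦ power l w ≟ʷ u ⟧))
    ≡⟨ ∑-single _ (Unique.upTo⁺ (suc n)) (∈-upTo⁺ (s≤s (≤-trans (m≤m*n l* p*) (≤-reflexive l*p≡)))) (λ {l} _ l≢ →
         trans (⟦⟧-*-cong (l * p* ≟ n) {n = 0} (λ _ → ∑-zero (allSeqs p*) (λ {w} w∈ → none w l λ (_ , l≡) → l≢ l≡)))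
               (*-zeroʳ ⟦ l * p* ≟ n ⟧)) ⟩
  ⟦ l* * p* ≟ n ⟧ * (∑[ w ∈ allSeqs p* ] ⟦ primitive? w ⟧ * ⟦ power l* w ≟ʷ u ⟧)
    ≡⟨ ⟦⟧-*-yes (l* * p* ≟ n) l*p≡ ⟩
  (∑[ w ∈ allSeqs p* ] ⟦ primitive? w ⟧ * ⟦ power l* w ≟ʷ u ⟧)
    ≡⟨ ∑-allSeqs-single w* _ refl (λ {w} _ w≢ → none w l* λ (w≡ , _) → w≢ w≡) ⟩
  ⟦ primitive? w* ⟧ * ⟦ power l* w* ≟ʷ u ⟧
    ≡⟨ cong₂ _*_ (⟦⟧-yes (primitive? w*) prim*) (⟦⟧-yes (_ ≟ʷ _) expand*) ⟩
  1 ∎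
  where
  open ≡-Reasoning
  open Root (root u pos) renaming (word to w*; exponent to l*; prim to prim*; expand to expand*)
  p* = length w*
  l*p≡ : l* * p* ≡ n
  l*p≡ = trans (sym (length-power l* w*)) (cong length expand*)
  0<l* = proj₁ (*-pos {l*} {p*} (subst (0 <_) (sym l*p≡) pos))
  0<p* = proj₂ (*-pos {l*} {p*} (subst (0 <_) (sym l*p≡) pos))
  instance
    _ = >-nonZero 0<l*
    _ = >-nonZero 0<p*
  none : ∀ w l → ¬ (w ≡ w* × l ≡ l*) → ⟦ primitive? w ⟧ * ⟦ power l w ≟ʷ u ⟧ ≡ 0
  none w l ≢ = trans (sym (⟦⟧-× (primitive? w) (power l w ≟ʷ u)))
    (⟦⟧-no (primitive? w ×-dec (power l w ≟ʷ u)) λ (prim , eq) →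
      ≢ (root-unique {l} {l*} (subst (λ t → 0 < length t) (sym eq) pos) prim prim* (trans eq (sym expand*))))

-- Words are grouped by primitive root and exponent, using that every nonempty word has exactly one
-- of each.
∑-primitive-roots : ∀ n → 0 < n → (f : SignSeq → ℕ) →
  ∑ (allSeqs n) f ≡ ∑-factorisations n (λ p l → ∑[ w ∈ allSeqs p ] ⟦ primitive? w ⟧ * f (power l w))
∑-primitive-roots n pos f = begin
  ∑ U f
    ≡⟨ ∑-cong U (λ {u} u∈ → sym (trans (cong (_* f u) (∑-roots u pos (∈-allSeqs⁻ n u∈))) (*-identityˡ (f u)))) ⟩
  (∑[ u ∈ U ] ∑-factorisations n (λ p l → c p l u) * f u)
    ≡⟨ ∑-ext U (λ u → trans (sym (∑-*ʳ N (f u) (λ p → ∑[ l ∈ N ] ⟦ l * p ≟ n ⟧ * c p l u)))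
                             (∑-ext N (λ p → sym (∑-*ʳ N (f u) (λ l → ⟦ l * p ≟ n ⟧ * c p l u))))) ⟩
  (∑[ u ∈ U ] ∑[ p ∈ N ] ∑[ l ∈ N ] ⟦ l * p ≟ n ⟧ * c p l u * f u)
    ≡⟨ ∑-comm U N _ ⟩
  (∑[ p ∈ N ] ∑[ u ∈ U ] ∑[ l ∈ N ] ⟦ l * p ≟ n ⟧ * c p l u * f u)
    ≡⟨ ∑-ext N (λ p → ∑-comm U N _) ⟩
  (∑[ p ∈ N ] ∑[ l ∈ N ] ∑[ u ∈ U ] ⟦ l * p ≟ n ⟧ * c p l u * f u)
    ≡⟨ ∑-ext N (λ p → ∑-ext N (λ l → trans (trans (∑-ext U (λ u → *-assoc ⟦ l * p ≟ n ⟧ _ _)) (∑-*ˡ U ⟦ l * p ≟ n ⟧ _))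
                                           (⟦⟧-*-cong (l * p ≟ n) (collect p l)))) ⟩
  ∑-factorisations n (λ p l → ∑[ w ∈ allSeqs p ] ⟦ primitive? w ⟧ * f (power l w)) ∎
  where
  open ≡-Reasoning
  U = allSeqs n
  N = upTo (suc n)
  c : ℕ → ℕ → SignSeq → ℕ
  c p l u = ∑[ w ∈ allSeqs p ] ⟦ primitive? w ⟧ * ⟦ power l w ≟ʷ u ⟧
  collect : ∀ p l → l * p ≡ n → (∑[ u ∈ U ] c p l u * f u) ≡ (∑[ w ∈ allSeqs p ] ⟦ primitive? w ⟧ * f (power l w))
  collect p l lp = begin
    (∑[ u ∈ U ] c p l u * f u)
      ≡⟨ ∑-ext U (λ u → sym (∑-*ʳ (allSeqs p) (f u) _)) ⟩
    (∑[ u ∈ U ] ∑[ w ∈ allSeqs p ] ⟦ primitive? w ⟧ * ⟦ power l w ≟ʷ u ⟧ * f u)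
      ≡⟨ ∑-comm U (allSeqs p) _ ⟩
    (∑[ w ∈ allSeqs p ] ∑[ u ∈ U ] ⟦ primitive? w ⟧ * ⟦ power l w ≟ʷ u ⟧ * f u)
      ≡⟨ ∑-cong (allSeqs p) (λ {w} w∈ → trans (∑-allSeqs-single (power l w) _
           (trans (length-power l w) (trans (cong (l *_) (∈-allSeqs⁻ p w∈)) lp))
           (λ {u} _ u≢ → cong (_* f u) (trans (cong (⟦ primitive? w ⟧ *_) (⟦⟧-no (power l w ≟ʷ u) (u≢ ∘ sym))) (*-zeroʳ ⟦ primitive? w ⟧))))
           (cong (_* f (power l w)) (trans (cong (⟦ primitive? w ⟧ *_) (⟦⟧-yes (power l w ≟ʷ power l w) refl)) (*-identityʳ ⟦ primitive? w ⟧)))) ⟩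
    (∑[ w ∈ allSeqs p ] ⟦ primitive? w ⟧ * f (power l w)) ∎

-- Lyndon words as representatives of primitive words under rotation

Lyndon : SignSeq → Set
Lyndon s = ∀ {i} → i < length s → 0 < i → binary s < binary (rotate^ i s)

lyndon? : ∀ s → Dec (Lyndon s)
lyndon? s = map′ to from (T? (isLyndon s))
  where
  to : T (isLyndon s) → Lyndon s
  to lyn {suc i} i< _ = lexLt⇒< s _ (sym (length-rotate^ (suc i) s))
    (subst (T ∘ lexLt s) (rot≡rotate^ (suc i) s (<⇒≤ i<)) (allB⁻ _ (upTo (length s ∸ 1)) lyn (∈-upTo⁺ (∸-monoˡ-< i< (s≤s z≤n)))))
  from : Lyndon s → T (isLyndon s)
  from lyn = allB⁺ _ (upTo (length s ∸ 1)) λ {i} i∈ → below i (inc (length s) i (∈-upTo⁻ i∈))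
    where
    inc : ∀ n i → i < n ∸ 1 → suc i < n
    inc (suc n) i i< = s≤s i<
    below : ∀ i → suc i < length s → T (lexLt s (rot (suc i) s))
    below i i< rewrite rot≡rotate^ (suc i) s (<⇒≤ i<) =
      <⇒lexLt s _ (sym (length-rotate^ (suc i) s)) (lyn i< (s≤s z≤n))

Lyndon⇒Primitive : ∀ {s} → Lyndon s → Primitive s
Lyndon⇒Primitive lyn i< 0<i eq = <⇒≢ (lyn i< 0<i) (cong binary (sym eq))

Primitive-rotate^⁻ : ∀ i {s} → Primitive (rotate^ i s) → Primitive s
Primitive-rotate^⁻ i {s} prim {j} j< 0<j eq = prim (subst (j <_) (sym (length-rotate^ i s)) j<) 0<j
  (trans (rotate^-comm j i s) (cong (rotate^ i) eq))

Primitive-rotate^⁺ : ∀ i {s} → Primitive s → Primitive (rotate^ i s)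
Primitive-rotate^⁺ i {s} prim {j} j< 0<j eq = prim (subst (j <_) (length-rotate^ i s) j<) 0<j
  (rotate^-injective i (trans (rotate^-comm i j s) eq))

-- Each of the two words is a proper rotation of the other, so each would be strictly smaller than
-- the other.
lyndon-irreflexive : ∀ {s i j} → i < j → j < length s → Lyndon (rotate^ i s) → ¬ Lyndon (rotate^ j s)
lyndon-irreflexive {s} {i} {j} i<j j<n lynᵢ lynⱼ = <-asym
  (subst (λ t → binary (rotate^ i s) < binary t) forth
    (lynᵢ (subst (d <_) (sym (length-rotate^ i s)) d<n) (m<n⇒0<n∸m i<j)))
  (subst (λ t → binary (rotate^ j s) < binary t) back
    (lynⱼ (subst (n ∸ d <_) (sym (length-rotate^ j s)) (∸-monoʳ-< {n} (m<n⇒0<n∸m i<j) (<⇒≤ d<n))) (m<n⇒0<n∸m d<n)))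
  where
  n = length s
  d = j ∸ i
  d<n : d < n
  d<n = ≤-<-trans (m∸n≤m j i) j<n
  forth : rotate^ d (rotate^ i s) ≡ rotate^ j s
  forth = trans (sym (rotate^-+ i d s)) (cong (λ k → rotate^ k s) (m+[n∸m]≡n (<⇒≤ i<j)))
  back : rotate^ (n ∸ d) (rotate^ j s) ≡ rotate^ i s
  back = trans (cong (rotate^ (n ∸ d)) (sym forth)) (rotate^-∸ (rotate^ i s) (length-rotate^ i s) (<⇒≤ d<n))

-- The rotation of least numerical value is Lyndon: by primitivity the rotations are distinct, so
-- the minimum is strict.
∑-lyndon-rotations : ∀ {p} w → 0 < p → length w ≡ p → Primitive w → (∑[ i ∈ upTo p ] ⟦ lyndon? (rotate^ i w) ⟧) ≡ 1
∑-lyndon-rotations {p} w pos refl prim = trans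
  (∑-single _ (Unique.upTo⁺ p) (∈-upTo⁺ i*<) (λ {i} i∈ i≢ → ⟦⟧-no (lyndon? (rotate^ i w)) (off i (∈-upTo⁻ i∈) i≢)))
  (⟦⟧-yes (lyndon? (rotate^ i* w)) lyn*)
  where
  instance _ = >-nonZero pos
  key : ℕ → ℕ
  key i = binary (rotate^ i w)
  i* = argmin key 0 (upTo p)
  i*< : i* < p
  i*< = argmin-all key {xs = upTo p} {P = _< p} pos (All.tabulate ∈-upTo⁻)
  minimal : ∀ i → key i* ≤ key i
  minimal i = subst (key i* ≤_) (cong binary (sym (rotate^-% i p w (rotate^-length w))))
    (All.lookup (f[argmin]≤f[xs] {f = key} 0 (upTo p)) (∈-upTo⁺ (m%n<n i p)))
  lyn* : Lyndon (rotate^ i* w)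
  lyn* {j} j< 0<j = ≤∧≢⇒<
    (subst (λ t → key i* ≤ binary t) (rotate^-+ i* j w) (minimal (i* + j)))
    (λ eq → Primitive-rotate^⁺ i* prim j< 0<j (sym (binary-injective _ _ (sym (length-rotate^ j (rotate^ i* w))) eq)))
  off : ∀ i → i < p → i ≢ i* → ¬ Lyndon (rotate^ i w)
  off i i< i≢ lyn with <-cmp i i*
  ... | tri< lt _ _ = lyndon-irreflexive {w} lt i*< lyn lyn*
  ... | tri≈ _ eq _ = i≢ eq
  ... | tri> _ _ gt = lyndon-irreflexive {w} gt i< lyn* lyn

-- A primitive word becomes Lyndon under exactly one of its p rotations, and is recovered by
-- rotating back.
∑-primitive : ∀ p → 0 < p → (f : SignSeq → ℕ) →
  (∑[ w ∈ allSeqs p ] ⟦ primitive? w ⟧ * f w) ≡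
  (∑[ v ∈ allSeqs p ] ⟦ lyndon? v ⟧ * (∑[ i ∈ upTo p ] f (rotate^ i v)))
∑-primitive p pos f = begin
  (∑[ w ∈ W ] ⟦ primitive? w ⟧ * f w)
    ≡⟨ ∑-cong W (λ {w} w∈ → ⟦⟧-*-cong (primitive? w) (λ prim →
         sym (trans (cong (_* f w) (∑-lyndon-rotations w pos (∈-allSeqs⁻ p w∈) prim)) (*-identityˡ (f w))))) ⟩
  (∑[ w ∈ W ] ⟦ primitive? w ⟧ * ((∑[ i ∈ upTo p ] ⟦ lyndon? (rotate^ i w) ⟧) * f w))
    ≡⟨ ∑-ext W (λ w → trans (cong (⟦ primitive? w ⟧ *_) (sym (∑-*ʳ (upTo p) (f w) _))) (sym (∑-*ˡ (upTo p) ⟦ primitive? w ⟧ _))) ⟩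
  (∑[ w ∈ W ] ∑[ i ∈ upTo p ] ⟦ primitive? w ⟧ * (⟦ lyndon? (rotate^ i w) ⟧ * f w))
    ≡⟨ ∑-comm W (upTo p) _ ⟩
  (∑[ i ∈ upTo p ] ∑[ w ∈ W ] ⟦ primitive? w ⟧ * (⟦ lyndon? (rotate^ i w) ⟧ * f w))
    ≡⟨ ∑-cong (upTo p) (λ {i} i∈ → trans (∑-cong W (λ {w} w∈ → conjugate i w (∈-upTo⁻ i∈) (∈-allSeqs⁻ p w∈)))
                                         (∑-rotate^ i p (λ v → ⟦ lyndon? v ⟧ * f (rotate^ (p ∸ i) v)))) ⟩
  (∑[ i ∈ upTo p ] ∑[ v ∈ W ] ⟦ lyndon? v ⟧ * f (rotate^ (p ∸ i) v))
    ≡⟨ ∑-comm (upTo p) W _ ⟩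
  (∑[ v ∈ W ] ∑[ i ∈ upTo p ] ⟦ lyndon? v ⟧ * f (rotate^ (p ∸ i) v))
    ≡⟨ ∑-cong W (λ {v} v∈ → trans (∑-*ˡ (upTo p) ⟦ lyndon? v ⟧ _) (cong (⟦ lyndon? v ⟧ *_)
         -- Rotating back uses the exponents p, ..., 1 instead of 0, ..., p - 1; the end values p
         -- and 0 act alike.
         (trans (∑-upTo-∸ p (λ i → f (rotate^ i v)))
                (∑-upTo-shift p (λ i → f (rotate^ i v)) (cong f (period v (∈-allSeqs⁻ p v∈))))))) ⟩
  (∑[ v ∈ W ] ⟦ lyndon? v ⟧ * (∑[ i ∈ upTo p ] f (rotate^ i v))) ∎
  where
  open ≡-Reasoning
  W = allSeqs p
  period : ∀ v → length v ≡ p → rotate^ p v ≡ v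
  period v refl = rotate^-length v
  conjugate : ∀ i w → i < p → length w ≡ p → ⟦ primitive? w ⟧ * (⟦ lyndon? (rotate^ i w) ⟧ * f w) ≡
              ⟦ lyndon? (rotate^ i w) ⟧ * f (rotate^ (p ∸ i) (rotate^ i w))
  conjugate i w i< len = begin
    ⟦ primitive? w ⟧ * (⟦ lyndon? (rotate^ i w) ⟧ * f w)  ≡⟨ *-left-comm ⟦ primitive? w ⟧ ⟦ lyndon? (rotate^ i w) ⟧ (f w) ⟩
    ⟦ lyndon? (rotate^ i w) ⟧ * (⟦ primitive? w ⟧ * f w)  ≡⟨ ⟦⟧-*-cong (lyndon? (rotate^ i w)) (λ lyn → trans
                                                              (⟦⟧-*-yes (primitive? w) (Primitive-rotate^⁻ i (Lyndon⇒Primitive lyn)))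
                                                              (cong f (sym (rotate^-∸ w len (<⇒≤ i<))))) ⟩
    ⟦ lyndon? (rotate^ i w) ⟧ * f (rotate^ (p ∸ i) (rotate^ i w)) ∎

-- Words negated by a rotation

-- Parity recorded as a sign: `negate k minus` is `plus` exactly when `k` is odd. Tests of parity
-- thereby become comparisons of signs.
negate : ℕ → Sign → Sign
negate zero    a = a
negate (suc k) a = negate k (neg a)

negate-+ : ∀ i j a → negate (i + j) a ≡ negate j (negate i a)
negate-+ zero    j a = refl
negate-+ (suc i) j a = negate-+ i j (neg a)

negate-neg : ∀ k a → negate k (neg a) ≡ neg (negate k a)
negate-neg zero    a = refl
negate-neg (suc k) a = negate-neg k (neg a)

negate-*2 : ∀ t j a → negate (t * 2 + j) a ≡ negate j a
negate-*2 zero    j a = refl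
negate-*2 (suc t) j a = trans (cong (negate (t * 2 + j)) (neg-involutive a)) (negate-*2 t j a)

negate-odd-* : ∀ t j → negate j minus ≡ plus → negate (t * j) minus ≡ negate t minus
negate-odd-* zero    j odd = refl
negate-odd-* (suc t) j odd = begin
  negate (j + t * j) minus          ≡⟨ negate-+ j (t * j) minus ⟩
  negate (t * j) (negate j minus)   ≡⟨ cong (negate (t * j)) odd ⟩
  negate (t * j) (neg minus)        ≡⟨ negate-neg (t * j) minus ⟩
  neg (negate (t * j) minus)        ≡⟨ cong neg (negate-odd-* t j odd) ⟩
  neg (negate t minus)              ≡⟨ negate-neg t minus ⟨
  negate (suc t) minus              ∎
  where open ≡-Reasoning

negate-even-* : ∀ t j → negate j minus ≡ minus → negate (t * j) minus ≡ minus
negate-even-* zero    j even = refl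
negate-even-* (suc t) j even =
  trans (negate-+ j (t * j) minus) (trans (cong (negate (t * j)) even) (negate-even-* t j even))

change : Sign → Sign → Sign
change minus b = b
change plus  b = neg b

-- The cyclic difference word, in which plus marks a change of sign: follow recovers signs from it.
path : Sign → SignSeq → Sign → SignSeq
path a []      z = change a z ∷ []
path a (b ∷ s) z = change a b ∷ path b s z

changes : SignSeq → SignSeq
changes []      = []
changes (a ∷ s) = path a s a

follow : Sign → SignSeq → Sign
follow a d = negate (countPlus d) a

follow-change : ∀ a b d → follow a (change a b ∷ d) ≡ follow b d
follow-change plus  plus  d = refl
follow-change plus  minus d = refl
follow-change minus plus  d = refl
follow-change minus minus d = refl

length-path : ∀ a s z → length (path a s z) ≡ suc (length s)
length-path a []      z = refl
length-path a (b ∷ s) z = cong suc (length-path b s z)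

path-∷ʳ : ∀ a s b z → path a (s ∷ʳ b) z ≡ path a s b ∷ʳ change b z
path-∷ʳ a []      b z = refl
path-∷ʳ a (c ∷ s) b z = cong (change a c ∷_) (path-∷ʳ c s b z)

changes-rotate : ∀ s → changes (rotate s) ≡ rotate (changes s)
changes-rotate []          = refl
changes-rotate (a ∷ [])    = refl
changes-rotate (a ∷ b ∷ s) = path-∷ʳ b s a b

changes-rotate^ : ∀ i s → changes (rotate^ i s) ≡ rotate^ i (changes s)
changes-rotate^ zero    s = refl
changes-rotate^ (suc i) s = trans (changes-rotate^ i (rotate s)) (cong (rotate^ i) (changes-rotate s))

change-neg : ∀ a b → change (neg a) (neg b) ≡ change a b
change-neg plus  b = refl
change-neg minus b = neg-involutive b

path-neg : ∀ a s z → path (neg a) (map neg s) (neg z) ≡ path a s z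
path-neg a []      z = cong (_∷ []) (change-neg a z)
path-neg a (b ∷ s) z = cong₂ _∷_ (change-neg a b) (path-neg b s z)

changes-neg : ∀ s → changes (map neg s) ≡ changes s
changes-neg []      = refl
changes-neg (a ∷ s) = path-neg a s a

change-injective : ∀ a {b c} → change a b ≡ change a c → b ≡ c
change-injective minus eq = eq
change-injective plus {b} {c} eq = trans (sym (neg-involutive b)) (trans (cong neg eq) (neg-involutive c))

path-injective : ∀ a s t {z} → length s ≡ length t → path a s z ≡ path a t z → s ≡ t
path-injective a []      []      len eq = refl
path-injective a (b ∷ s) (c ∷ t) len eq with change-injective a (∷-injectiveˡ eq)
... | refl = cong (b ∷_) (path-injective b s t (suc-injective len) (∷-injectiveʳ eq))

first : SignSeq → Sign
first []      = minus
first (a ∷ s) = a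

changes-injective : ∀ s t → length s ≡ length t → first s ≡ first t → changes s ≡ changes t → s ≡ t
changes-injective []      []      len hd eq = refl
changes-injective (a ∷ s) (.a ∷ t) len refl eq = cong (a ∷_) (path-injective a s t (suc-injective len) eq)

take-∷ʳ : ∀ i (s : SignSeq) a → i ≤ length s → take i (s ∷ʳ a) ≡ take i s
take-∷ʳ zero    s       a _        = refl
take-∷ʳ (suc i) (b ∷ s) a (s≤s i≤) = cong (b ∷_) (take-∷ʳ i s a i≤)

first-rotate^ : ∀ i s → i < length s → first (rotate^ i s) ≡ follow (first s) (take i (changes s))
first-rotate^ zero    (a ∷ s)     i< = refl
first-rotate^ (suc i) (a ∷ [])    (s≤s ())
first-rotate^ (suc i) (a ∷ b ∷ s) (s≤s i<) = begin
  first (rotate^ i (b ∷ (s ∷ʳ a)))                    ≡⟨ first-rotate^ i (b ∷ (s ∷ʳ a)) (≤-trans i< (≤-trans (n≤1+n _) (≤-reflexive (sym (length-rotate (a ∷ b ∷ s)))))) ⟩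
  follow b (take i (path b (s ∷ʳ a) b))               ≡⟨ cong (λ d → follow b (take i d)) (path-∷ʳ b s a b) ⟩
  follow b (take i (path b s a ∷ʳ change a b))        ≡⟨ cong (follow b) (take-∷ʳ i (path b s a) (change a b) (≤-trans (<⇒≤ i<) (≤-reflexive (sym (length-path b s a))))) ⟩
  follow b (take i (path b s a))                      ≡⟨ follow-change a b _ ⟨
  follow a (change a b ∷ take i (path b s a))         ∎
  where open ≡-Reasoning

-- With the first sign fixed, the intermediate signs and their changes determine each other; the
-- changes are arbitrary except that their parity must lead from `a` to `z`.
∑-path : ∀ k a z (f : SignSeq → ℕ) →
         (∑[ s ∈ allSeqs k ] f (path a s z)) ≡ (∑[ d ∈ allSeqs (suc k) ] ⟦ follow a d ≟ₛ z ⟧ * f d)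
∑-path zero plus  plus  f = sym (+-identityʳ _)
∑-path zero plus  minus f = sym (+-identityʳ _)
∑-path zero minus plus  f = sym (+-identityʳ _)
∑-path zero minus minus f = sym (+-identityʳ _)
∑-path (suc k) a z f = begin
  (∑[ s ∈ allSeqs (suc k) ] f (path a s z))
    ≡⟨ ∑-allSeqs-suc k _ ⟩
  (∑[ s ∈ allSeqs k ] f (change a minus ∷ path minus s z)) + (∑[ s ∈ allSeqs k ] f (change a plus ∷ path plus s z))
    ≡⟨ cong₂ _+_ (∑-path k minus z (f ∘ (change a minus ∷_))) (∑-path k plus z (f ∘ (change a plus ∷_))) ⟩
  (∑[ d ∈ allSeqs (suc k) ] ⟦ follow minus d ≟ₛ z ⟧ * f (change a minus ∷ d)) +
  (∑[ d ∈ allSeqs (suc k) ] ⟦ follow plus d ≟ₛ z ⟧ * f (change a plus ∷ d))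
    ≡⟨ arrange a ⟩
  (∑[ d ∈ allSeqs (suc k) ] ⟦ follow a (minus ∷ d) ≟ₛ z ⟧ * f (minus ∷ d)) +
  (∑[ d ∈ allSeqs (suc k) ] ⟦ follow a (plus ∷ d) ≟ₛ z ⟧ * f (plus ∷ d))
    ≡⟨ ∑-allSeqs-suc (suc k) _ ⟨
  (∑[ d ∈ allSeqs (suc (suc k)) ] ⟦ follow a d ≟ₛ z ⟧ * f d) ∎
  where
  open ≡-Reasoning
  arrange : ∀ a →
    (∑[ d ∈ allSeqs (suc k) ] ⟦ follow minus d ≟ₛ z ⟧ * f (change a minus ∷ d)) +
    (∑[ d ∈ allSeqs (suc k) ] ⟦ follow plus d ≟ₛ z ⟧ * f (change a plus ∷ d)) ≡
    (∑[ d ∈ allSeqs (suc k) ] ⟦ follow a (minus ∷ d) ≟ₛ z ⟧ * f (minus ∷ d)) +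
    (∑[ d ∈ allSeqs (suc k) ] ⟦ follow a (plus ∷ d) ≟ₛ z ⟧ * f (plus ∷ d))
  arrange minus = refl
  arrange plus  = +-comm (∑[ d ∈ allSeqs (suc k) ] ⟦ follow minus d ≟ₛ z ⟧ * f (plus ∷ d)) _

-- A cyclic difference word has an even number of `plus`, and each such word comes from two words,
-- one for each first sign.
∑-changes : ∀ n → 0 < n → (f : SignSeq → ℕ) →
            (∑[ s ∈ allSeqs n ] f (changes s)) ≡ 2 * (∑[ d ∈ allSeqs n ] ⟦ follow minus d ≟ₛ minus ⟧ * f d)
∑-changes (suc k) _ f = begin
  (∑[ s ∈ allSeqs (suc k) ] f (changes s))
    ≡⟨ ∑-allSeqs-suc k _ ⟩
  (∑[ s ∈ allSeqs k ] f (path minus s minus)) + (∑[ s ∈ allSeqs k ] f (path plus s plus))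
    ≡⟨ cong₂ _+_ (∑-path k minus minus f) (∑-path k plus plus f) ⟩
  E + (∑[ d ∈ allSeqs (suc k) ] ⟦ follow plus d ≟ₛ plus ⟧ * f d)
    ≡⟨ cong (E +_) (∑-ext (allSeqs (suc k)) (λ d → cong (_* f d)
         (⟦⟧-cong (follow plus d ≟ₛ plus) (follow minus d ≟ₛ minus) (to d) (from d)))) ⟩
  E + E
    ≡⟨ cong (E +_) (+-identityʳ E) ⟨
  2 * E ∎
  where
  open ≡-Reasoning
  E = ∑[ d ∈ allSeqs (suc k) ] ⟦ follow minus d ≟ₛ minus ⟧ * f d
  to : ∀ d → follow plus d ≡ plus → follow minus d ≡ minus
  to d eq = trans (negate-neg (countPlus d) plus) (cong neg eq)
  from : ∀ d → follow minus d ≡ minus → follow plus d ≡ plus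
  from d eq = trans (negate-neg (countPlus d) minus) (cong neg eq)

-- When `d` is the difference word of `s`, these are the rotations negating `s`: the shift must be a
-- period of `d`, and the sign must change an odd number of times on the way.
antiperiods : ℕ → SignSeq → ℕ
antiperiods n d = ∑[ i ∈ upTo n ] ⟦ rotate^ i d ≟ʷ d ⟧ * ⟦ follow minus (take i d) ≟ₛ plus ⟧

hits-neg : ∀ {n} s → length s ≡ n → hits n (map neg s) s ≡ antiperiods n (changes s)
hits-neg {n} s refl = ∑-cong (upTo n) λ {i} i∈ → trans
  (⟦⟧-cong (rotate^ i (map neg s) ≟ʷ s) ((rotate^ i d ≟ʷ d) ×-dec (follow minus (take i d) ≟ₛ plus)) (to i (∈-upTo⁻ i∈)) (from i (∈-upTo⁻ i∈)))
  (⟦⟧-× (rotate^ i d ≟ʷ d) (follow minus (take i d) ≟ₛ plus))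
  where
  d = changes s
  first-neg : ∀ s → 0 < length s → first (map neg s) ≡ neg (first s)
  first-neg (a ∷ s) _ = refl
  follow-odd : ∀ a d → follow a d ≡ neg a → follow minus d ≡ plus
  follow-odd minus d eq = eq
  follow-odd plus  d eq = trans (negate-neg (countPlus d) plus) (cong neg eq)
  odd-follow : ∀ a d → follow minus d ≡ plus → follow a d ≡ neg a
  odd-follow minus d eq = eq
  odd-follow plus  d eq = trans (negate-neg (countPlus d) minus) (cong neg eq)
  to : ∀ i → i < n → rotate^ i (map neg s) ≡ s → rotate^ i d ≡ d × follow minus (take i d) ≡ plus
  to i i< eq = trans (sym (changes-rotate^ i s)) (trans (cong changes rot≡) (changes-neg s)) ,
    follow-odd (first s) (take i d) (trans (sym (first-rotate^ i s i<)) (trans (cong first rot≡) (first-neg s (≤-<-trans z≤n i<))))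
    where
    rot≡ : rotate^ i s ≡ map neg s
    rot≡ = trans (sym (map-neg-involutive _)) (cong (map neg) (trans (sym (rotate^-map-neg i s)) eq))
  from : ∀ i → i < n → rotate^ i d ≡ d × follow minus (take i d) ≡ plus → rotate^ i (map neg s) ≡ s
  from i i< (per , odd) = trans (rotate^-map-neg i s) (trans (cong (map neg) rot≡) (map-neg-involutive s))
    where
    rot≡ : rotate^ i s ≡ map neg s
    rot≡ = changes-injective _ _ (trans (length-rotate^ i s) (sym (length-map neg s)))
      (trans (first-rotate^ i s i<) (trans (odd-follow (first s) (take i d) odd) (sym (first-neg s (≤-<-trans z≤n i<)))))
      (trans (changes-rotate^ i s) (trans per (sym (changes-neg s))))

∑-hits-neg : ∀ n → 0 < n → (∑[ s ∈ allSeqs n ] hits n (map neg s) s) ≡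
             2 * (∑[ d ∈ allSeqs n ] ⟦ follow minus d ≟ₛ minus ⟧ * antiperiods n d)
∑-hits-neg n pos = trans (∑-cong (allSeqs n) (λ {s} s∈ → hits-neg s (∈-allSeqs⁻ n s∈))) (∑-changes n pos (antiperiods n))

take-power : ∀ {t l} w → t ≤ l → take (t * length w) (power l w) ≡ power t w
take-power w z≤n = refl
take-power {suc t} {suc l} w (s≤s t≤l) = trans (prefix w _ (power l w)) (cong (w ++_) (take-power w t≤l))
  where
  prefix : ∀ s k (t : SignSeq) → take (length s + k) (s ++ t) ≡ s ++ take k t
  prefix []      k t = refl
  prefix (a ∷ s) k t = cong (a ∷_) (prefix s k t)

countPlus-power : ∀ l w → countPlus (power l w) ≡ l * countPlus w
countPlus-power zero    w = refl
countPlus-power (suc l) w = trans (countPlus-++ w (power l w)) (cong (countPlus w +_) (countPlus-power l w))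

odds : ℕ → ℕ
odds l = ∑[ t ∈ upTo l ] ⟦ negate t minus ≟ₛ plus ⟧

-- This is l / 2 for even `l` and 0 for odd `l`: the number of odd multiplicities t below an even
-- exponent.
evenHalf : ℕ → ℕ
evenHalf l = ⟦ negate l minus ≟ₛ minus ⟧ * odds l

evenHalf-even : ∀ l → evenHalf (l * 2) ≡ l
evenHalf-even l = begin
  evenHalf (l * 2)
    ≡⟨ ⟦⟧-*-yes (negate (l * 2) minus ≟ₛ minus) (trans (cong (λ k → negate k minus) (sym (+-identityʳ (l * 2)))) (negate-*2 l 0 minus)) ⟩
  odds (l * 2)
    ≡⟨ ∑-upTo-* l 2 _ ⟩
  (∑[ t ∈ upTo l ] ∑[ j ∈ upTo 2 ] ⟦ negate (t * 2 + j) minus ≟ₛ plus ⟧)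
    ≡⟨ ∑-ext (upTo l) (λ t → ∑-ext (upTo 2) (λ j → cong (λ a → ⟦ a ≟ₛ plus ⟧) (negate-*2 t j minus))) ⟩
  (∑[ t ∈ upTo l ] 1)
    ≡⟨ ∑-const (upTo l) 1 ⟩
  length (upTo l) * 1
    ≡⟨ trans (*-identityʳ _) (length-upTo l) ⟩
  l ∎
  where open ≡-Reasoning

evenHalf-odd : ∀ l → evenHalf (l * 2 + 1) ≡ 0
evenHalf-odd l = cong (λ a → ⟦ a ≟ₛ minus ⟧ * odds (l * 2 + 1)) (negate-*2 l 1 minus)

-- The periods of a power of a primitive word are the multiples t of the root's length, and the
-- prefix passed over consists of t copies of the root.
antiperiods-power : ∀ l w → 0 < l → 0 < length w → Primitive w →
  antiperiods (l * length w) (power l w) ≡ (∑[ t ∈ upTo l ] ⟦ negate (t * countPlus w) minus ≟ₛ plus ⟧)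
antiperiods-power l w 0<l 0<w prim = trans
  (∑-multiples l (length w) _ (λ i ∤i → ⟦⟧-*-no (rotate^ i (power l w) ≟ʷ power l w) (λ eq → ∤i (primitive∣ w 0<w prim i
    (power-injective l 0<l (length-rotate^ i w) (trans (sym (rotate^-power i l w)) eq))))))
  (∑-cong (upTo l) λ {t} t∈ → trans
    (⟦⟧-*-yes (rotate^ (t * length w) (power l w) ≟ʷ power l w)
      (trans (rotate^-power (t * length w) l w) (cong (power l) (rotate^-multiple t (length w) w (rotate^-length w)))))
    (cong (λ k → ⟦ negate k minus ≟ₛ plus ⟧)
      (trans (cong countPlus (take-power w (<⇒≤ (∈-upTo⁻ t∈)))) (countPlus-power t w))))
  where instance _ = >-nonZero 0<w

odd? : ∀ w → Dec (follow minus w ≡ plus)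
odd? w = follow minus w ≟ₛ plus

-- If the root has evenly many `plus`, no prefix of whole copies has odd parity. Otherwise t copies
-- have the parity of t and the whole word has the parity of l.
even-antiperiods-power : ∀ l w → 0 < l → 0 < length w → Primitive w →
  ⟦ follow minus (power l w) ≟ₛ minus ⟧ * antiperiods (l * length w) (power l w) ≡ ⟦ odd? w ⟧ * evenHalf l
even-antiperiods-power l w 0<l 0<w prim
  rewrite antiperiods-power l w 0<l 0<w prim | countPlus-power l w = go (follow minus w) refl
  where
  j = countPlus w
  go : ∀ a → follow minus w ≡ a →
       ⟦ negate (l * j) minus ≟ₛ minus ⟧ * (∑[ t ∈ upTo l ] ⟦ negate (t * j) minus ≟ₛ plus ⟧) ≡ ⟦ odd? w ⟧ * evenHalf l
  go plus odd = trans
    (cong₂ _*_ (cong (λ a → ⟦ a ≟ₛ minus ⟧) (negate-odd-* l j odd))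
               (∑-ext (upTo l) (λ t → cong (λ a → ⟦ a ≟ₛ plus ⟧) (negate-odd-* t j odd))))
    (sym (⟦⟧-*-yes (odd? w) odd))
  go minus even = trans
    (trans (cong (⟦ negate (l * j) minus ≟ₛ minus ⟧ *_)
              (∑-zero (upTo l) (λ {t} _ → cong (λ a → ⟦ a ≟ₛ plus ⟧) (negate-even-* t j even))))
           (*-zeroʳ ⟦ negate (l * j) minus ≟ₛ minus ⟧))
    (sym (cong (λ a → ⟦ a ≟ₛ plus ⟧ * evenHalf l) even))

∑-factorisations-cong : ∀ n {h k : ℕ → ℕ → ℕ} → (∀ p l → l * p ≡ n → h p l ≡ k p l) →
                        ∑-factorisations n h ≡ ∑-factorisations n k
∑-factorisations-cong n eq = ∑-ext (upTo (suc n)) λ p → ∑-ext (upTo (suc n)) λ l → ⟦⟧-*-cong (l * p ≟ n) (eq p l)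

∑-factorisations-*ˡ : ∀ n c (h : ℕ → ℕ → ℕ) → ∑-factorisations n (λ p l → c * h p l) ≡ c * ∑-factorisations n h
∑-factorisations-*ˡ n c h = trans
  (∑-ext (upTo (suc n)) λ p → trans (∑-ext (upTo (suc n)) λ l → *-left-comm ⟦ l * p ≟ n ⟧ c (h p l))
                                    (∑-*ˡ (upTo (suc n)) c (λ l → ⟦ l * p ≟ n ⟧ * h p l)))
  (∑-*ˡ (upTo (suc n)) c (λ p → ∑[ l ∈ upTo (suc n) ] ⟦ l * p ≟ n ⟧ * h p l))

-- Only even exponents survive, and l = 2t turns a factorisation of 2m into the factorisation t p =
-- m; root lengths beyond m then drop out.
∑-factorisations-evenHalf : ∀ m → 0 < m → (q : ℕ → ℕ) →
  ∑-factorisations (m + m) (λ p l → q p * evenHalf l) ≡ ∑-factorisations m (λ p l → q p * l)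
∑-factorisations-evenHalf m pos q = trans (∑-ext (upTo (suc (m + m))) inner)
  (∑-upTo-extend _ (s≤s (m≤m+n m m)) λ p m<p → ∑-zero (upTo (suc m)) λ {l} _ →
    ⟦⟧-*-no (l * p ≟ m) (λ eq → <⇒≱ m<p (bound l p eq)))
  where
  open ≡-Reasoning
  bound : ∀ l p → l * p ≡ m → p ≤ m
  bound l p eq = ≤-trans (m≤n*m p l) (≤-reflexive eq)
    where instance _ = >-nonZero (proj₁ (*-pos {l} {p} (subst (0 <_) (sym eq) pos)))
  double : ∀ t p → t * 2 * p ≡ t * p + t * p
  double = solve-∀
  inner : ∀ p → (∑[ l ∈ upTo (suc (m + m)) ] ⟦ l * p ≟ m + m ⟧ * (q p * evenHalf l)) ≡
                (∑[ l ∈ upTo (suc m) ] ⟦ l * p ≟ m ⟧ * (q p * l))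
  inner p = begin
    ∑ (upTo (suc (m + m))) f                                     ≡⟨ +-identityʳ _ ⟨
    -- The added term has the odd index 2m + 1 and vanishes; it completes the range so that it
    -- splits into pairs of an even and an odd index.
    ∑ (upTo (suc (m + m))) f + 0                                 ≡⟨ cong (∑ (upTo (suc (m + m))) f +_) (trans (cong f (last-odd m)) (f-odd m)) ⟨
    ∑ (upTo (suc (m + m))) f + f (suc (m + m))                   ≡⟨ ∑-upTo-last (suc (m + m)) f ⟨
    ∑ (upTo (suc (suc (m + m)))) f                               ≡⟨ cong (λ k → ∑ (upTo k) f) (length≡ m) ⟩
    ∑ (upTo (suc m * 2)) f                                       ≡⟨ ∑-upTo-* (suc m) 2 f ⟩
    (∑[ t ∈ upTo (suc m) ] (f (t * 2 + 0) + (f (t * 2 + 1) + 0))) ≡⟨ ∑-ext (upTo (suc m)) (λ t → trans (cong₂ (λ a b → a + (b + 0)) (f-even t) (f-odd t)) (+-identityʳ _)) ⟩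
    (∑[ t ∈ upTo (suc m) ] ⟦ t * p ≟ m ⟧ * (q p * t))            ∎
    where
    f : ℕ → ℕ
    f l = ⟦ l * p ≟ m + m ⟧ * (q p * evenHalf l)
    last-odd : ∀ m → suc (m + m) ≡ m * 2 + 1
    last-odd = solve-∀
    length≡ : ∀ m → suc (suc (m + m)) ≡ suc m * 2
    length≡ = solve-∀
    f-odd : ∀ t → f (t * 2 + 1) ≡ 0
    f-odd t = trans (cong (λ e → ⟦ (t * 2 + 1) * p ≟ m + m ⟧ * (q p * e)) (evenHalf-odd t))
      (trans (cong (⟦ (t * 2 + 1) * p ≟ m + m ⟧ *_) (*-zeroʳ (q p))) (*-zeroʳ ⟦ (t * 2 + 1) * p ≟ m + m ⟧))
    f-even : ∀ t → f (t * 2 + 0) ≡ ⟦ t * p ≟ m ⟧ * (q p * t)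
    f-even t = trans (cong f (+-identityʳ (t * 2))) (cong₂ (λ i e → i * (q p * e))
      (⟦⟧-cong (t * 2 * p ≟ m + m) (t * p ≟ m)
        (λ eq → n+n-injective {t * p} {m} (trans (sym (double t p)) eq))
        (λ eq → trans (double t p) (cong₂ _+_ eq eq)))
      (evenHalf-even t))

oddLyndon : ℕ → ℕ
oddLyndon p = ∑[ v ∈ allSeqs p ] ⟦ lyndon? v ⟧ * ⟦ odd? v ⟧

countPlus-rotate^ : ∀ i s → countPlus (rotate^ i s) ≡ countPlus s
countPlus-rotate^ zero    s = refl
countPlus-rotate^ (suc i) s = trans (countPlus-rotate^ i (rotate s)) (countPlus-rotate s)

∑-primitive-odd : ∀ p → 0 < p → (∑[ w ∈ allSeqs p ] ⟦ primitive? w ⟧ * ⟦ odd? w ⟧) ≡ p * oddLyndon p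
∑-primitive-odd p pos = begin
  (∑[ w ∈ allSeqs p ] ⟦ primitive? w ⟧ * ⟦ odd? w ⟧)
    ≡⟨ ∑-primitive p pos (λ w → ⟦ odd? w ⟧) ⟩
  (∑[ v ∈ allSeqs p ] ⟦ lyndon? v ⟧ * (∑[ i ∈ upTo p ] ⟦ odd? (rotate^ i v) ⟧))
    ≡⟨ ∑-ext (allSeqs p) (λ v → trans (cong (⟦ lyndon? v ⟧ *_) (constant v)) (*-left-comm ⟦ lyndon? v ⟧ p ⟦ odd? v ⟧)) ⟩
  (∑[ v ∈ allSeqs p ] p * (⟦ lyndon? v ⟧ * ⟦ odd? v ⟧))
    ≡⟨ ∑-*ˡ (allSeqs p) p _ ⟩
  p * oddLyndon p ∎
  where
  open ≡-Reasoning
  constant : ∀ v → (∑[ i ∈ upTo p ] ⟦ odd? (rotate^ i v) ⟧) ≡ p * ⟦ odd? v ⟧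
  constant v = trans (∑-ext (upTo p) (λ i → cong (λ k → ⟦ negate k minus ≟ₛ plus ⟧) (countPlus-rotate^ i v)))
    (trans (∑-const (upTo p) ⟦ odd? v ⟧) (cong (_* ⟦ odd? v ⟧) (length-upTo p)))

-- The factor 2 counts the words with a given difference word. The factor m is the p rotations of a
-- Lyndon root of length p times the m / p odd multiplicities below its exponent.
∑-rotations : ∀ m → 0 < m → (∑[ s ∈ allSeqs (m + m) ] hits (m + m) (map neg s) s) ≡
              2 * (m * ∑-factorisations m (λ p l → oddLyndon p))
∑-rotations m pos = begin
  (∑[ s ∈ allSeqs n ] hits n (map neg s) s)
    ≡⟨ ∑-hits-neg n posn ⟩
  2 * (∑[ d ∈ allSeqs n ] h d)
    ≡⟨ cong (2 *_) (∑-primitive-roots n posn h) ⟩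
  2 * ∑-factorisations n (λ p l → ∑[ w ∈ allSeqs p ] ⟦ primitive? w ⟧ * h (power l w))
    ≡⟨ cong (2 *_) (∑-factorisations-cong n evaluate) ⟩
  2 * ∑-factorisations n (λ p l → q p * evenHalf l)
    ≡⟨ cong (2 *_) (∑-factorisations-evenHalf m pos q) ⟩
  2 * ∑-factorisations m (λ p l → q p * l)
    ≡⟨ cong (2 *_) (∑-factorisations-cong m (λ p l eq → trans
         (cong (_* l) (∑-primitive-odd p (proj₂ (*-pos {l} {p} (subst (0 <_) (sym eq) pos)))))
         (trans (rearrange p (oddLyndon p) l) (cong (_* oddLyndon p) eq)))) ⟩
  2 * ∑-factorisations m (λ p l → m * oddLyndon p)
    ≡⟨ cong (2 *_) (∑-factorisations-*ˡ m m (λ p l → oddLyndon p)) ⟩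
  2 * (m * ∑-factorisations m (λ p l → oddLyndon p)) ∎
  where
  open ≡-Reasoning
  n = m + m
  posn : 0 < n
  posn = ≤-trans pos (m≤m+n m m)
  h : SignSeq → ℕ
  h d = ⟦ follow minus d ≟ₛ minus ⟧ * antiperiods n d
  q : ℕ → ℕ
  q p = ∑[ w ∈ allSeqs p ] ⟦ primitive? w ⟧ * ⟦ odd? w ⟧
  rearrange : ∀ p o l → p * o * l ≡ l * p * o
  rearrange = solve-∀
  evaluate : ∀ p l → l * p ≡ n → (∑[ w ∈ allSeqs p ] ⟦ primitive? w ⟧ * h (power l w)) ≡ q p * evenHalf l
  evaluate p l eq = trans (∑-cong (allSeqs p) term) (∑-*ʳ (allSeqs p) (evenHalf l) (λ w → ⟦ primitive? w ⟧ * ⟦ odd? w ⟧))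
    where
    0<l = proj₁ (*-pos {l} {p} (subst (0 <_) (sym eq) posn))
    0<p = proj₂ (*-pos {l} {p} (subst (0 <_) (sym eq) posn))
    term : ∀ {w} → w ∈ allSeqs p → ⟦ primitive? w ⟧ * h (power l w) ≡ ⟦ primitive? w ⟧ * ⟦ odd? w ⟧ * evenHalf l
    term {w} w∈ = trans (⟦⟧-*-cong (primitive? w) (λ prim → trans
        (cong (λ k → ⟦ follow minus (power l w) ≟ₛ minus ⟧ * antiperiods k (power l w)) (trans (sym eq) (cong (l *_) (sym len))))
        (even-antiperiods-power l w 0<l (subst (0 <_) (sym len) 0<p) prim)))
      (sym (*-assoc ⟦ primitive? w ⟧ ⟦ odd? w ⟧ (evenHalf l)))
      where len = ∈-allSeqs⁻ p w∈

-- The function F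

-- Rotation brings each letter of `s` to the front once. The suffix `t` is there for the induction,
-- because letters already inspected move behind it.
∑-first : ∀ s t → (∑[ i ∈ upTo (length s) ] ⟦ first (rotate^ i (s ++ t)) ≟ₛ plus ⟧) ≡ countPlus s
∑-first []      t = refl
∑-first (a ∷ s) t = trans (∑-upTo-suc (length s) _) (trans (cong (⟦ a ≟ₛ plus ⟧ +_)
  (trans (∑-ext (upTo (length s)) (λ i → cong (λ u → ⟦ first (rotate^ i u) ≟ₛ plus ⟧) (++-assoc s t (a ∷ []))))
         (∑-first s (t ∷ʳ a)))) (add a))
  where
  add : ∀ a → ⟦ a ≟ₛ plus ⟧ + countPlus s ≡ countPlus (a ∷ s)
  add plus  = refl
  add minus = refl

-- Both sides are twice the number of words of length m that start with `plus`. A word starts like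
-- its primitive root, and a Lyndon word has as many rotations starting with `plus` as it has `plus`
-- entries.
∑-lyndon-countPlus : ∀ m → 0 < m →
  2 * ∑-factorisations m (λ p l → ∑[ v ∈ allSeqs p ] ⟦ lyndon? v ⟧ * countPlus v) ≡ 2 ^ m
∑-lyndon-countPlus (suc k) pos = cong (2 *_) (begin
  ∑-factorisations m (λ p l → ∑[ v ∈ allSeqs p ] ⟦ lyndon? v ⟧ * countPlus v)
    ≡⟨ ∑-factorisations-cong m (λ p l eq → sym (evaluate p l eq)) ⟩
  ∑-factorisations m (λ p l → ∑[ w ∈ allSeqs p ] ⟦ primitive? w ⟧ * f (power l w))
    ≡⟨ ∑-primitive-roots m pos f ⟨
  ∑ (allSeqs m) f
    ≡⟨ ∑-allSeqs-suc k f ⟩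
  (∑[ s ∈ allSeqs k ] 0) + (∑[ s ∈ allSeqs k ] 1)
    ≡⟨ cong₂ _+_ (∑-zero (allSeqs k) (λ _ → refl)) (trans (∑-const (allSeqs k) 1) (*-identityʳ _)) ⟩
  length (allSeqs k)
    ≡⟨ length-allSeqs k ⟩
  2 ^ k ∎)
  where
  open ≡-Reasoning
  m = suc k
  f : SignSeq → ℕ
  f u = ⟦ first u ≟ₛ plus ⟧
  first-power : ∀ l w → 0 < l → 0 < length w → first (power l w) ≡ first w
  first-power (suc l) (a ∷ w) _ _ = refl
  evaluate : ∀ p l → l * p ≡ m → (∑[ w ∈ allSeqs p ] ⟦ primitive? w ⟧ * f (power l w)) ≡
                                 (∑[ v ∈ allSeqs p ] ⟦ lyndon? v ⟧ * countPlus v)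
  evaluate p l eq = begin
    (∑[ w ∈ allSeqs p ] ⟦ primitive? w ⟧ * f (power l w))
      ≡⟨ ∑-cong (allSeqs p) (λ {w} w∈ → cong (λ a → ⟦ primitive? w ⟧ * ⟦ a ≟ₛ plus ⟧)
           (first-power l w 0<l (subst (0 <_) (sym (∈-allSeqs⁻ p w∈)) 0<p))) ⟩
    (∑[ w ∈ allSeqs p ] ⟦ primitive? w ⟧ * f w)
      ≡⟨ ∑-primitive p 0<p f ⟩
    (∑[ v ∈ allSeqs p ] ⟦ lyndon? v ⟧ * (∑[ i ∈ upTo p ] f (rotate^ i v)))
      ≡⟨ ∑-cong (allSeqs p) (λ {v} v∈ → cong (⟦ lyndon? v ⟧ *_) (count v (∈-allSeqs⁻ p v∈))) ⟩
    (∑[ v ∈ allSeqs p ] ⟦ lyndon? v ⟧ * countPlus v) ∎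
    where
    0<l = proj₁ (*-pos {l} {p} (subst (0 <_) (sym eq) pos))
    0<p = proj₂ (*-pos {l} {p} (subst (0 <_) (sym eq) pos))
    count : ∀ v → length v ≡ p → (∑[ i ∈ upTo p ] f (rotate^ i v)) ≡ countPlus v
    count v refl = trans (∑-ext (upTo (length v)) (λ i → cong (f ∘ rotate^ i) (sym (++-identityʳ v)))) (∑-first v [])

halfLyndon : ℕ → ℕ
halfLyndon p = ∑[ v ∈ allSeqs p ] ⟦ lyndon? v ⟧ * ⌈ countPlus v /2⌉

2*⌈/2⌉ : ∀ j → 2 * ⌈ j /2⌉ ≡ j + ⟦ negate j minus ≟ₛ plus ⟧
2*⌈/2⌉ zero          = refl
2*⌈/2⌉ (suc zero)    = refl
2*⌈/2⌉ (suc (suc j)) = trans (step⁺ ⌈ j /2⌉) (cong (2 +_) (2*⌈/2⌉ j))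
  where
  step⁺ : ∀ a → 2 * suc a ≡ 2 + 2 * a
  step⁺ = solve-∀

∑-factorisations-+ : ∀ n (h k : ℕ → ℕ → ℕ) →
  ∑-factorisations n (λ p l → h p l + k p l) ≡ ∑-factorisations n h + ∑-factorisations n k
∑-factorisations-+ n h k = trans
  (∑-ext N (λ p → trans (∑-ext N (λ l → *-distribˡ-+ ⟦ l * p ≟ n ⟧ (h p l) (k p l)))
                        (∑-+ N (λ l → ⟦ l * p ≟ n ⟧ * h p l) (λ l → ⟦ l * p ≟ n ⟧ * k p l))))
  (∑-+ N (λ p → ∑[ l ∈ N ] ⟦ l * p ≟ n ⟧ * h p l) (λ p → ∑[ l ∈ N ] ⟦ l * p ≟ n ⟧ * k p l))
  where N = upTo (suc n)

2*∑-halfLyndon : ∀ m → 2 * ∑-factorisations m (λ p l → halfLyndon p) ≡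
  ∑-factorisations m (λ p l → ∑[ v ∈ allSeqs p ] ⟦ lyndon? v ⟧ * countPlus v) + ∑-factorisations m (λ p l → oddLyndon p)
2*∑-halfLyndon m = trans (sym (∑-factorisations-*ˡ m 2 (λ p l → halfLyndon p)))
  (trans (∑-factorisations-cong m (λ p l _ → split p)) (∑-factorisations-+ m _ (λ p l → oddLyndon p)))
  where
  split : ∀ p → 2 * halfLyndon p ≡ (∑[ v ∈ allSeqs p ] ⟦ lyndon? v ⟧ * countPlus v) + oddLyndon p
  split p = trans (sym (∑-*ˡ (allSeqs p) 2 (λ v → ⟦ lyndon? v ⟧ * ⌈ countPlus v /2⌉)))
    (trans (∑-ext (allSeqs p) (λ v → trans (*-left-comm 2 ⟦ lyndon? v ⟧ ⌈ countPlus v /2⌉)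
             (trans (cong (⟦ lyndon? v ⟧ *_) (2*⌈/2⌉ (countPlus v))) (*-distribˡ-+ ⟦ lyndon? v ⟧ (countPlus v) ⟦ odd? v ⟧))))
           (∑-+ (allSeqs p) (λ v → ⟦ lyndon? v ⟧ * countPlus v) (λ v → ⟦ lyndon? v ⟧ * ⟦ odd? v ⟧)))

[m+m]/2 : ∀ m → (m + m) / 2 ≡ m
[m+m]/2 m = trans (cong (_/ 2) (n+n≡n*2 m)) (m*n/n≡m m 2)

[r+q*n]/n : ∀ q {n r} .{{_ : NonZero n}} → r < n → (r + q * n) / n ≡ q
[r+q*n]/n q {n} {r} r<n = trans (+-distrib-/-∣ʳ r (n∣m*n q)) (cong₂ _+_ (m<n⇒m/n≡0 r<n) (m*n/n≡m q n))

ceilDiv-* : ∀ t i → ceilDiv (t * suc i) (2 * suc i) ≡ ⌈ t /2⌉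
ceilDiv-* t i = trans (/-congˡ {o = 2 * suc i} (eq t)) ([r+q*n]/n ⌈ t /2⌉ (r< t))
  where
  -- With l = `suc i`, the remainder of t l + 2l - 1 modulo 2l: it is 2l - 1 for even t and l - 1
  -- for odd t.
  r : ℕ → ℕ
  r zero          = i + suc (i + 0)
  r (suc zero)    = i
  r (suc (suc t)) = r t
  r< : ∀ t → r t < 2 * suc i
  r< zero          = ≤-refl
  r< (suc zero)    = s≤s (m≤m+n i _)
  r< (suc (suc t)) = r< t
  eq₁ : ∀ i → 1 * suc i + (i + suc (i + 0)) ≡ i + 1 * (2 * suc i)
  eq₁ = solve-∀
  eq₂ : ∀ t i → suc (suc t) * suc i + (i + suc (i + 0)) ≡ 2 * suc i + (t * suc i + (i + suc (i + 0)))
  eq₂ = solve-∀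
  eq₃ : ∀ a b c → c + (a + b * c) ≡ a + suc b * c
  eq₃ = solve-∀
  eq : ∀ t → t * suc i + (2 * suc i ∸ 1) ≡ r t + ⌈ t /2⌉ * (2 * suc i)
  eq zero          = sym (+-identityʳ _)
  eq (suc zero)    = eq₁ i
  eq (suc (suc t)) = trans (eq₂ t i) (trans (cong (2 * suc i +_) (eq t)) (eq₃ (r t) ⌈ t /2⌉ (2 * suc i)))

∑-L : ∀ p → (∑[ t ∈ upTo (suc p) ] L p t * ⌈ t /2⌉) ≡ halfLyndon p
∑-L p = begin
  (∑[ t ∈ upTo (suc p) ] L p t * ⌈ t /2⌉)
    ≡⟨ ∑-ext (upTo (suc p)) (λ t → trans (cong (_* ⌈ t /2⌉) (trans (length-filter-∑ _ (allSeqs p)) (∑-ext (allSeqs p) (term t))))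
                                         (sym (∑-*ʳ (allSeqs p) ⌈ t /2⌉ (λ v → ⟦ countPlus v ≟ t ⟧ * ⟦ lyndon? v ⟧)))) ⟩
  (∑[ t ∈ upTo (suc p) ] ∑[ v ∈ allSeqs p ] ⟦ countPlus v ≟ t ⟧ * ⟦ lyndon? v ⟧ * ⌈ t /2⌉)
    ≡⟨ ∑-comm (upTo (suc p)) (allSeqs p) _ ⟩
  (∑[ v ∈ allSeqs p ] ∑[ t ∈ upTo (suc p) ] ⟦ countPlus v ≟ t ⟧ * ⟦ lyndon? v ⟧ * ⌈ t /2⌉)
    ≡⟨ ∑-cong (allSeqs p) (λ {v} v∈ → trans
         (∑-single _ (Unique.upTo⁺ (suc p)) (∈-upTo⁺ (s≤s (≤-trans (countPlus≤length v) (≤-reflexive (∈-allSeqs⁻ p v∈)))))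
           (λ {t} _ t≢ → cong (λ k → k * ⟦ lyndon? v ⟧ * ⌈ t /2⌉) (⟦⟧-no (countPlus v ≟ t) (t≢ ∘ sym))))
         (cong (_* ⌈ countPlus v /2⌉) (⟦⟧-*-yes (countPlus v ≟ countPlus v) refl))) ⟩
  halfLyndon p ∎
  where
  open ≡-Reasoning
  term : ∀ t v → ⟦ T? ((countPlus v ≡ᵇ t) ∧ isLyndon v) ⟧ ≡ ⟦ countPlus v ≟ t ⟧ * ⟦ lyndon? v ⟧
  term t v = trans (⟦⟧-cong (T? ((countPlus v ≡ᵇ t) ∧ isLyndon v)) (T? (countPlus v ≡ᵇ t) ×-dec T? (isLyndon v))
                      (Equivalence.to T-∧) (Equivalence.from T-∧))
                   (⟦⟧-× (T? (countPlus v ≡ᵇ t)) (T? (isLyndon v)))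

F-term : ℕ → ℕ → ℕ → ℕ
F-term m i k = L ((m + m) / (2 * suc i)) (k / suc i) * ceilDiv k (2 * suc i)

F-unfold : ∀ m → F (m + m) ≡
  (∑[ k ∈ upTo m ] ∑[ i ∈ filter (λ i → suc i ∣? gcd m (suc k)) (upTo (gcd m (suc k))) ] F-term m i (suc k))
F-unfold m = cong
  (λ h → ∑[ k ∈ upTo h ] ∑[ i ∈ filter (λ i → suc i ∣? gcd h (suc k)) (upTo (gcd h (suc k))) ] F-term m i (suc k))
  ([m+m]/2 m)

∑-F-term : ∀ p i → (∑[ k ∈ upTo (p * suc i) ] ⟦ suc i ∣? suc k ⟧ * F-term (p * suc i) i (suc k)) ≡ halfLyndon p
∑-F-term p i = begin
  ∑ (upTo m) (φ ∘ suc)                     ≡⟨⟩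
  -- The sum in `F` starts at k = 1. The term k = 0 may be added because ⌈ 0 /2⌉ is 0, and it
  -- completes the progression of multiples of l.
  0 + ∑ (upTo m) (φ ∘ suc)                 ≡⟨ cong (_+ ∑ (upTo m) (φ ∘ suc)) φ0 ⟨
  φ 0 + ∑ (upTo m) (φ ∘ suc)               ≡⟨ ∑-upTo-suc m φ ⟨
  ∑ (upTo (suc m)) φ                       ≡⟨ ∑-upTo-last m φ ⟩
  ∑ (upTo m) φ + φ m                       ≡⟨ cong (_+ φ m) (∑-multiples p l φ (λ k ∤k → ⟦⟧-*-no (l ∣? k) ∤k)) ⟩
  (∑[ t ∈ upTo p ] φ (t * l)) + φ (p * l)  ≡⟨ ∑-upTo-last p (λ t → φ (t * l)) ⟨
  (∑[ t ∈ upTo (suc p) ] φ (t * l))        ≡⟨ ∑-ext (upTo (suc p)) φ* ⟩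
  (∑[ t ∈ upTo (suc p) ] L p t * ⌈ t /2⌉)  ≡⟨ ∑-L p ⟩
  halfLyndon p                             ∎
  where
  open ≡-Reasoning
  l = suc i
  m = p * l
  φ : ℕ → ℕ
  φ k = ⟦ l ∣? k ⟧ * F-term m i k
  double : ∀ p l → p * l + p * l ≡ p * (2 * l)
  double = solve-∀
  φ* : ∀ t → φ (t * l) ≡ L p t * ⌈ t /2⌉
  φ* t = trans (⟦⟧-*-yes (l ∣? (t * l)) (n∣m*n t)) (cong₂ _*_
    (cong₂ L (trans (/-congˡ {o = 2 * l} (double p l)) (m*n/n≡m p (2 * l))) (m*n/n≡m t l))
    (ceilDiv-* t i))
  φ0 : φ 0 ≡ 0
  φ0 = trans (φ* 0) (*-zeroʳ (L p 0))

-- Dividing the gcd means dividing both m and k. After swapping the sums, each divisor l of m leaves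
-- the k = t l, which run through all counts of `plus` in Lyndon words of length m / l.
F≡ : ∀ m → 0 < m → F (m + m) ≡ ∑-factorisations m (λ p l → halfLyndon p)
F≡ m pos = begin
  F (m + m)
    ≡⟨ F-unfold m ⟩
  (∑[ k ∈ M ] ∑[ i ∈ filter (λ i → suc i ∣? gcd m (suc k)) (upTo (gcd m (suc k))) ] F-term m i (suc k))
    ≡⟨ ∑-ext M divisors ⟩
  (∑[ k ∈ M ] ∑[ i ∈ M ] ⟦ suc i ∣? m ⟧ * (⟦ suc i ∣? suc k ⟧ * F-term m i (suc k)))
    ≡⟨ ∑-comm M M _ ⟩
  (∑[ i ∈ M ] ∑[ k ∈ M ] ⟦ suc i ∣? m ⟧ * (⟦ suc i ∣? suc k ⟧ * F-term m i (suc k)))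
    ≡⟨ ∑-ext M (λ i → trans (∑-*ˡ M ⟦ suc i ∣? m ⟧ (λ k → ⟦ suc i ∣? suc k ⟧ * F-term m i (suc k))) (codivisor i)) ⟩
  (∑[ i ∈ M ] ∑[ p ∈ upTo (suc m) ] ⟦ suc i * p ≟ m ⟧ * halfLyndon p)
    ≡⟨ cong (_+ (∑[ i ∈ M ] ∑[ p ∈ upTo (suc m) ] ⟦ suc i * p ≟ m ⟧ * halfLyndon p))
         (∑-zero (upTo (suc m)) (λ {p} _ → ⟦⟧-*-no (0 ≟ m) (<⇒≢ pos))) ⟨
  (∑[ p ∈ upTo (suc m) ] ⟦ 0 ≟ m ⟧ * halfLyndon p) + (∑[ i ∈ M ] ∑[ p ∈ upTo (suc m) ] ⟦ suc i * p ≟ m ⟧ * halfLyndon p)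
    ≡⟨ ∑-upTo-suc m (λ l → ∑[ p ∈ upTo (suc m) ] ⟦ l * p ≟ m ⟧ * halfLyndon p) ⟨
  (∑[ l ∈ upTo (suc m) ] ∑[ p ∈ upTo (suc m) ] ⟦ l * p ≟ m ⟧ * halfLyndon p)
    ≡⟨ ∑-comm (upTo (suc m)) (upTo (suc m)) _ ⟩
  ∑-factorisations m (λ p l → halfLyndon p) ∎
  where
  open ≡-Reasoning
  instance _ = >-nonZero pos
  M = upTo m
  divisors : ∀ k → (∑[ i ∈ filter (λ i → suc i ∣? gcd m (suc k)) (upTo (gcd m (suc k))) ] F-term m i (suc k)) ≡
                   (∑[ i ∈ M ] ⟦ suc i ∣? m ⟧ * (⟦ suc i ∣? suc k ⟧ * F-term m i (suc k)))
  divisors k = begin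
    (∑[ i ∈ filter (λ i → suc i ∣? g) (upTo g) ] F-term m i (suc k))
      ≡⟨ ∑-filter (λ i → suc i ∣? g) (upTo g) _ ⟩
    (∑[ i ∈ upTo g ] ⟦ suc i ∣? g ⟧ * F-term m i (suc k))
      ≡⟨ ∑-upTo-extend _ (∣⇒≤ (gcd[m,n]∣m m (suc k))) (λ i g≤i → ⟦⟧-*-no (suc i ∣? g) (λ ∣g → <⇒≱ (s≤s g≤i) (∣⇒≤ {{g≢0}} ∣g))) ⟨
    (∑[ i ∈ M ] ⟦ suc i ∣? g ⟧ * F-term m i (suc k))
      ≡⟨ ∑-ext M (λ i → trans (cong (_* F-term m i (suc k)) (trans
           (⟦⟧-cong (suc i ∣? g) ((suc i ∣? m) ×-dec (suc i ∣? suc k))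
             (λ ∣g → ∣-trans ∣g (gcd[m,n]∣m m (suc k)) , ∣-trans ∣g (gcd[m,n]∣n m (suc k)))
             (λ (∣m , ∣k) → gcd-greatest ∣m ∣k))
           (⟦⟧-× (suc i ∣? m) (suc i ∣? suc k))))
         (*-assoc ⟦ suc i ∣? m ⟧ ⟦ suc i ∣? suc k ⟧ _)) ⟩
    (∑[ i ∈ M ] ⟦ suc i ∣? m ⟧ * (⟦ suc i ∣? suc k ⟧ * F-term m i (suc k))) ∎
    where
    g = gcd m (suc k)
    g≢0 : NonZero g
    g≢0 = ≢-nonZero (λ g≡0 → contradiction (0∣⇒≡0 (subst (_∣ suc k) g≡0 (gcd[m,n]∣n m (suc k)))) λ ())
  codivisor : ∀ i → ⟦ suc i ∣? m ⟧ * (∑[ k ∈ M ] ⟦ suc i ∣? suc k ⟧ * F-term m i (suc k)) ≡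
                    (∑[ p ∈ upTo (suc m) ] ⟦ suc i * p ≟ m ⟧ * halfLyndon p)
  codivisor i = go (suc i ∣? m)
    where
    go : Dec (suc i ∣ m) → ⟦ suc i ∣? m ⟧ * (∑[ k ∈ M ] ⟦ suc i ∣? suc k ⟧ * F-term m i (suc k)) ≡
                           (∑[ p ∈ upTo (suc m) ] ⟦ suc i * p ≟ m ⟧ * halfLyndon p)
    go (no ∤m) = trans (⟦⟧-*-no (suc i ∣? m) ∤m) (sym (∑-zero (upTo (suc m)) λ {p} _ →
      ⟦⟧-*-no (suc i * p ≟ m) (λ eq → ∤m (divides p (trans (sym eq) (*-comm (suc i) p))))))
    go (yes ∣m@(divides q eq)) = trans (⟦⟧-*-yes (suc i ∣? m) ∣m) (trans
      (subst (λ m → (∑[ k ∈ upTo m ] ⟦ suc i ∣? suc k ⟧ * F-term m i (suc k)) ≡ halfLyndon q) (sym eq) (∑-F-term q i))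
      (sym (trans
        (∑-single _ (Unique.upTo⁺ (suc m)) (∈-upTo⁺ (s≤s (≤-trans (m≤m*n q (suc i)) (≤-reflexive (sym eq)))))
          (λ {p} _ p≢ → ⟦⟧-*-no (suc i * p ≟ m) (λ eq′ → p≢ (*-cancelˡ-≡ p q (suc i) (trans eq′ (trans eq (*-comm q (suc i))))))))
        (⟦⟧-*-yes (suc i * q ≟ m) (trans (*-comm (suc i) q) (sym eq))))))

-- With S the left side, Burnside's count reads 4m S = 2m O + m 2^m. Since 2^m = 2C and C + O = 2 F,
-- this is 4m F.
∑-self-complementary : ∀ m → 0 < m → (∑[ r ∈ allSeqs (m + m) ] ⟦ least? r ⟧ * ⟦ map neg r ∼? r ⟧) ≡ F (m + m)
∑-self-complementary m pos = *-cancelʳ-≡ S (F n) (n + n) (begin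
  S * (n + n)
    ≡⟨ burnside-neg n posn ⟨
  (∑[ s ∈ allSeqs n ] meets (map neg s) s)
    ≡⟨ ∑-cong (allSeqs n) (λ {s} s∈ → cong (λ k → hits k (map neg s) s + hits k (reverse (map neg s)) s)
         (trans (length-map neg s) (∈-allSeqs⁻ n s∈))) ⟩
  (∑[ s ∈ allSeqs n ] (hits n (map neg s) s + hits n (reverse (map neg s)) s))
    ≡⟨ ∑-+ (allSeqs n) (λ s → hits n (map neg s) s) (λ s → hits n (reverse (map neg s)) s) ⟩
  (∑[ s ∈ allSeqs n ] hits n (map neg s) s) + (∑[ s ∈ allSeqs n ] hits n (reverse (map neg s)) s)
    ≡⟨ cong₂ _+_ (∑-rotations m pos) (∑-reflections m pos) ⟩
  2 * (m * O) + m * 2 ^ m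
    ≡⟨ cong (λ k → 2 * (m * O) + m * k) (∑-lyndon-countPlus m pos) ⟨
  2 * (m * O) + m * (2 * C)
    ≡⟨ arrange m O C ⟩
  2 * m * (C + O)
    ≡⟨ cong (2 * m *_) (2*∑-halfLyndon m) ⟨
  2 * m * (2 * ∑-factorisations m (λ p l → halfLyndon p))
    ≡⟨ cong (λ k → 2 * m * (2 * k)) (F≡ m pos) ⟨
  2 * m * (2 * F n)
    ≡⟨ arrange′ m (F n) ⟩
  F n * (n + n) ∎)
  where
  open ≡-Reasoning
  n = m + m
  posn : 0 < n
  posn = ≤-trans pos (m≤m+n m m)
  instance _ = >-nonZero (≤-trans posn (m≤m+n n n))
  S = ∑[ r ∈ allSeqs n ] ⟦ least? r ⟧ * ⟦ map neg r ∼? r ⟧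
  O = ∑-factorisations m (λ p l → oddLyndon p)
  C = ∑-factorisations m (λ p l → ∑[ v ∈ allSeqs p ] ⟦ lyndon? v ⟧ * countPlus v)
  arrange : ∀ m o c → 2 * (m * o) + m * (2 * c) ≡ 2 * m * (c + o)
  arrange = solve-∀
  arrange′ : ∀ m f → 2 * m * (2 * f) ≡ f * ((m + m) + (m + m))
  arrange′ = solve-∀

-- Reachable classes

≈-refl : ∀ {s} → s ≈ s
≈-refl = EqC.reflexive Move

≈-sym : ∀ {s t} → s ≈ t → t ≈ s
≈-sym = EqC.symmetric Move

≈-trans : ∀ {s t u} → s ≈ t → t ≈ u → s ≈ u
≈-trans = EqC.transitive Move

neg-≈ : ∀ s → s ≈ map neg s
neg-≈ s = EqC.return (invert s)

∼⇒≈ : ∀ {s t} → s ∼ t → s ≈ t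
∼⇒≈ = EqC.fold (EqC.isEquivalence Move) λ
  { (rotation [])      → ≈-refl
  ; (rotation (a ∷ s)) → EqC.return (shift (a ∷ []) s)
  ; (reflection s)     → EqC.return (revers s) }

neg∼-swap : ∀ {s t} → map neg s ∼ t → s ∼ map neg t
neg∼-swap {s} {t} ns∼t = subst (_∼ map neg t) (map-neg-involutive s) (∼-map-neg ns∼t)

-- Complementation commutes with turns and is an involution, so a chain of moves needs at most one
-- complementation, performed first.
≈⇒∼ : ∀ {s t} → s ≈ t → s ∼ t ⊎ map neg s ∼ t
≈⇒∼ = EqC.fold record { refl = inj₁ ∼-refl ; sym = symmetric ; trans = transitive } λ
  { (shift xs ys) → inj₁ (subst (xs ++ ys ∼_) (rotate^-++ xs ys) (rotate^-∼ (length xs) (xs ++ ys)))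
  ; (revers xs)   → inj₁ (reverse-∼ xs)
  ; (invert xs)   → inj₂ ∼-refl }
  where
  symmetric : ∀ {s t} → s ∼ t ⊎ map neg s ∼ t → t ∼ s ⊎ map neg t ∼ s
  symmetric (inj₁ s∼t)  = inj₁ (∼-sym s∼t)
  symmetric (inj₂ ns∼t) = inj₂ (∼-sym (neg∼-swap ns∼t))
  transitive : ∀ {s t u} → s ∼ t ⊎ map neg s ∼ t → t ∼ u ⊎ map neg t ∼ u → s ∼ u ⊎ map neg s ∼ u
  transitive (inj₁ s∼t)  (inj₁ t∼u)  = inj₁ (∼-trans s∼t t∼u)
  transitive (inj₁ s∼t)  (inj₂ nt∼u) = inj₂ (∼-trans (∼-map-neg s∼t) nt∼u)
  transitive (inj₂ ns∼t) (inj₁ t∼u)  = inj₂ (∼-trans ns∼t t∼u)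
  transitive (inj₂ ns∼t) (inj₂ nt∼u) = inj₁ (∼-trans (neg∼-swap ns∼t) nt∼u)

≈-length : ∀ {s t} → s ≈ t → length s ≡ length t
≈-length {s} s≈t with ≈⇒∼ s≈t
... | inj₁ s∼t  = ∼-length s∼t
... | inj₂ ns∼t = trans (sym (length-map neg s)) (∼-length ns∼t)

-- One equation covers all cyclic neighbours, including the pair of last and first sign, and is
-- easily carried along turns and complementation.
Alternating : SignSeq → Set
Alternating s = rotate s ≡ map neg s

alternating? : ∀ s → Dec (Alternating s)
alternating? s = rotate s ≟ʷ map neg s

alternating-rotate : ∀ s → Alternating s → Alternating (rotate s)
alternating-rotate s alt = trans (cong rotate alt) (rotate-map-neg s)

alternating-rotate^ : ∀ i s → Alternating s → Alternating (rotate^ i s)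
alternating-rotate^ zero    s alt = alt
alternating-rotate^ (suc i) s alt = alternating-rotate^ i (rotate s) (alternating-rotate s alt)

alternating-reverse : ∀ s → Alternating s → Alternating (reverse s)
alternating-reverse s alt = begin
  rotate (reverse s)                          ≡⟨ cong (rotate ∘ reverse) (map-neg-involutive s) ⟨
  rotate (reverse (map neg (map neg s)))      ≡⟨ cong (λ u → rotate (reverse (map neg u))) alt ⟨
  rotate (reverse (map neg (rotate s)))       ≡⟨ rotate-reverse-neg-rotate s ⟩
  reverse (map neg s)                         ≡⟨ map-neg-reverse s ⟨
  map neg (reverse s)                         ∎
  where open ≡-Reasoning

alternating-neg : ∀ s → Alternating s → Alternating (map neg s)
alternating-neg s alt = trans (rotate-map-neg s) (cong (map neg) alt)

alternating-∼ : ∀ {s t} → s ∼ t → Alternating s → Alternating t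
alternating-∼ s∼t = proj₁ (EqC.fold {S = λ s t → (Alternating s → Alternating t) × (Alternating t → Alternating s)}
  record { refl = id , id ; sym = λ (f , g) → g , f ; trans = λ (f , g) (f′ , g′) → f′ ∘ f , g ∘ g′ }
  (λ { (rotation s)   → alternating-rotate s , λ alt → rotate-injective (trans alt (sym (rotate-map-neg s)))
     ; (reflection s) → alternating-reverse s , λ alt → subst Alternating (reverse-involutive s) (alternating-reverse (reverse s) alt) })
  s∼t)

double-head : ∀ b t → ¬ Alternating (b ∷ b ∷ t)
double-head b t alt = neg-≢ b (sym (∷-injectiveˡ alt))

double-¬alternating : ∀ as b bs → ¬ Alternating (as ++ b ∷ b ∷ bs)
double-¬alternating as b bs alt = double-head b (bs ++ as)
  (subst Alternating (rotate^-++ as (b ∷ b ∷ bs)) (alternating-rotate^ (length as) (as ++ b ∷ b ∷ bs) alt))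

weight : SignSeq → ℕ
weight s = length s + countPlus s

weight-∼ : ∀ {s t} → s ∼ t → weight s ≡ weight t
weight-∼ s∼t = cong₂ _+_ (∼-length s∼t) (∼-countPlus s∼t)

weight-++ : ∀ s t → weight (s ++ t) ≡ weight s + weight t
weight-++ s t = trans (cong₂ _+_ (length-++ s) (countPlus-++ s t))
  (interchange (length s) (length t) (countPlus s) (countPlus t))
  where
  interchange : ∀ a b c d → (a + b) + (c + d) ≡ (a + c) + (b + d)
  interchange = solve-∀

weight-neg : ∀ s → weight s + weight (map neg s) ≡ length s * 3
weight-neg s rewrite length-map neg s =
  trans (rearrange (length s) (countPlus s) (countPlus (map neg s)))
        (trans (cong (length s + length s +_) (countPlus-neg s)) (triple (length s)))
  where
  rearrange : ∀ n c d → (n + c) + (n + d) ≡ n + n + (d + c)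
  rearrange = solve-∀
  triple : ∀ n → n + n + n ≡ n * 3
  triple = solve-∀

3∣weight-neg : ∀ s → 3 ∣ weight s → 3 ∣ weight (map neg s)
3∣weight-neg s 3∣ = ∣m+n∣m⇒∣n (subst (3 ∣_) (sym (weight-neg s)) (n∣m*n (length s))) 3∣

-- The conditions that characterise the reachable classes: necessary by `reachable⇒good`, sufficient
-- by `good⇒reachable`.
record Good (s : SignSeq) : Set where
  constructor good
  field
    3≤length : 3 ≤ length s
    3∣weight : 3 ∣ weight s
    ¬alt     : ¬ Alternating s

-- A `plus` weighs 2, as do two `minus`; a `minus` weighs 1 and two `plus` weigh 4.
weight-extend⁺ : ∀ a bs → 3 ∣ weight (a ∷ bs) → 3 ∣ weight (neg a ∷ neg a ∷ bs)
weight-extend⁺ plus  bs 3∣ = subst (3 ∣_) (+-suc (suc (length bs)) (countPlus bs)) 3∣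
weight-extend⁺ minus bs 3∣ = subst (3 ∣_) (shape (length bs) (countPlus bs)) (∣m∣n⇒∣m+n ∣-refl 3∣)
  where
  shape : ∀ l c → 3 + (suc l + c) ≡ suc (suc l) + suc (suc c)
  shape = solve-∀

weight-extend⁻ : ∀ a bs → 3 ∣ weight (neg a ∷ neg a ∷ bs) → 3 ∣ weight (a ∷ bs)
weight-extend⁻ plus  bs 3∣ = subst (3 ∣_) (sym (+-suc (suc (length bs)) (countPlus bs))) 3∣
weight-extend⁻ minus bs 3∣ = ∣m+n∣m⇒∣n (subst (3 ∣_) (shape (length bs) (countPlus bs)) 3∣) ∣-refl
  where
  shape : ∀ l c → suc (suc l) + suc (suc c) ≡ 3 + (suc l + c)
  shape = solve-∀

weight-swap : ∀ s t → weight (s ++ t) ≡ weight (t ++ s)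
weight-swap s t = trans (weight-++ s t) (trans (+-comm (weight s) (weight t)) (sym (weight-++ t s)))

reachable⇒good : ∀ {s} → Reachable s → Good s
reachable⇒good base = good ≤-refl (divides 2 refl) λ ()
reachable⇒good (step r (ext as bs a)) with reachable⇒good r
... | good 3≤ 3∣ _ = good
  (≤-trans 3≤ (≤-trans (≤-reflexive (length-++ as)) (≤-trans (+-monoʳ-≤ (length as) (n≤1+n _)) (≤-reflexive (sym (length-++ as))))))
  (subst (3 ∣_) (weight-swap (neg a ∷ neg a ∷ bs) as) (weight-extend⁺ a (bs ++ as) (subst (3 ∣_) (weight-swap as (a ∷ bs)) 3∣)))
  (double-¬alternating as (neg a) bs)

-- When the extended entry is the first one, moving it to the back corresponds to moving its two
-- replacements, that is to two rotation steps of the longer word.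
ext-rotate : ∀ {s s′} → Ext s s′ → ∃ λ t′ → s′ ∼ t′ × Ext (rotate s) t′
ext-rotate (ext [] bs a) = bs ++ neg a ∷ neg a ∷ [] ,
  subst (neg a ∷ neg a ∷ bs ∼_) (rotate^-++ (neg a ∷ neg a ∷ []) bs) (rotate^-∼ 2 (neg a ∷ neg a ∷ bs)) ,
  ext bs [] a
ext-rotate (ext (c ∷ as) bs a) = as ++ neg a ∷ neg a ∷ (bs ∷ʳ c) ,
  subst (c ∷ as ++ neg a ∷ neg a ∷ bs ∼_) (++-assoc as (neg a ∷ neg a ∷ bs) (c ∷ [])) (rotate-∼ (c ∷ as ++ neg a ∷ neg a ∷ bs)) ,
  subst (λ u → Ext u (as ++ neg a ∷ neg a ∷ (bs ∷ʳ c))) (sym (++-assoc as (a ∷ bs) (c ∷ []))) (ext as (bs ∷ʳ c) a)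

ext-rotate^ : ∀ i {s s′} → Ext s s′ → ∃ λ t′ → s′ ∼ t′ × Ext (rotate^ i s) t′
ext-rotate^ zero    e = _ , ∼-refl , e
ext-rotate^ (suc i) e with ext-rotate e
... | _ , s′∼t′ , e′ with ext-rotate^ i e′
...   | u′ , t′∼u′ , e″ = u′ , ∼-trans s′∼t′ t′∼u′ , e″

ext-reverse : ∀ {s s′} → Ext s s′ → ∃ λ t′ → s′ ∼ t′ × Ext (reverse s) t′
ext-reverse (ext as bs a) = reverse (as ++ neg a ∷ neg a ∷ bs) , reverse-∼ (as ++ neg a ∷ neg a ∷ bs) ,
  subst₂ Ext (sym eq₁) (sym eq₂) (ext (reverse bs) (reverse as) a)
  where
  eq₁ : reverse (as ++ a ∷ bs) ≡ reverse bs ++ a ∷ reverse as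
  eq₁ = trans (reverse-++ as (a ∷ bs)) (trans (cong (_++ reverse as) (unfold-reverse a bs)) (++-assoc (reverse bs) (a ∷ []) (reverse as)))
  eq₂ : reverse (as ++ neg a ∷ neg a ∷ bs) ≡ reverse bs ++ neg a ∷ neg a ∷ reverse as
  eq₂ = trans (reverse-++ as (neg a ∷ neg a ∷ bs)) (trans (cong (_++ reverse as) (reverse-++ (neg a ∷ neg a ∷ []) bs))
    (++-assoc (reverse bs) (neg a ∷ neg a ∷ []) (reverse as)))

ext-∼ : ∀ {s s′ t} → Ext s s′ → s ∼ t → ∃ λ t′ → s′ ∼ t′ × Ext t t′
ext-∼ {s} e s∼t with ∼⇒reaches (nonempty e) s∼t
  where
  nonempty : ∀ {s s′} → Ext s s′ → 0 < length s
  nonempty (ext []       bs a) = s≤s z≤n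
  nonempty (ext (_ ∷ _) bs a)  = s≤s z≤n
... | i , _ , inj₁ refl with ext-rotate^ i e
...   | t′ , s′∼t′ , e′ = t′ , s′∼t′ , e′
ext-∼ {s} e s∼t | i , _ , inj₂ refl with ext-reverse e
...   | _ , s′∼u′ , e′ with ext-rotate^ i e′
...     | t′ , u′∼t′ , e″ = t′ , ∼-trans s′∼u′ u′∼t′ , e″

ext-neg : ∀ {s s′} → Ext s s′ → Ext (map neg s) (map neg s′)
ext-neg (ext as bs a) = subst₂ Ext (sym (map-++ neg as (a ∷ bs))) (sym (map-++ neg as (neg a ∷ neg a ∷ bs)))
  (ext (map neg as) (map neg bs) (neg a))

-- Contraction yields a word that is only equivalent to a reachable one, so the extension undoing it
-- has to be carried over to that reachable word.
ext-≈ : ∀ {s s′ t} → Ext s s′ → s ≈ t → ∃ λ t′ → s′ ≈ t′ × Ext t t′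
ext-≈ {s′ = s′} e s≈t with ≈⇒∼ s≈t
... | inj₁ s∼t with ext-∼ e s∼t
...   | t′ , s′∼t′ , e′ = t′ , ∼⇒≈ s′∼t′ , e′
ext-≈ {s′ = s′} e s≈t | inj₂ ns∼t with ext-∼ (ext-neg e) ns∼t
...   | t′ , ns′∼t′ , e′ = t′ , ≈-trans (neg-≈ s′) (∼⇒≈ ns′∼t′) , e′

-- Finding a contraction

final : Sign → SignSeq → Sign
final a []      = a
final a (b ∷ s) = final b s

final-split : ∀ b s → ∃ λ t → b ∷ s ≡ t ∷ʳ final b s
final-split b []      = [] , refl
final-split b (c ∷ s) with final-split c s
... | t , eq = b ∷ t , cong (b ∷_) eq

-- The first alternative is linear alternation, written so that it becomes `Alternating` as soon as
-- the final sign also differs from the first.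
find-double : ∀ a s → (map neg (a ∷ s) ≡ s ∷ʳ neg (final a s)) ⊎
                      (∃ λ us → ∃ λ b → ∃ λ vs → a ∷ s ≡ us ++ b ∷ b ∷ vs)
find-double a []      = inj₁ refl
find-double a (b ∷ s) with a ≟ₛ b
... | yes refl = inj₂ ([] , a , s , refl)
... | no a≢b with find-double b s
...   | inj₁ eq                  = inj₁ (cong₂ _∷_ (sym (≢⇒≡neg a≢b)) eq)
...   | inj₂ (us , c , vs , eq)  = inj₂ (a ∷ us , c , vs , cong (a ∷_) eq)

cyclic-double : ∀ a b s → ¬ Alternating (a ∷ b ∷ s) → ∃ λ c → ∃ λ t → a ∷ b ∷ s ∼ c ∷ c ∷ t
cyclic-double a b s ¬alt with find-double a (b ∷ s)
... | inj₂ (us , c , vs , eq) = c , vs ++ us ,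
  subst (a ∷ b ∷ s ∼_) (trans (cong (rotate^ (length us)) eq) (rotate^-++ us (c ∷ c ∷ vs))) (rotate^-∼ (length us) (a ∷ b ∷ s))
... | inj₁ eq with final b s ≟ₛ a | final-split b s
-- The equal neighbours are the last and the first sign; bringing the last one to the front makes
-- them adjacent.
...   | yes refl | t , split = final b s , t , ∼-sym
  (subst (final b s ∷ final b s ∷ t ∼_) (cong (final b s ∷_) (sym split)) (rotate-∼ (final b s ∷ final b s ∷ t)))
...   | no ≢a | _ = contradiction (trans (cong (λ z → b ∷ s ∷ʳ z) (≢⇒≡neg ≢a)) (sym eq)) ¬alt

replicate-∷ʳ : ∀ j (b : Sign) → replicate j b ∷ʳ b ≡ b ∷ replicate j b
replicate-∷ʳ zero    b = refl
replicate-∷ʳ (suc j) b = cong (b ∷_) (replicate-∷ʳ j b)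

-- Contracting the double sign at the end of a maximal run leaves a double sign behind.
contractible : ∀ b t j → 2 ≤ length t + j →
  ∃ λ c → ∃ λ u → b ∷ b ∷ t ++ replicate j b ∼ c ∷ c ∷ u × ¬ Alternating (neg c ∷ u)
-- All signs agree. With at least four of them, contracting one pair leaves two equal neighbours
-- among the others.
contractible b [] (suc (suc j)) 2≤ = b , b ∷ b ∷ replicate j b , ∼-refl ,
  λ alt → neg-≢ b (sym (∷-injectiveˡ (∷-injectiveʳ alt)))
contractible b [] (suc zero) (s≤s ())
contractible b (c ∷ t) j 2≤ with b ≟ₛ c
-- The run ends here: the contracted sign `neg b` equals the next sign `c`, and together they form
-- the new double.
... | no b≢c = b , c ∷ t ++ replicate j b , ∼-refl ,
  subst (λ d → ¬ Alternating (neg b ∷ d ∷ t ++ replicate j b)) (sym (≢⇒≡neg b≢c)) (double-head (neg b) _)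
... | yes refl with contractible b t (suc j) (subst (2 ≤_) (sym (+-suc (length t) j)) 2≤)
...   | d , u , ∼u , ¬alt = d , u , ∼-trans
  (subst (b ∷ b ∷ b ∷ t ++ replicate j b ∼_)
    (cong (λ z → b ∷ b ∷ z) (trans (++-assoc t (replicate j b) (b ∷ [])) (cong (t ++_) (replicate-∷ʳ j b))))
    (rotate-∼ (b ∷ b ∷ b ∷ t ++ replicate j b))) ∼u , ¬alt

contract : ∀ s → 4 ≤ length s → ¬ Alternating s → ∃ λ c → ∃ λ u → s ∼ c ∷ c ∷ u × ¬ Alternating (neg c ∷ u)
contract (_ ∷ []) (s≤s ()) ¬alt
contract (a ∷ b ∷ s) 4≤ ¬alt with cyclic-double a b s ¬alt
... | c , t , ∼cct with contractible c t 0 (≤-trans (≤-pred (≤-pred (≤-trans 4≤ (≤-reflexive (∼-length ∼cct))))) (≤-reflexive (sym (+-identityʳ (length t)))))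
...   | d , u , ∼ddu , ¬alt′ = d , u , ∼-trans ∼cct (subst (λ z → c ∷ c ∷ z ∼ d ∷ d ∷ u) (++-identityʳ t) ∼ddu) , ¬alt′

-- Contract, apply induction to the shorter good word, and extend its reachable equivalent. For
-- length 3, words with one or two `plus` have weight 4 or 5 and are excluded.
good⇒reachable-length : ∀ k s → length s ≡ 3 + k → Good s → ∃ λ r → s ≈ r × Reachable r
good⇒reachable-length zero (plus ∷ plus ∷ plus ∷ [])    refl g = _ , ≈-refl , base
good⇒reachable-length zero (minus ∷ minus ∷ minus ∷ []) refl g = _ , neg-≈ _ , base
good⇒reachable-length zero (plus ∷ plus ∷ minus ∷ [])   refl (good _ 3∣ _) = contradiction 3∣ (from-no (3 ∣? 5))
good⇒reachable-length zero (plus ∷ minus ∷ plus ∷ [])   refl (good _ 3∣ _) = contradiction 3∣ (from-no (3 ∣? 5))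
good⇒reachable-length zero (minus ∷ plus ∷ plus ∷ [])   refl (good _ 3∣ _) = contradiction 3∣ (from-no (3 ∣? 5))
good⇒reachable-length zero (plus ∷ minus ∷ minus ∷ [])  refl (good _ 3∣ _) = contradiction 3∣ (from-no (3 ∣? 4))
good⇒reachable-length zero (minus ∷ plus ∷ minus ∷ [])  refl (good _ 3∣ _) = contradiction 3∣ (from-no (3 ∣? 4))
good⇒reachable-length zero (minus ∷ minus ∷ plus ∷ [])  refl (good _ 3∣ _) = contradiction 3∣ (from-no (3 ∣? 4))
good⇒reachable-length (suc k) s len (good _ 3∣ ¬alt)
  with contract s (≤-trans (s≤s (s≤s (s≤s (s≤s z≤n)))) (≤-reflexive (sym len))) ¬alt
... | c , u , s∼ , ¬alt′
  with good⇒reachable-length k (neg c ∷ u) len′ (good (≤-trans (s≤s (s≤s (s≤s z≤n))) (≤-reflexive (sym len′)))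
         (weight-extend⁻ (neg c) u (subst (λ d → 3 ∣ weight (d ∷ d ∷ u)) (sym (neg-involutive c)) (subst (3 ∣_) (weight-∼ s∼) 3∣))) ¬alt′)
  where
  len′ : length (neg c ∷ u) ≡ 3 + k
  len′ = suc-injective (trans (sym (∼-length s∼)) len)
... | r , ≈r , reach with ext-≈ (subst (λ d → Ext (neg c ∷ u) (d ∷ d ∷ u)) (neg-involutive c) (ext [] u (neg c))) ≈r
...   | r′ , ≈r′ , e = r′ , ≈-trans (∼⇒≈ s∼) ≈r′ , step reach e

good⇒reachable : ∀ {s} → Good s → ∃ λ r → s ≈ r × Reachable r
good⇒reachable {s} g = good⇒reachable-length (length s ∸ 3) s (sym (m+[n∸m]≡n (Good.3≤length g))) g

good-∼ : ∀ {s t} → s ∼ t → Good s → Good t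
good-∼ s∼t (good 3≤ 3∣ ¬alt) = good (subst (3 ≤_) (∼-length s∼t) 3≤) (subst (3 ∣_) (weight-∼ s∼t) 3∣) (¬alt ∘ alternating-∼ (∼-sym s∼t))

good-neg : ∀ {s} → Good s → Good (map neg s)
good-neg {s} (good 3≤ 3∣ ¬alt) = good (subst (3 ≤_) (sym (length-map neg s)) 3≤) (3∣weight-neg s 3∣)
  (λ alt → ¬alt (subst Alternating (map-neg-involutive s) (alternating-neg (map neg s) alt)))

-- A canonical word for each class

Majority : SignSeq → Set
Majority s = length s < countPlus s + countPlus s

Balanced : SignSeq → Set
Balanced s = length s ≡ countPlus s + countPlus s

mirror : SignSeq → SignSeq
mirror s = canon (map neg s)

-- Of the two complementary bracelets in a class, the one with more `plus` is chosen, and in the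
-- balanced case the one whose least word is not the larger.
Representative : SignSeq → Set
Representative s = Least s × (3 ∣ weight s × (¬ Alternating s × (Majority s ⊎ (Balanced s × binary s ≤ binary (mirror s)))))

majority? : ∀ s → Dec (Majority s)
majority? s = length s <? countPlus s + countPlus s

balanced? : ∀ s → Dec (Balanced s)
balanced? s = length s ≟ countPlus s + countPlus s

representative? : ∀ s → Dec (Representative s)
representative? s = least? s ×-dec (3 ∣? weight s ×-dec (¬? (alternating? s) ×-dec
  (majority? s ⊎-dec (balanced? s ×-dec (binary s ≤? binary (mirror s))))))

mirror-unique : ∀ {s t} → Least t → map neg s ∼ t → mirror s ≡ t
mirror-unique {s} lt ns∼t = least-unique (canon-least (map neg s)) lt (∼-trans (∼-sym (canon-∼ (map neg s))) ns∼t)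

neg∼-countPlus : ∀ {s t} → map neg s ∼ t → countPlus t + countPlus s ≡ length s
neg∼-countPlus {s} ns∼t = trans (cong (_+ countPlus s) (sym (∼-countPlus ns∼t))) (countPlus-neg s)

majority⇒minority : ∀ c d {n} → d + c ≡ n → n < c + c → d + d < n
majority⇒minority c d refl lt = +-monoʳ-< d (+-cancelʳ-< c d c lt)

minority⇒majority : ∀ c d {n} → d + c ≡ n → c + c < n → n < d + d
minority⇒majority c d refl lt = +-monoʳ-< d (+-cancelʳ-< c c d lt)

balanced⇒balanced : ∀ c d {n} → d + c ≡ n → n ≡ c + c → n ≡ d + d
balanced⇒balanced c d refl eq = cong (d +_) (sym (+-cancelʳ-≡ c d c eq))

-- Complementation turns a majority into a minority. If the two words are related through it, both
-- are therefore balanced; each is then the mirror of the other and at most that mirror.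
representative-unique : ∀ {s t} → Representative s → Representative t → s ≈ t → s ≡ t
representative-unique {s} {t} (ls , _ , _ , hs) (lt , _ , _ , ht) s≈t with ≈⇒∼ s≈t
... | inj₁ s∼t  = least-unique ls lt s∼t
... | inj₂ ns∼t = go hs ht
  where
  len : length s ≡ length t
  len = ≈-length s≈t
  sum≡ : countPlus t + countPlus s ≡ length t
  sum≡ = trans (neg∼-countPlus ns∼t) len
  sum≡′ : countPlus s + countPlus t ≡ length s
  sum≡′ = trans (+-comm (countPlus s) (countPlus t)) (trans sum≡ (sym len))
  go : Majority s ⊎ (Balanced s × binary s ≤ binary (mirror s)) → Majority t ⊎ (Balanced t × binary t ≤ binary (mirror t)) → s ≡ t
  go (inj₁ ms) (inj₁ mt)       = contradiction mt (<-asym (majority⇒minority (countPlus s) (countPlus t) sum≡ (subst (_< _) len ms)))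
  go (inj₁ ms) (inj₂ (bt , _)) = contradiction (sym bt) (<⇒≢ (majority⇒minority (countPlus s) (countPlus t) sum≡ (subst (_< _) len ms)))
  go (inj₂ (bs , _)) (inj₁ mt) = contradiction (sym bs) (<⇒≢ (majority⇒minority (countPlus t) (countPlus s) sum≡′ (subst (_< _) (sym len) mt)))
  go (inj₂ (_ , s≤)) (inj₂ (_ , t≤)) = binary-injective s t len (≤-antisym
    (subst (λ u → binary s ≤ binary u) (mirror-unique {s} lt ns∼t) s≤)
    (subst (λ u → binary t ≤ binary u) (mirror-unique {t} ls (∼-sym (neg∼-swap ns∼t))) t≤))

representative-exists : ∀ {s} → Good s → ∃ λ r → s ≈ r × Representative r
representative-exists {s} g with <-cmp (length s) (countPlus s + countPlus s)
... | tri< maj _ _ = canon s , ∼⇒≈ (canon-∼ s) , canon-least s , 3∣weight , ¬alt ,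
  inj₁ (subst₂ (λ n c → n < c + c) (∼-length (canon-∼ s)) (∼-countPlus (canon-∼ s)) maj)
  where open Good (good-∼ (canon-∼ s) g)
... | tri> _ _ min = mirror s , ≈-trans (neg-≈ s) (∼⇒≈ (canon-∼ (map neg s))) , canon-least (map neg s) , 3∣weight , ¬alt ,
  inj₁ (subst (_< countPlus (mirror s) + countPlus (mirror s)) (trans (sym (length-map neg s)) (∼-length (canon-∼ (map neg s))))
    (minority⇒majority (countPlus s) (countPlus (mirror s)) (neg∼-countPlus (canon-∼ (map neg s))) min))
  where open Good (good-∼ (canon-∼ (map neg s)) (good-neg g))
... | tri≈ _ bal _ with binary (canon s) ≤? binary (mirror (canon s))
...   | yes r≤ = canon s , ∼⇒≈ (canon-∼ s) , canon-least s , 3∣weight , ¬alt ,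
  inj₂ (subst₂ (λ n c → n ≡ c + c) (∼-length (canon-∼ s)) (∼-countPlus (canon-∼ s)) bal , r≤)
  where open Good (good-∼ (canon-∼ s) g)
-- The mirror is the smaller of the two and qualifies, because its own mirror is `r` again.
...   | no r≰ = mirror r , ≈-trans (∼⇒≈ s∼r) (≈-trans (neg-≈ r) (∼⇒≈ nr∼)) , canon-least (map neg r) , 3∣weight , ¬alt ,
  inj₂ ( trans (sym len) (balanced⇒balanced (countPlus r) (countPlus (mirror r)) (neg∼-countPlus nr∼) (subst₂ (λ n c → n ≡ c + c) (∼-length s∼r) (∼-countPlus s∼r) bal))
       , ≤-trans (<⇒≤ (≰⇒> r≰)) (≤-reflexive (cong binary (sym (mirror-unique {mirror r} (canon-least s) (∼-sym (neg∼-swap nr∼)))))))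
  where
  r = canon s
  s∼r = canon-∼ s
  nr∼ : map neg r ∼ mirror r
  nr∼ = canon-∼ (map neg r)
  len : length r ≡ length (mirror r)
  len = trans (sym (length-map neg r)) (∼-length nr∼)
  open Good (good-∼ nr∼ (good-neg (good-∼ s∼r g)))

lookup-injective : ∀ {ss} → AllPairs (λ s t → ¬ s ≈ t) ss →
                   ∀ (i j : Fin (length ss)) → lookup ss i ≈ lookup ss j → i ≡ j
lookup-injective (h ∷ hs) Fin.zero    Fin.zero    eq = refl
lookup-injective (h ∷ hs) Fin.zero    (Fin.suc j) eq = contradiction eq (All.lookup h (∈-lookup j))
lookup-injective (h ∷ hs) (Fin.suc i) Fin.zero    eq = contradiction (≈-sym eq) (All.lookup h (∈-lookup i))
lookup-injective (h ∷ hs) (Fin.suc i) (Fin.suc j) eq = cong Fin.suc (lookup-injective hs i j eq)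

classCount : ℕ → ℕ
classCount n = length (filter representative? (allSeqs n))

-- The list must consist of reachable words, whereas a representative is only equivalent to one;
-- `pick` makes the exchange within each class.
hasClassCount : ∀ n → 3 ≤ n → HasClassCount n (classCount n)
hasClassCount n 3≤n = map pick reps , length-map pick reps , All.map⁺ (All.tabulate valid) ,
  lookup-injective (inequivalent reps (Unique.filter⁺ representative? (allSeqs-unique n)) id) , covers
  where
  reps = filter representative? (allSeqs n)
  good? : ∀ s → Dec (Good s)
  good? s = map′ (λ (a , b , c) → good a b c) (λ (good a b c) → a , b , c)
    ((3 ≤? length s) ×-dec (3 ∣? weight s) ×-dec ¬? (alternating? s))
  pick : SignSeq → SignSeq
  pick s with good? s
  ... | yes g = proj₁ (good⇒reachable g)
  -- A default for words that are not good; all entries of `reps` are good.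
  ... | no _  = s
  pick-spec : ∀ s → Good s → s ≈ pick s × Reachable (pick s)
  pick-spec s g with good? s
  ... | yes g′ = proj₂ (good⇒reachable g′)
  ... | no ¬g  = contradiction g ¬g
  rep-good : ∀ {s} → s ∈ reps → length s ≡ n × Representative s × Good s
  rep-good s∈ with ∈-filter⁻ representative? s∈
  ... | s∈all , rep@(_ , 3∣ , ¬alt , _) =
    ∈-allSeqs⁻ n s∈all , rep , good (subst (3 ≤_) (sym (∈-allSeqs⁻ n s∈all)) 3≤n) 3∣ ¬alt
  valid : ∀ {s} → s ∈ reps → length (pick s) ≡ n × Reachable (pick s)
  valid {s} s∈ with rep-good s∈
  ... | len , _ , g with pick-spec s g
  ...   | s≈ , reach = trans (sym (≈-length s≈)) len , reach
  inequivalent : ∀ ss → Unique ss → (∀ {s} → s ∈ ss → s ∈ reps) → AllPairs (λ s t → ¬ s ≈ t) (map pick ss)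
  inequivalent []       []       sub = []
  inequivalent (s ∷ ss) (s∉ ∷ u) sub = All.map⁺ (All.tabulate distinct) ∷ inequivalent ss u (sub ∘ there)
    where
    distinct : ∀ {t} → t ∈ ss → ¬ pick s ≈ pick t
    distinct {t} t∈ eq with rep-good (sub (here refl)) | rep-good (sub (there t∈))
    ... | _ , rs , gs | _ , rt , gt = All.lookup s∉ t∈ (representative-unique rs rt
      (≈-trans (proj₁ (pick-spec s gs)) (≈-trans eq (≈-sym (proj₁ (pick-spec t gt))))))
  covers : ∀ s → length s ≡ n → Reachable s → Any (s ≈_) (map pick reps)
  covers s len reach with representative-exists (reachable⇒good reach)
  ... | r , s≈r , rep = Any.map (λ { refl → ≈-trans s≈r (proj₁ (pick-spec r (proj₂ (proj₂ (rep-good r∈))))) }) (∈-map⁺ pick r∈)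
    where
    r∈ : r ∈ reps
    r∈ = ∈-filter⁺ representative? (∈-allSeqs⁺ r (trans (sym (≈-length s≈r)) len)) rep

-- Counting the classes

m<[1+m/n]*n : ∀ m n .{{_ : NonZero n}} → m < suc (m / n) * n
m<[1+m/n]*n m n = ≤-trans (≤-reflexive (cong suc (m≡m%n+[m/n]*n m n))) (+-monoˡ-≤ (m / n * n) (m%n<n m n))

B≡ : ∀ n k → B n k ≡ (∑[ s ∈ allSeqs n ] ⟦ least? s ⟧ * ⟦ countPlus s ≟ k ⟧)
B≡ n k = trans (length-filter-∑ _ (allSeqs n)) (∑-ext (allSeqs n) λ s → trans
  (⟦⟧-cong (T? ((countPlus s ≡ᵇ k) ∧ isBraceletRep s)) (T? (countPlus s ≡ᵇ k) ×-dec T? (isBraceletRep s))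
    (Equivalence.to T-∧) (Equivalence.from T-∧))
  (trans (⟦⟧-× (T? (countPlus s ≡ᵇ k)) (T? (isBraceletRep s))) (*-comm ⟦ countPlus s ≟ k ⟧ ⟦ least? s ⟧)))

-- As 3 divides n + k, it divides n + c exactly when c lies in the residue class of k. The bound on
-- c keeps the matching index within range.
∑-progression : ∀ {n} N k c → 3 ∣ n + k → c < k + 3 * suc N →
  (∑[ i ∈ upTo (suc N) ] ⟦ c ≟ k + 3 * i ⟧) ≡ ⟦ 3 ∣? n + c ⟧ * ⟦ k ≤? c ⟧
∑-progression {n} N k c 3∣ c< = trans (go (3 ∣? n + c) (k ≤? c)) (⟦⟧-× (3 ∣? n + c) (k ≤? c))
  where
  both? = (3 ∣? n + c) ×-dec (k ≤? c)
  hit⇒both : ∀ i → c ≡ k + 3 * i → 3 ∣ n + c × k ≤ c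
  hit⇒both i refl = subst (3 ∣_) (+-assoc n k (3 * i)) (∣m∣n⇒∣m+n 3∣ (m∣m*n i)) , m≤m+n k (3 * i)
  miss : ¬ (3 ∣ n + c × k ≤ c) → (∑[ i ∈ upTo (suc N) ] ⟦ c ≟ k + 3 * i ⟧) ≡ ⟦ both? ⟧
  miss ¬both = trans (∑-zero (upTo (suc N)) (λ {i} _ → ⟦⟧-no (c ≟ k + 3 * i) (¬both ∘ hit⇒both i))) (sym (⟦⟧-no both? ¬both))
  go : Dec (3 ∣ n + c) → Dec (k ≤ c) → (∑[ i ∈ upTo (suc N) ] ⟦ c ≟ k + 3 * i ⟧) ≡ ⟦ both? ⟧
  go (no ∤) _        = miss (∤ ∘ proj₁)
  go _      (no k≰c) = miss (k≰c ∘ proj₂)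
  go (yes ∣c) (yes k≤c) with ∣m+n∣m⇒∣n (subst (3 ∣_) (trans (cong (n +_) (sym (m+[n∸m]≡n k≤c))) (sym (+-assoc n k (c ∸ k)))) ∣c) 3∣
  ... | divides q eq = trans
    (∑-single _ (Unique.upTo⁺ (suc N)) (∈-upTo⁺ q<)
      (λ {i} _ i≢q → ⟦⟧-no (c ≟ k + 3 * i) (λ eq′ → i≢q (*-cancelˡ-≡ i q 3 (+-cancelˡ-≡ k (3 * i) (3 * q) (trans (sym eq′) c≡))))))
    (trans (⟦⟧-yes (c ≟ k + 3 * q) c≡) (sym (⟦⟧-yes both? (∣c , k≤c))))
    where
    c≡ : c ≡ k + 3 * q
    c≡ = trans (sym (m+[n∸m]≡n k≤c)) (cong (k +_) (trans eq (*-comm q 3)))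
    q< : q < suc N
    q< = *-cancelˡ-< 3 q (suc N) (+-cancelˡ-< k _ _ (subst (_< k + 3 * suc N) c≡ c<))

-- The second hypothesis says that the progression is continued past every possible number of
-- `plus`, so no bracelet is lost at the upper end.
∑-B : ∀ {n} N k → 3 ∣ n + k → n < k + 3 * suc N →
  (∑[ i ∈ upTo (suc N) ] B n (k + 3 * i)) ≡
  (∑[ s ∈ allSeqs n ] ⟦ least? s ⟧ * (⟦ 3 ∣? weight s ⟧ * ⟦ k ≤? countPlus s ⟧))
∑-B {n} N k 3∣ n< = begin
  (∑[ i ∈ upTo (suc N) ] B n (k + 3 * i))
    ≡⟨ ∑-ext (upTo (suc N)) (λ i → B≡ n (k + 3 * i)) ⟩
  (∑[ i ∈ upTo (suc N) ] ∑[ s ∈ allSeqs n ] ⟦ least? s ⟧ * ⟦ countPlus s ≟ k + 3 * i ⟧)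
    ≡⟨ ∑-comm (upTo (suc N)) (allSeqs n) _ ⟩
  (∑[ s ∈ allSeqs n ] ∑[ i ∈ upTo (suc N) ] ⟦ least? s ⟧ * ⟦ countPlus s ≟ k + 3 * i ⟧)
    ≡⟨ ∑-cong (allSeqs n) (λ {s} s∈ → trans (∑-*ˡ (upTo (suc N)) ⟦ least? s ⟧ (λ i → ⟦ countPlus s ≟ k + 3 * i ⟧))
         (cong (⟦ least? s ⟧ *_) (count s (∈-allSeqs⁻ n s∈)))) ⟩
  (∑[ s ∈ allSeqs n ] ⟦ least? s ⟧ * (⟦ 3 ∣? weight s ⟧ * ⟦ k ≤? countPlus s ⟧)) ∎
  where
  open ≡-Reasoning
  count : ∀ s → length s ≡ n → (∑[ i ∈ upTo (suc N) ] ⟦ countPlus s ≟ k + 3 * i ⟧) ≡ ⟦ 3 ∣? weight s ⟧ * ⟦ k ≤? countPlus s ⟧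
  count s refl = ∑-progression {length s} N k (countPlus s) 3∣ (≤-<-trans (countPlus≤length s) n<)

self-complementary⇒balanced : ∀ {s} → map neg s ∼ s → Balanced s
self-complementary⇒balanced ns∼s = sym (neg∼-countPlus ns∼s)

alternating⇒self-complementary : ∀ {s} → Alternating s → map neg s ∼ s
alternating⇒self-complementary {s} alt = subst (_∼ s) alt (∼-sym (rotate-∼ s))

-- Balanced and alternating words need even length, so only majorities remain. These start at q + 1
-- `plus`, but that weight is 3q + 2; the first admissible count is q + 2, of weight 3(q + 1).
classCount-odd : ∀ q → 1 ≤ q →
  classCount (suc (q + q)) ≡ (∑[ i ∈ upTo (suc ((suc (q + q) ∸ 2) / 6)) ] B (suc (q + q)) (q + 2 + 3 * i))
classCount-odd q 1≤q = trans (length-filter-∑ representative? (allSeqs n)) (trans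
  (∑-cong (allSeqs n) (λ {s} s∈ → trans
    (⟦⟧-cong (representative? s) (least? s ×-dec (3 ∣? weight s ×-dec q + 2 ≤? countPlus s))
      (λ (l , 3∣ , _ , h) → l , 3∣ , to s (∈-allSeqs⁻ n s∈) 3∣ h)
      (λ (l , 3∣ , h) → l , 3∣ , unbalanced s (∈-allSeqs⁻ n s∈) ∘ self-complementary⇒balanced ∘ alternating⇒self-complementary ,
                        inj₁ (from s (∈-allSeqs⁻ n s∈) h)))
    (trans (⟦⟧-× (least? s) (3 ∣? weight s ×-dec q + 2 ≤? countPlus s))
           (cong (⟦ least? s ⟧ *_) (⟦⟧-× (3 ∣? weight s) (q + 2 ≤? countPlus s))))))
  (sym (∑-B N (q + 2) (divides (suc q) (3∣ q)) n<)))
  where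
  n = suc (q + q)
  N = (n ∸ 2) / 6
  3∣ : ∀ q → suc (q + q) + (q + 2) ≡ suc q * 3
  3∣ = solve-∀
  n≤ : ∀ n → n ≤ n ∸ 2 + 2
  n≤ n = subst (n ≤_) (+-comm 2 (n ∸ 2)) (m≤n+m∸n n 2)
  n< : n < q + 2 + 3 * suc N
  -- The division gives 2q + 1 ≤ 6N + 8, hence q < 3N + 4, which is the required bound with q + 2
  -- added on both sides.
  n< = subst (suc n ≤_) (shape q N) (s≤s (s≤s (+-monoʳ-≤ q (≤-pred (*-cancelˡ-< 2 q (suc (3 + 3 * N)) (begin-strict
    2 * q                  ≡⟨ cong (q +_) (+-identityʳ q) ⟩
    q + q                  <⟨ n<1+n (q + q) ⟩
    n                      ≤⟨ n≤ n ⟩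
    n ∸ 2 + 2              ≤⟨ +-monoˡ-≤ 2 (<⇒≤ (m<[1+m/n]*n (n ∸ 2) 6)) ⟩
    suc N * 6 + 2          ≡⟨ shape′ N ⟩
    2 * suc (3 + 3 * N)    ∎))))))
    where
    open ≤-Reasoning
    shape : ∀ q N → suc (suc (q + (3 + 3 * N))) ≡ q + 2 + 3 * suc N
    shape = solve-∀
    shape′ : ∀ N → suc N * 6 + 2 ≡ 2 * suc (3 + 3 * N)
    shape′ = solve-∀
  odd≢even : ∀ q c → suc (q + q) ≢ c + c
  odd≢even q c eq = contradiction (trans (sym (par 1 q)) (trans (cong (_% 2) eq) (par 0 c))) λ ()
    where
    par : ∀ r q → (r + (q + q)) % 2 ≡ r % 2
    par r q = trans (cong (λ k → (r + k) % 2) (n+n≡n*2 q)) ([m+kn]%n≡m%n r q 2)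
  unbalanced : ∀ s → length s ≡ n → ¬ Balanced s
  unbalanced s len bal = odd≢even q (countPlus s) (trans (sym len) bal)
  from : ∀ s → length s ≡ n → q + 2 ≤ countPlus s → Majority s
  from s len h = subst (_< countPlus s + countPlus s) (sym len)
    (≤-trans (≤-trans (n≤1+n _) (≤-trans (n≤1+n _) (≤-reflexive (shape q)))) (+-mono-≤ h h))
    where
    shape : ∀ q → suc (suc (suc (suc (q + q)))) ≡ q + 2 + (q + 2)
    shape = solve-∀
  to : ∀ s → length s ≡ n → 3 ∣ weight s → Majority s ⊎ (Balanced s × binary s ≤ binary (mirror s)) → q + 2 ≤ countPlus s
  to s len 3∣w (inj₂ (bal , _)) = contradiction bal (unbalanced s len)
  to s len 3∣w (inj₁ maj) with m≤n⇒m<n∨m≡n (half-< q (countPlus s) (subst (_< countPlus s + countPlus s) len maj))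
    where
    half-< : ∀ q c → suc (q + q) < c + c → suc q ≤ c
    half-< q c lt = *-cancelˡ-< 2 q c (≤-trans (≤-trans (≤-reflexive (cong suc (cong (q +_) (+-identityʳ q)))) (<⇒≤ lt))
      (≤-reflexive (cong (c +_) (sym (+-identityʳ c)))))
  ... | inj₁ lt = subst (_≤ countPlus s) (+-comm 2 q) lt
  ... | inj₂ eq = contradiction (∣m+n∣m⇒∣n (subst (3 ∣_) (trans (cong₂ _+_ len (sym eq)) (shape q)) 3∣w) (n∣m*n q)) (from-no (3 ∣? 2))
    where
    shape : ∀ q → suc (q + q) + suc q ≡ q * 3 + 2
    shape = solve-∀

-- The alternating bracelet and the balanced bracelets

alternating-step : ∀ {a} s t {y z} → s ∷ʳ y ≡ neg a ∷ map neg s → t ∷ʳ z ≡ neg a ∷ map neg t → length s ≡ length t → s ≡ t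
alternating-step []      []      eq eq′ len = refl
alternating-step (b ∷ s) (c ∷ t) eq eq′ len with ∷-injectiveˡ eq | ∷-injectiveˡ eq′
... | refl | refl = cong (_ ∷_) (alternating-step s t (∷-injectiveʳ eq) (∷-injectiveʳ eq′) (suc-injective len))

-- An alternating word is determined by its length and first sign; those with opposite first signs
-- are one rotation step apart.
alternating-unique : ∀ s t → Alternating s → Alternating t → length s ≡ length t → s ∼ t
alternating-unique []      []      _  _  _   = ∼-refl
alternating-unique (a ∷ s) (b ∷ t) as at len with a ≟ₛ b
... | yes refl = subst (λ u → a ∷ s ∼ a ∷ u) (alternating-step s t as at (suc-injective len)) ∼-refl
... | no a≢b with ≢⇒≡neg a≢b
...   | refl = subst (a ∷ s ∼_)
  (trans as (cong (neg a ∷_) (alternating-step (map neg s) t (alternating-neg (a ∷ s) as) at (trans (length-map neg s) (suc-injective len)))))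
  (rotate-∼ (a ∷ s))

-- This single bracelet meets every other condition on representatives without being reachable: it
-- is the source of the -1 in the formula.
∑-alternating : ∀ m → (∑[ s ∈ allSeqs (m + m) ] ⟦ least? s ⟧ * ⟦ alternating? s ⟧) ≡ 1
∑-alternating m = trans
  (∑-allSeqs-single r _ len-r (λ {s} len s≢ → trans (sym (⟦⟧-× (least? s) (alternating? s)))
    (⟦⟧-no (least? s ×-dec alternating? s) (λ (l , alt) → s≢ (least-unique l (canon-least w)
      (alternating-unique s r alt alt-r (trans len (sym len-r))))))))
  (cong₂ _*_ (⟦⟧-yes (least? r) (canon-least w)) (⟦⟧-yes (alternating? r) alt-r))
  where
  w = power m (minus ∷ plus ∷ [])
  r = canon w
  len-r : length r ≡ m + m
  len-r = trans (sym (∼-length (canon-∼ w))) (trans (length-power m (minus ∷ plus ∷ [])) (sym (n+n≡n*2 m)))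
  map-neg-power : ∀ l u → power l (map neg u) ≡ map neg (power l u)
  map-neg-power zero    u = refl
  map-neg-power (suc l) u = trans (cong (map neg u ++_) (map-neg-power l u)) (sym (map-++ neg u (power l u)))
  alt-r : Alternating r
  alt-r = alternating-∼ (canon-∼ w) (trans (rotate-power m (minus ∷ plus ∷ [])) (map-neg-power m (minus ∷ plus ∷ [])))

balancedLeast? : ∀ s → Dec (Least s × Balanced s)
balancedLeast? s = least? s ×-dec balanced? s

-- `mirror` is an involution of the balanced least words, and reindexing along it exchanges the two
-- comparisons.
∑-mirror : ∀ n → (∑[ s ∈ filter balancedLeast? (allSeqs n) ] ⟦ binary s ≤? binary (mirror s) ⟧) ≡
                 (∑[ s ∈ filter balancedLeast? (allSeqs n) ] ⟦ binary (mirror s) ≤? binary s ⟧)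
∑-mirror n = trans
  (∑-cong S (λ {s} s∈ → cong (λ u → ⟦ binary u ≤? binary (mirror s) ⟧) (sym (proj₂ (mirror-closed s∈)))))
  (∑-reindex mirror mirror unique unique mirror-closed mirror-closed (λ s → ⟦ binary (mirror s) ≤? binary s ⟧))
  where
  S = filter balancedLeast? (allSeqs n)
  unique = Unique.filter⁺ balancedLeast? (allSeqs-unique n)
  mirror-closed : ∀ {s} → s ∈ S → mirror s ∈ S × mirror (mirror s) ≡ s
  mirror-closed {s} s∈ with ∈-filter⁻ balancedLeast? s∈
  ... | s∈all , l , bal = ∈-filter⁺ balancedLeast? (∈-allSeqs⁺ (mirror s) (trans (sym len) (∈-allSeqs⁻ n s∈all)))
      (canon-least (map neg s) , trans (sym len) (balanced⇒balanced (countPlus s) (countPlus (mirror s)) (neg∼-countPlus ns∼) bal))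
    , mirror-unique {mirror s} l (∼-sym (neg∼-swap ns∼))
    where
    ns∼ : map neg s ∼ mirror s
    ns∼ = canon-∼ (map neg s)
    len : length s ≡ length (mirror s)
    len = trans (sym (length-map neg s)) (∼-length ns∼)

-- Complementation acts as the involution mirror on balanced bracelets, and s ≤ mirror s picks one
-- bracelet from each of its orbits.
2*∑-mirror-minimal : ∀ m → 0 < m →
  2 * (∑[ s ∈ allSeqs (m + m) ] ⟦ balancedLeast? s ⟧ * ⟦ binary s ≤? binary (mirror s) ⟧) ≡ B (m + m) m + F (m + m)
2*∑-mirror-minimal m pos = begin
  2 * (∑[ s ∈ allSeqs n ] ⟦ balancedLeast? s ⟧ * ⟦ binary s ≤? binary (mirror s) ⟧)
    ≡⟨ cong (2 *_) (∑-filter balancedLeast? (allSeqs n) (λ s → ⟦ binary s ≤? binary (mirror s) ⟧)) ⟨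
  2 * (∑[ s ∈ S ] ⟦ binary s ≤? binary (mirror s) ⟧)
    ≡⟨ cong ((∑[ s ∈ S ] ⟦ binary s ≤? binary (mirror s) ⟧) +_) (trans (+-identityʳ _) (∑-mirror n)) ⟩
  (∑[ s ∈ S ] ⟦ binary s ≤? binary (mirror s) ⟧) + (∑[ s ∈ S ] ⟦ binary (mirror s) ≤? binary s ⟧)
    ≡⟨ ∑-+ S (λ s → ⟦ binary s ≤? binary (mirror s) ⟧) (λ s → ⟦ binary (mirror s) ≤? binary s ⟧) ⟨
  (∑[ s ∈ S ] (⟦ binary s ≤? binary (mirror s) ⟧ + ⟦ binary (mirror s) ≤? binary s ⟧))
    ≡⟨ ∑-cong S (λ {s} s∈ → tally s (proj₁ (proj₂ (∈-filter⁻ balancedLeast? {xs = allSeqs n} s∈)))) ⟩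
  (∑[ s ∈ S ] (1 + ⟦ map neg s ∼? s ⟧))
    ≡⟨ ∑-filter balancedLeast? (allSeqs n) (λ s → 1 + ⟦ map neg s ∼? s ⟧) ⟩
  (∑[ s ∈ allSeqs n ] ⟦ balancedLeast? s ⟧ * (1 + ⟦ map neg s ∼? s ⟧))
    ≡⟨ ∑-cong (allSeqs n) (λ {s} s∈ → term s (∈-allSeqs⁻ n s∈)) ⟩
  (∑[ s ∈ allSeqs n ] (⟦ least? s ⟧ * ⟦ countPlus s ≟ m ⟧ + ⟦ least? s ⟧ * ⟦ map neg s ∼? s ⟧))
    ≡⟨ ∑-+ (allSeqs n) (λ s → ⟦ least? s ⟧ * ⟦ countPlus s ≟ m ⟧) (λ s → ⟦ least? s ⟧ * ⟦ map neg s ∼? s ⟧) ⟩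
  (∑[ s ∈ allSeqs n ] ⟦ least? s ⟧ * ⟦ countPlus s ≟ m ⟧) + (∑[ s ∈ allSeqs n ] ⟦ least? s ⟧ * ⟦ map neg s ∼? s ⟧)
    ≡⟨ cong₂ _+_ (sym (B≡ n m)) (∑-self-complementary m pos) ⟩
  B n m + F n ∎
  where
  open ≡-Reasoning
  n = m + m
  S = filter balancedLeast? (allSeqs n)
  tally : ∀ s → Least s → ⟦ binary s ≤? binary (mirror s) ⟧ + ⟦ binary (mirror s) ≤? binary s ⟧ ≡ 1 + ⟦ map neg s ∼? s ⟧
  -- Both comparisons hold exactly for a bracelet equal to its own complement; otherwise exactly one
  -- holds.
  tally s l with <-cmp (binary s) (binary (mirror s))
  ... | tri< lt ≢ _ = cong₂ _+_ (⟦⟧-yes (binary s ≤? binary (mirror s)) (<⇒≤ lt))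
    (trans (⟦⟧-no (binary (mirror s) ≤? binary s) (<⇒≱ lt))
           (sym (⟦⟧-no (map neg s ∼? s) (λ ns∼s → ≢ (cong binary (sym (mirror-unique {s} l ns∼s)))))))
  ... | tri> _ ≢ gt = trans (cong₂ _+_ (⟦⟧-no (binary s ≤? binary (mirror s)) (<⇒≱ gt)) (⟦⟧-yes (binary (mirror s) ≤? binary s) (<⇒≤ gt)))
    (cong suc (sym (⟦⟧-no (map neg s ∼? s) (λ ns∼s → ≢ (cong binary (sym (mirror-unique {s} l ns∼s)))))))
  ... | tri≈ _ eq _ = cong₂ _+_ (⟦⟧-yes (binary s ≤? binary (mirror s)) (≤-reflexive eq))
    (trans (⟦⟧-yes (binary (mirror s) ≤? binary s) (≤-reflexive (sym eq)))
           (sym (⟦⟧-yes (map neg s ∼? s) (subst (map neg s ∼_) (sym s≡) (canon-∼ (map neg s))))))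
    where
    s≡ : s ≡ mirror s
    s≡ = binary-injective s (mirror s) (trans (sym (length-map neg s)) (∼-length (canon-∼ (map neg s)))) eq
  term : ∀ s → length s ≡ n → ⟦ balancedLeast? s ⟧ * (1 + ⟦ map neg s ∼? s ⟧) ≡
                              ⟦ least? s ⟧ * ⟦ countPlus s ≟ m ⟧ + ⟦ least? s ⟧ * ⟦ map neg s ∼? s ⟧
  term s len = begin
    ⟦ balancedLeast? s ⟧ * (1 + ⟦ map neg s ∼? s ⟧)
      ≡⟨ cong (_* (1 + ⟦ map neg s ∼? s ⟧)) (⟦⟧-× (least? s) (balanced? s)) ⟩
    ⟦ least? s ⟧ * ⟦ balanced? s ⟧ * (1 + ⟦ map neg s ∼? s ⟧)
      ≡⟨ expand ⟦ least? s ⟧ ⟦ balanced? s ⟧ ⟦ map neg s ∼? s ⟧ ⟩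
    ⟦ least? s ⟧ * ⟦ balanced? s ⟧ + ⟦ least? s ⟧ * (⟦ balanced? s ⟧ * ⟦ map neg s ∼? s ⟧)
      ≡⟨ cong₂ (λ a b → ⟦ least? s ⟧ * a + ⟦ least? s ⟧ * b)
           (⟦⟧-cong (balanced? s) (countPlus s ≟ m)
             (λ bal → n+n-injective {countPlus s} {m} (trans (sym bal) len))
             (λ eq → trans len (cong₂ _+_ (sym eq) (sym eq))))
           (trans (sym (⟦⟧-× (balanced? s) (map neg s ∼? s)))
                  (⟦⟧-cong (balanced? s ×-dec map neg s ∼? s) (map neg s ∼? s) proj₂ (λ ns∼s → self-complementary⇒balanced ns∼s , ns∼s))) ⟩
    ⟦ least? s ⟧ * ⟦ countPlus s ≟ m ⟧ + ⟦ least? s ⟧ * ⟦ map neg s ∼? s ⟧ ∎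
    where
    expand : ∀ a b c → a * b * (1 + c) ≡ a * b + a * (b * c)
    expand = solve-∀

-- Here U counts the majority bracelets and V the balanced ones up to complement, alternating one
-- included. Then H + 1 = U + V, 2V = B + F, and the sum of bracelet numbers is U + B, its first
-- term being the balanced ones.
classCount-even : ∀ m → 0 < m →
  2 * classCount (m + m) + 2 + B (m + m) m ≡
  F (m + m) + 2 * (∑[ i ∈ upTo (suc ((m + m) / 6)) ] B (m + m) (m + 3 * i))
classCount-even m pos = begin
  2 * classCount n + 2 + B n m
    ≡⟨ regroup (classCount n) (B n m) ⟩
  2 * (classCount n + 1) + B n m
    ≡⟨ cong (λ k → 2 * k + B n m) split ⟩
  2 * (U + V) + B n m
    ≡⟨ cong (_+ B n m) (*-distribˡ-+ 2 U V) ⟩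
  2 * U + 2 * V + B n m
    ≡⟨ cong (λ k → 2 * U + k + B n m) (2*∑-mirror-minimal m pos) ⟩
  2 * U + (B n m + F n) + B n m
    ≡⟨ regroup′ U (B n m) (F n) ⟩
  F n + 2 * (U + B n m)
    ≡⟨ cong (λ k → F n + 2 * k) total ⟨
  F n + 2 * (∑[ i ∈ upTo (suc (n / 6)) ] B n (m + 3 * i)) ∎
  where
  open ≡-Reasoning
  n = m + m
  regroup : ∀ h b → 2 * h + 2 + b ≡ 2 * (h + 1) + b
  regroup = solve-∀
  regroup′ : ∀ u b f → 2 * u + (b + f) + b ≡ f + 2 * (u + b)
  regroup′ = solve-∀
  minimal? : ∀ s → Dec (binary s ≤ binary (mirror s))
  minimal? s = binary s ≤? binary (mirror s)
  U = ∑[ s ∈ allSeqs n ] ⟦ least? s ×-dec (3 ∣? weight s ×-dec majority? s) ⟧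
  V = ∑[ s ∈ allSeqs n ] ⟦ balancedLeast? s ⟧ * ⟦ minimal? s ⟧

  ⟦⟧-⊎ : ∀ {P Q : Set} (d : Dec P) (e : Dec Q) → ¬ (P × Q) → ⟦ d ⊎-dec e ⟧ ≡ ⟦ d ⟧ + ⟦ e ⟧
  ⟦⟧-⊎ (yes p) (yes q) excl = contradiction (p , q) excl
  ⟦⟧-⊎ (yes _) (no _)  excl = refl
  ⟦⟧-⊎ (no _)  (yes _) excl = refl
  ⟦⟧-⊎ (no _)  (no _)  excl = refl

  balanced⇒3∣ : ∀ s → Balanced s → 3 ∣ weight s
  balanced⇒3∣ s bal = divides (countPlus s) (trans (cong (_+ countPlus s) bal) (triple (countPlus s)))
    where
    triple : ∀ c → c + c + c ≡ c * 3
    triple = solve-∀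

  alternating⇒minimal : ∀ s → Least s → Alternating s → Balanced s × binary s ≤ binary (mirror s)
  alternating⇒minimal s l alt = self-complementary⇒balanced ns∼s , ≤-reflexive (cong binary (sym (mirror-unique {s} l ns∼s)))
    where ns∼s = alternating⇒self-complementary alt

  split : classCount n + 1 ≡ U + V
  split = begin
    classCount n + 1
      ≡⟨ cong₂ _+_ (length-filter-∑ representative? (allSeqs n)) (sym (∑-alternating m)) ⟩
    (∑[ s ∈ allSeqs n ] ⟦ representative? s ⟧) + (∑[ s ∈ allSeqs n ] ⟦ least? s ⟧ * ⟦ alternating? s ⟧)
      ≡⟨ ∑-+ (allSeqs n) (λ s → ⟦ representative? s ⟧) (λ s → ⟦ least? s ⟧ * ⟦ alternating? s ⟧) ⟨
    (∑[ s ∈ allSeqs n ] (⟦ representative? s ⟧ + ⟦ least? s ⟧ * ⟦ alternating? s ⟧))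
      ≡⟨ ∑-ext (allSeqs n) term ⟩
    (∑[ s ∈ allSeqs n ] (⟦ least? s ×-dec (3 ∣? weight s ×-dec majority? s) ⟧ + ⟦ balancedLeast? s ⟧ * ⟦ minimal? s ⟧))
      ≡⟨ ∑-+ (allSeqs n) (λ s → ⟦ least? s ×-dec (3 ∣? weight s ×-dec majority? s) ⟧) (λ s → ⟦ balancedLeast? s ⟧ * ⟦ minimal? s ⟧) ⟩
    U + V ∎
    where
    term : ∀ s → ⟦ representative? s ⟧ + ⟦ least? s ⟧ * ⟦ alternating? s ⟧ ≡
                 ⟦ least? s ×-dec (3 ∣? weight s ×-dec majority? s) ⟧ + ⟦ balancedLeast? s ⟧ * ⟦ minimal? s ⟧
    term s = begin
      ⟦ representative? s ⟧ + ⟦ least? s ⟧ * ⟦ alternating? s ⟧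
        ≡⟨ cong (⟦ representative? s ⟧ +_) (⟦⟧-× (least? s) (alternating? s)) ⟨
      ⟦ representative? s ⟧ + ⟦ least? s ×-dec alternating? s ⟧
        ≡⟨ ⟦⟧-⊎ (representative? s) (least? s ×-dec alternating? s) (λ ((_ , _ , ¬alt , _) , (_ , alt)) → ¬alt alt) ⟨
      ⟦ representative? s ⊎-dec (least? s ×-dec alternating? s) ⟧
        ≡⟨ ⟦⟧-cong (representative? s ⊎-dec (least? s ×-dec alternating? s))
             ((least? s ×-dec (3 ∣? weight s ×-dec majority? s)) ⊎-dec (balancedLeast? s ×-dec minimal? s)) to from ⟩
      ⟦ (least? s ×-dec (3 ∣? weight s ×-dec majority? s)) ⊎-dec (balancedLeast? s ×-dec minimal? s) ⟧
        ≡⟨ ⟦⟧-⊎ (least? s ×-dec (3 ∣? weight s ×-dec majority? s)) (balancedLeast? s ×-dec minimal? s)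
             (λ ((_ , _ , maj) , ((_ , bal) , _)) → <⇒≢ maj bal) ⟩
      ⟦ least? s ×-dec (3 ∣? weight s ×-dec majority? s) ⟧ + ⟦ balancedLeast? s ×-dec minimal? s ⟧
        ≡⟨ cong (⟦ least? s ×-dec (3 ∣? weight s ×-dec majority? s) ⟧ +_) (⟦⟧-× (balancedLeast? s) (minimal? s)) ⟩
      ⟦ least? s ×-dec (3 ∣? weight s ×-dec majority? s) ⟧ + ⟦ balancedLeast? s ⟧ * ⟦ minimal? s ⟧ ∎
      where
      to : Representative s ⊎ (Least s × Alternating s) →
           (Least s × (3 ∣ weight s × Majority s)) ⊎ ((Least s × Balanced s) × binary s ≤ binary (mirror s))
      to (inj₁ (l , 3∣ , _ , inj₁ maj))         = inj₁ (l , 3∣ , maj)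
      to (inj₁ (l , _ , _ , inj₂ (bal , min)))  = inj₂ ((l , bal) , min)
      to (inj₂ (l , alt))                       = inj₂ ((l , proj₁ (alternating⇒minimal s l alt)) , proj₂ (alternating⇒minimal s l alt))
      from : (Least s × (3 ∣ weight s × Majority s)) ⊎ ((Least s × Balanced s) × binary s ≤ binary (mirror s)) →
             Representative s ⊎ (Least s × Alternating s)
      from (inj₁ (l , 3∣ , maj)) = inj₁ (l , 3∣ , (λ alt → <⇒≢ maj (proj₁ (alternating⇒minimal s l alt))) , inj₁ maj)
      from (inj₂ ((l , bal) , min)) with alternating? s
      ... | yes alt = inj₂ (l , alt)
      ... | no ¬alt = inj₁ (l , balanced⇒3∣ s bal , ¬alt , inj₂ (bal , min))

  total : (∑[ i ∈ upTo (suc (n / 6)) ] B n (m + 3 * i)) ≡ U + B n m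
  total = begin
    (∑[ i ∈ upTo (suc (n / 6)) ] B n (m + 3 * i))
      ≡⟨ ∑-B (n / 6) m (divides m (triple m)) n< ⟩
    (∑[ s ∈ allSeqs n ] ⟦ least? s ⟧ * (⟦ 3 ∣? weight s ⟧ * ⟦ m ≤? countPlus s ⟧))
      ≡⟨ ∑-cong (allSeqs n) (λ {s} s∈ → term s (∈-allSeqs⁻ n s∈)) ⟩
    (∑[ s ∈ allSeqs n ] (⟦ least? s ×-dec (3 ∣? weight s ×-dec majority? s) ⟧ + ⟦ least? s ⟧ * ⟦ countPlus s ≟ m ⟧))
      ≡⟨ ∑-+ (allSeqs n) (λ s → ⟦ least? s ×-dec (3 ∣? weight s ×-dec majority? s) ⟧) (λ s → ⟦ least? s ⟧ * ⟦ countPlus s ≟ m ⟧) ⟩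
    U + (∑[ s ∈ allSeqs n ] ⟦ least? s ⟧ * ⟦ countPlus s ≟ m ⟧)
      ≡⟨ cong (U +_) (B≡ n m) ⟨
    U + B n m ∎
    where
    triple : ∀ m → m + m + m ≡ m * 3
    triple = solve-∀
    n< : n < m + 3 * suc (n / 6)
    n< = +-monoʳ-< m (*-cancelˡ-< 2 m (3 * suc (n / 6)) (subst₂ _<_ (cong (m +_) (sym (+-identityʳ m))) (sextuple (suc (n / 6)))
           (m<[1+m/n]*n n 6)))
      where
      sextuple : ∀ k → k * 6 ≡ 2 * (3 * k)
      sextuple = solve-∀
    half : ∀ c → n < c + c → m < c
    half c lt = *-cancelˡ-< 2 m c (subst₂ _<_ (cong (m +_) (sym (+-identityʳ m))) (cong (c +_) (sym (+-identityʳ c))) lt)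
    term : ∀ s → length s ≡ n → ⟦ least? s ⟧ * (⟦ 3 ∣? weight s ⟧ * ⟦ m ≤? countPlus s ⟧) ≡
           ⟦ least? s ×-dec (3 ∣? weight s ×-dec majority? s) ⟧ + ⟦ least? s ⟧ * ⟦ countPlus s ≟ m ⟧
    term s len = begin
      ⟦ least? s ⟧ * (⟦ 3 ∣? weight s ⟧ * ⟦ m ≤? countPlus s ⟧)
        ≡⟨ cong (⟦ least? s ⟧ *_) (⟦⟧-× (3 ∣? weight s) (m ≤? countPlus s)) ⟨
      ⟦ least? s ⟧ * ⟦ 3 ∣? weight s ×-dec m ≤? countPlus s ⟧
        ≡⟨ cong (⟦ least? s ⟧ *_) (⟦⟧-cong (3 ∣? weight s ×-dec m ≤? countPlus s)
             ((3 ∣? weight s ×-dec majority? s) ⊎-dec (countPlus s ≟ m)) to from) ⟩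
      ⟦ least? s ⟧ * ⟦ (3 ∣? weight s ×-dec majority? s) ⊎-dec (countPlus s ≟ m) ⟧
        ≡⟨ cong (⟦ least? s ⟧ *_) (⟦⟧-⊎ (3 ∣? weight s ×-dec majority? s) (countPlus s ≟ m)
             (λ ((_ , maj) , eq) → <⇒≢ maj (balanced eq))) ⟩
      ⟦ least? s ⟧ * (⟦ 3 ∣? weight s ×-dec majority? s ⟧ + ⟦ countPlus s ≟ m ⟧)
        ≡⟨ *-distribˡ-+ ⟦ least? s ⟧ ⟦ 3 ∣? weight s ×-dec majority? s ⟧ ⟦ countPlus s ≟ m ⟧ ⟩
      ⟦ least? s ⟧ * ⟦ 3 ∣? weight s ×-dec majority? s ⟧ + ⟦ least? s ⟧ * ⟦ countPlus s ≟ m ⟧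
        ≡⟨ cong (_+ ⟦ least? s ⟧ * ⟦ countPlus s ≟ m ⟧) (⟦⟧-× (least? s) (3 ∣? weight s ×-dec majority? s)) ⟨
      ⟦ least? s ×-dec (3 ∣? weight s ×-dec majority? s) ⟧ + ⟦ least? s ⟧ * ⟦ countPlus s ≟ m ⟧ ∎
      where
      balanced : countPlus s ≡ m → Balanced s
      balanced eq = trans len (cong₂ _+_ (sym eq) (sym eq))
      to : 3 ∣ weight s × m ≤ countPlus s → (3 ∣ weight s × Majority s) ⊎ (countPlus s ≡ m)
      to (3∣ , m≤) with m≤n⇒m<n∨m≡n m≤
      ... | inj₁ m<   = inj₁ (3∣ , subst (_< countPlus s + countPlus s) (sym len) (+-mono-< m< m<))
      ... | inj₂ m≡   = inj₂ (sym m≡)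
      from : (3 ∣ weight s × Majority s) ⊎ (countPlus s ≡ m) → 3 ∣ weight s × m ≤ countPlus s
      from (inj₁ (3∣ , maj)) = 3∣ , <⇒≤ (half (countPlus s) (subst (_< countPlus s + countPlus s) len maj))
      from (inj₂ eq)         = balanced⇒3∣ s (balanced eq) , ≤-reflexive (sym eq)

-- The formula over the rationals

open import Data.Integer using (+_)
open import Data.Rational using (ℚ; ½; -_; _-_; 1ℚ; toℚᵘ) renaming (_+_ to _+ℚ_; _*_ to _*ℚ_; _/_ to _/ℚ_)
open import Data.Rational.Properties using (toℚᵘ-injective; toℚᵘ-fromℚᵘ; toℚᵘ-homo-+)
open import Data.Rational.Unnormalised using (mkℚᵘ; *≡*) renaming (_≃_ to _≃ᵘ_; _+_ to _+ᵘ_)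
import Data.Integer as ℤ
import Data.Integer.Properties as ℤ
import Data.Rational.Solver as ℚ
import Data.Rational.Unnormalised.Properties as ℚᵘ

fromℕ : ℕ → ℚ
fromℕ k = + k /ℚ 1

-- The detour leads through unnormalised rationals, where both sides are explicit fractions with
-- denominator 1.
fromℕ-+ : ∀ j k → fromℕ (j + k) ≡ fromℕ j +ℚ fromℕ k
fromℕ-+ j k = toℚᵘ-injective (begin
  toℚᵘ (fromℕ (j + k))                ≈⟨ toℚᵘ-fromℚᵘ (mkℚᵘ (+ (j + k)) 0) ⟩
  mkℚᵘ (+ (j + k)) 0                  ≈⟨ *≡* (cong (λ i → i ℤ.* + 1) (sym (cong₂ ℤ._+_ (ℤ.*-identityʳ (+ j)) (ℤ.*-identityʳ (+ k))))) ⟩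
  mkℚᵘ (+ j) 0 +ᵘ mkℚᵘ (+ k) 0        ≈⟨ ℚᵘ.+-cong (toℚᵘ-fromℚᵘ (mkℚᵘ (+ j) 0)) (toℚᵘ-fromℚᵘ (mkℚᵘ (+ k) 0)) ⟨
  toℚᵘ (fromℕ j) +ᵘ toℚᵘ (fromℕ k)    ≈⟨ toℚᵘ-homo-+ (fromℕ j) (fromℕ k) ⟨
  toℚᵘ (fromℕ j +ℚ fromℕ k)           ∎)
  where open ℚᵘ.≃-Reasoning

-- Solves the doubled identity of `EvenFormula` for the number of classes, in the shape of the
-- theorem.
halve : ∀ h b f t → 2 * h + 2 + b ≡ f + 2 * t →
  fromℕ h ≡ ((- (½ *ℚ fromℕ b) +ℚ ½ *ℚ fromℕ f) - 1ℚ) +ℚ fromℕ t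
halve h b f t eq = begin
  fromℕ h
    ≡⟨ isolate (fromℕ h) (fromℕ b) ⟩
  (½ *ℚ (((fromℕ h +ℚ fromℕ h) +ℚ (1ℚ +ℚ 1ℚ)) +ℚ fromℕ b) - ½ *ℚ fromℕ b) - 1ℚ
    ≡⟨ cong (λ x → (½ *ℚ x - ½ *ℚ fromℕ b) - 1ℚ) (begin
         ((fromℕ h +ℚ fromℕ h) +ℚ (1ℚ +ℚ 1ℚ)) +ℚ fromℕ b  ≡⟨ cong (λ x → (x +ℚ (1ℚ +ℚ 1ℚ)) +ℚ fromℕ b) (fromℕ-+ h h) ⟨
         (fromℕ (h + h) +ℚ fromℕ 2) +ℚ fromℕ b             ≡⟨ cong (_+ℚ fromℕ b) (fromℕ-+ (h + h) 2) ⟨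
         fromℕ (h + h + 2) +ℚ fromℕ b                      ≡⟨ fromℕ-+ (h + h + 2) b ⟨
         fromℕ (h + h + 2 + b)                             ≡⟨ cong fromℕ (trans (cong (λ k → k + 2 + b) (twice h)) (trans eq (cong (λ k → f + k) (sym (twice t))))) ⟩
         fromℕ (f + (t + t))                               ≡⟨ fromℕ-+ f (t + t) ⟩
         fromℕ f +ℚ fromℕ (t + t)                          ≡⟨ cong (fromℕ f +ℚ_) (fromℕ-+ t t) ⟩
         fromℕ f +ℚ (fromℕ t +ℚ fromℕ t)                   ∎) ⟩
  (½ *ℚ (fromℕ f +ℚ (fromℕ t +ℚ fromℕ t)) - ½ *ℚ fromℕ b) - 1ℚ
    ≡⟨ collect (fromℕ b) (fromℕ f) (fromℕ t) ⟩
  ((- (½ *ℚ fromℕ b) +ℚ ½ *ℚ fromℕ f) - 1ℚ) +ℚ fromℕ t ∎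
  where
  open ≡-Reasoning
  open ℚ.+-*-Solver
  twice : ∀ k → k + k ≡ 2 * k
  twice k = cong (λ j → k + j) (sym (+-identityʳ k))
  isolate : ∀ h b → h ≡ (½ *ℚ (((h +ℚ h) +ℚ (1ℚ +ℚ 1ℚ)) +ℚ b) - ½ *ℚ b) - 1ℚ
  isolate = solve 2 (λ h b → h := (con ½ :* (((h :+ h) :+ (con 1ℚ :+ con 1ℚ)) :+ b) :- con ½ :* b) :- con 1ℚ) refl
  collect : ∀ b f t → (½ *ℚ (f +ℚ (t +ℚ t)) - ½ *ℚ b) - 1ℚ ≡ ((- (½ *ℚ b) +ℚ ½ *ℚ f) - 1ℚ) +ℚ t
  collect = solve 3 (λ b f t → (con ½ :* (f :+ (t :+ t)) :- con ½ :* b) :- con 1ℚ :=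
                               ((:- (con ½ :* b) :+ con ½ :* f) :- con 1ℚ) :+ t) refl

halves : ∀ n → n ≡ n % 2 + (n / 2 + n / 2)
halves n = trans (m≡m%n+[m/n]*n n 2) (cong (λ k → n % 2 + k) (sym (n+n≡n*2 (n / 2))))

OddFormula : ℕ → Set
OddFormula n = classCount n ≡ sumTo ((n ∸ 2) / 6) (λ i → B n (⌈ n /2⌉ + 1 + 3 * i))

EvenFormula : ℕ → Set
EvenFormula n = 2 * classCount n + 2 + B n (n / 2) ≡ F n + 2 * sumTo (n / 6) (λ i → B n (⌈ n /2⌉ + 3 * i))

odd-formula : ∀ q → 3 ≤ suc (q + q) → OddFormula (suc (q + q))
odd-formula zero      (s≤s ())
odd-formula q@(suc _) _ = subst
  (λ k → classCount n ≡ sumTo ((n ∸ 2) / 6) (λ i → B n (k + 3 * i)))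
  (trans (+-suc q 1) (cong (λ k → suc k + 1) (n≡⌊n+n/2⌋ q)))
  (classCount-odd q (s≤s z≤n))
  where n = suc (q + q)

even-formula : ∀ m → 3 ≤ m + m → EvenFormula (m + m)
even-formula m@(suc _) _ = subst₂
  (λ j k → 2 * classCount n + 2 + B n j ≡ F n + 2 * sumTo (n / 6) (λ i → B n (k + 3 * i)))
  (sym ([m+m]/2 m)) (n≡⌈n+n/2⌉ m) (classCount-even m (s≤s z≤n))
  where n = m + m

mainTheorem2 : ∀ (n : ℕ) → 3 ≤ n →
    (n % 2 ≡ 1 →
    Σ ℕ λ h → HasClassCount n h
    × h ≡ sumTo ((n ∸ 2) / 6) (λ i → B n (⌈ n /2⌉ + 1 + 3 * i)))
    × (n % 2 ≡ 0 →
    Σ ℕ λ h → HasClassCount n h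
    × (+ h /ℚ 1) ≡ ((- (½ *ℚ (+ B n (n / 2) /ℚ 1)) +ℚ ½ *ℚ (+ F n /ℚ 1)) - 1ℚ)
    +ℚ (+ sumTo (n / 6) (λ i → B n (⌈ n /2⌉ + 3 * i)) /ℚ 1))
mainTheorem2 n 3≤n =
  (λ odd → classCount n , hasClassCount n 3≤n , oddly n 3≤n odd) ,
  (λ even → classCount n , hasClassCount n 3≤n , halve (classCount n) (B n (n / 2)) (F n)
    (sumTo (n / 6) (λ i → B n (⌈ n /2⌉ + 3 * i))) (evenly n 3≤n even))
  where
  oddly : ∀ n → 3 ≤ n → n % 2 ≡ 1 → OddFormula n
  oddly n 3≤n odd = subst OddFormula (sym n≡) (odd-formula (n / 2) (subst (3 ≤_) n≡ 3≤n))
    where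
    n≡ : n ≡ suc (n / 2 + n / 2)
    n≡ = trans (halves n) (cong (_+ (n / 2 + n / 2)) odd)
  evenly : ∀ n → 3 ≤ n → n % 2 ≡ 0 → EvenFormula n
  evenly n 3≤n even = subst EvenFormula (sym n≡) (even-formula (n / 2) (subst (3 ≤_) n≡ 3≤n))
    where
    n≡ : n ≡ n / 2 + n / 2
    n≡ = trans (halves n) (cong (_+ (n / 2 + n / 2)) even)
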